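{- For every $\gamma>0$ there exist $\delta>0$ and $n_0\in\mathbb{N}$ such that the following holds for all $n>n_0$. If $S\subseteq[n]^2$ is sum-free and $|S|>\left(\frac{3}{5}-\delta\right)n^2$, then $$S\subseteq\left\{(x,y)\in[n]^2 \;\middle|\; \frac{4n}{5}-\gamma n\le x+y<\frac{8n}{5}+\gamma n\right\}.$$
   Context: $[n]=\{1,\dots,n\}$ and $[n]^2=[n]\times[n]$ with coordinatewise addition. A set $S\subseteq[n]^2$ is sum-free if there are no $x,y,z\in S$ (with $x=y$ allowed) such that $x+y=z$. -}

module Defs where

open import Data.Nat as ℕ using (ℕ; _≤_)
open import Data.Integer using (+_)
open import Data.Product using (_×_; _,_; ∃; ∃-syntax)
open import Data.List using (List; length)
open import Data.List.Membership.Propositional using (_∈_)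
open import Data.List.Relation.Unary.Unique.Propositional using (Unique)
open import Data.Rational as ℚ using (ℚ; _/_)
open import Relation.Binary.PropositionalEquality using (_≡_)
open import Relation.Nullary using (¬_)

ℕ→ℚ : ℕ → ℚ
ℕ→ℚ k = + k / 1

InGrid : ℕ → ℕ × ℕ → Set
InGrid n (x , y) = (1 ≤ x × x ≤ n) × (1 ≤ y × y ≤ n)

_⊕_ : ℕ × ℕ → ℕ × ℕ → ℕ × ℕ
(a , b) ⊕ (c , d) = (a ℕ.+ c , b ℕ.+ d)

-- A finite set S ⊆ [n]^2, represented by a duplicate-free list (|S| = length)
record GridSet (n : ℕ) : Set where
  field
    elems  : List (ℕ × ℕ)
    unique : Unique elems
    inGrid : ∀ {p} → p ∈ elems → InGrid n p
open GridSet public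

SumFree : {n : ℕ} → GridSet n → Set
SumFree S = ∀ {x y z} → x ∈ elems S → y ∈ elems S → z ∈ elems S → ¬ (x ⊕ y ≡ z)

card : {n : ℕ} → GridSet n → ℕ
card S = length (elems S)

-- Work with sum-free sets S in a box [X] × [Y].  An element a of S pairs q with q + a, so at least half of the
-- region thus covered is missing; if a is small this reduces |S| ≤ (3/5)XY + O(X + Y) to the box shrunk by 2a.
-- Otherwise take the edge, on the line αx + βy = c, of the convex hull of S ∪ {(0,Y), (X,0)} that crosses the
-- diagonal.  All points below the line are missing, and translation by the contact points pairs the corner triangle
-- αx + βy ≥ 2c with points between the two lines.  With αX + βY = 2c + w, counting areas leaves c² + w² to be
-- bounded below, and 5(c² + w²) = (2c + w)² + (c − 2w)² with (αX + βY)² ≥ 4αβXY gives the constant 3/5.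
--
-- If X = Y = n and |S| is nearly extremal, near-equality forces c ≈ 2w and α ≈ β, whence x + y ≥ (4/5 − γ)n on S.
-- Moreover S is then nearly full on every small box of the strip that is not matched, so that it has elements near
-- (2n/5, 2n/5) and (n/5, 3n/5), and these make further boxes nearly full.  An element z with z₁ + z₂ ≥ (8/5 + γ)n
-- would then yield a nearly full box whose mirror image under w ↦ z − w is also nearly full, although w and z − w
-- cannot both lie in S.

module Submission where

-- The matching of the corner triangle is in general incomplete: when translated back, parts of it
-- stick out of the box or run into the layer already used. With three overflows u, v, z this costs
-- about (u² + v² + z²)/2 in units of area times αβ. The cost is paid from what the final estimate
-- would give away, since 5(c² + w²) exceeds 4αβXY by exactly g² + h², where g = |αX - βY| and h =
-- |c - 2w|. The overflows consume at most 49/50 of this surplus, and the last fiftieth is what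
-- yields stability. This needs w ≤ 1.35c, that is, no light elements in S; the shrinking step, the
-- bound for large shifts and the single-line bound for a light central element serve to exclude
-- them. Shrinking by 2a does not preserve squares, so the density bound has to be proved for
-- rectangles.
--
-- In the stability part each statement that a small box is nearly full loses about k times the
-- previous length, so the next box needs a side beyond the square root of that; hence the hierarchy
-- η ≪ κ ≪ l₂ ≪ l₄ ≪ l₅ ≪ k.
--
-- All sets are duplicate-free lists, and all polynomial inequalities are over ℕ and carry explicit
-- positivity certificates.

module Certificates where

  -- Certificates for polynomial inequalities over ℕ

  open import Data.Bool using (Bool; true; false; T; _∧_)
  open import Data.Bool.Properties using (T-∧)
  open import Data.Empty using (⊥; ⊥-elim)
  open import Data.List using (List; []; _∷_)
  open import Data.Nat
  open import Data.Nat.Properties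
  open import Data.Product using (_×_; _,_)
  open import Data.Unit using (⊤; tt)
  open import Data.Vec.N-ary using (N-ary)
  open import Function.Bundles using (Equivalence)
  open import Relation.Binary.PropositionalEquality using (_≡_; refl; sym; trans; cong; cong₂; subst₂)

  infix 9 _·_
  infixl 8 _:*_
  infixl 7 _:+_
  infix 6 _:≤_ _:<_ _:≡_
  infix 2 _⊢_

  data Expr : Set where
    con : ℕ → Expr
    var : ℕ → Expr
    _:+_ _:*_ : Expr → Expr → Expr

  _·_ : ℕ → Expr → Expr
  k · e = con k :* e

  data Relation : Set where
    _:≤_ _:<_ _:≡_ : Expr → Expr → Relation
    absurd : Relation

  record Sequent : Set where
    constructor _⊢_
    field
      hypotheses : List Relation
      conclusion : Relation

  Env : Set
  Env = List ℕ

  value : ℕ → Env → ℕ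
  value _ [] = 0
  value zero (x ∷ ρ) = x
  value (suc i) (_ ∷ ρ) = value i ρ

  ⟦_⟧ : Expr → Env → ℕ
  ⟦ con k ⟧ ρ = k
  ⟦ var i ⟧ ρ = value i ρ
  ⟦ d :+ e ⟧ ρ = ⟦ d ⟧ ρ + ⟦ e ⟧ ρ
  ⟦ d :* e ⟧ ρ = ⟦ d ⟧ ρ * ⟦ e ⟧ ρ

  Holds : Relation → Env → Set
  Holds (d :≤ e) ρ = ⟦ d ⟧ ρ ≤ ⟦ e ⟧ ρ
  Holds (d :< e) ρ = ⟦ d ⟧ ρ < ⟦ e ⟧ ρ
  Holds (d :≡ e) ρ = ⟦ d ⟧ ρ ≡ ⟦ e ⟧ ρ
  Holds absurd ρ = ⊥

  Implies : List Relation → Relation → Env → Set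
  Implies [] r ρ = Holds r ρ
  Implies (h ∷ hs) r ρ = Holds h ρ → Implies hs r ρ

  -- Polynomials in Horner form, as iterated coefficient lists.
  Poly : ℕ → Set
  Poly zero = ℕ
  Poly (suc n) = List (Poly n)

  eval : ∀ n → Poly n → Env → ℕ
  eval zero p ρ = p
  eval (suc n) [] ρ = 0
  eval (suc n) (p ∷ ps) [] = eval n p []
  eval (suc n) (p ∷ ps) (x ∷ ρ) = eval n p ρ + x * eval (suc n) ps (x ∷ ρ)

  constant : ∀ n → ℕ → Poly n
  constant zero k = k
  constant (suc n) k = constant n k ∷ []

  variable′ : ∀ n → ℕ → Poly n
  variable′ zero _ = 0
  variable′ (suc n) zero = constant n 0 ∷ constant n 1 ∷ []
  variable′ (suc n) (suc i) = variable′ n i ∷ []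

  add : ∀ n → Poly n → Poly n → Poly n
  add zero p q = p + q
  add (suc n) [] qs = qs
  add (suc n) ps@(_ ∷ _) [] = ps
  add (suc n) (p ∷ ps) (q ∷ qs) = add n p q ∷ add (suc n) ps qs

  mul : ∀ n → Poly n → Poly n → Poly n
  scale : ∀ n → Poly n → Poly (suc n) → Poly (suc n)
  mul zero p q = p * q
  mul (suc n) [] qs = []
  mul (suc n) (p ∷ ps) qs = add (suc n) (scale n p qs) (constant n 0 ∷ mul (suc n) ps qs)
  scale n p [] = []
  scale n p (q ∷ qs) = mul n p q ∷ scale n p qs

  -- Coefficientwise comparison is sound because the variables range over ℕ. It is far from
  -- complete; the hypotheses that a certificate combines supply the rest.
  dominated : ∀ n → Poly n → Poly n → Bool
  dominated zero p q = p ≤ᵇ q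
  dominated (suc n) [] qs = true
  dominated (suc n) (p ∷ ps) [] = dominated n p (constant n 0) ∧ dominated (suc n) ps []
  dominated (suc n) (p ∷ ps) (q ∷ qs) = dominated n p q ∧ dominated (suc n) ps qs

  normal : ∀ n → Expr → Poly n
  normal n (con k) = constant n k
  normal n (var i) = variable′ n i
  normal n (d :+ e) = add n (normal n d) (normal n e)
  normal n (d :* e) = mul n (normal n d) (normal n e)

  data Fits : ℕ → Env → Set where
    [] : Fits 0 []
    _∷_ : ∀ {n ρ} x → Fits n ρ → Fits (suc n) (x ∷ ρ)

  constant-correct : ∀ {n ρ} → Fits n ρ → ∀ k → eval n (constant n k) ρ ≡ k
  constant-correct [] k = refl
  constant-correct (x ∷ f) k = trans (cong₂ _+_ (constant-correct f k) (*-zeroʳ x)) (+-identityʳ k)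

  variable-correct : ∀ {n ρ} → Fits n ρ → ∀ i → eval n (variable′ n i) ρ ≡ value i ρ
  variable-correct [] i = refl
  variable-correct {suc n} {x ∷ ρ} (x ∷ f) zero = cong₂ _+_ (constant-correct f 0)
    (trans (cong (x *_) (trans (cong₂ _+_ (constant-correct f 1) (*-zeroʳ x)) refl)) (*-identityʳ x))
  variable-correct (x ∷ f) (suc i) = trans (cong₂ _+_ (variable-correct f i) (*-zeroʳ x)) (+-identityʳ _)

  interchange : ∀ a b c d → (a + b) + (c + d) ≡ (a + c) + (b + d)
  interchange a b c d = trans (+-assoc a b (c + d)) (trans (cong (a +_) (trans (sym (+-assoc b c d))
    (trans (cong (_+ d) (+-comm b c)) (+-assoc c b d)))) (sym (+-assoc a c (b + d))))

  add-correct : ∀ {n ρ} → Fits n ρ → ∀ p q → eval n (add n p q) ρ ≡ eval n p ρ + eval n q ρ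
  add-correct [] p q = refl
  add-correct (x ∷ f) [] q = refl
  add-correct (x ∷ f) (p ∷ ps) [] = sym (+-identityʳ _)
  add-correct {suc n} {.x ∷ ρ} (x ∷ f) (p ∷ ps) (q ∷ qs) = trans
    (cong₂ _+_ (add-correct f p q) (trans (cong (x *_) (add-correct (x ∷ f) ps qs)) (*-distribˡ-+ x _ _)))
    (interchange (eval n p ρ) (eval n q ρ) _ _)

  mul-correct : ∀ {n ρ} → Fits n ρ → ∀ p q → eval n (mul n p q) ρ ≡ eval n p ρ * eval n q ρ
  scale-correct : ∀ {n x ρ} → Fits n ρ → ∀ p qs → eval (suc n) (scale n p qs) (x ∷ ρ) ≡ eval n p ρ * eval (suc n) qs (x ∷ ρ)
  mul-correct [] p q = refl
  mul-correct (x ∷ f) [] q = refl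
  mul-correct {suc n} {.x ∷ ρ} (x ∷ f) (p ∷ ps) qs = trans (add-correct (x ∷ f) (scale n p qs) _)
    (trans (cong₂ _+_ (scale-correct f p qs) (trans (cong₂ _+_ (constant-correct f 0)
      (trans (cong (x *_) (mul-correct (x ∷ f) ps qs)) (sym (*-assoc x _ _)))) refl))
      (sym (*-distribʳ-+ (eval (suc n) qs (x ∷ ρ)) (eval n p ρ) _)))
  scale-correct {n} {x} {ρ} f p [] = sym (*-zeroʳ (eval n p ρ))
  scale-correct {n} {x} {ρ} f p (q ∷ qs) = trans (cong₂ _+_ (mul-correct f p q) (trans (cong (x *_) (scale-correct f p qs))
    (trans (sym (*-assoc x (eval n p ρ) (eval (suc n) qs (x ∷ ρ)))) (trans (cong (_* eval (suc n) qs (x ∷ ρ)) (*-comm x (eval n p ρ)))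
      (*-assoc (eval n p ρ) x (eval (suc n) qs (x ∷ ρ)))))))
    (sym (*-distribˡ-+ (eval n p ρ) _ _))

  dominated-correct : ∀ {n ρ} → Fits n ρ → ∀ p q → T (dominated n p q) → eval n p ρ ≤ eval n q ρ
  dominated-correct [] p q h = ≤ᵇ⇒≤ p q h
  dominated-correct (x ∷ f) [] q h = z≤n
  dominated-correct {suc n} (x ∷ f) (p ∷ ps) [] h = let h₁ , h₂ = Equivalence.to T-∧ h in
    ≤-trans (+-mono-≤ (≤-trans (dominated-correct f p (constant n 0) h₁) (≤-reflexive (constant-correct f 0)))
      (≤-trans (*-monoʳ-≤ x (dominated-correct (x ∷ f) ps [] h₂)) (≤-reflexive (*-zeroʳ x)))) ≤-refl
  dominated-correct {suc n} (x ∷ f) (p ∷ ps) (q ∷ qs) h = let h₁ , h₂ = Equivalence.to T-∧ h in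
    +-mono-≤ (dominated-correct f p q h₁) (*-monoʳ-≤ x (dominated-correct (x ∷ f) ps qs h₂))

  normal-correct : ∀ {n ρ} → Fits n ρ → ∀ e → eval n (normal n e) ρ ≡ ⟦ e ⟧ ρ
  normal-correct f (con k) = constant-correct f k
  normal-correct f (var i) = variable-correct f i
  normal-correct f (d :+ e) = trans (add-correct f (normal _ d) (normal _ e)) (cong₂ _+_ (normal-correct f d) (normal-correct f e))
  normal-correct f (d :* e) = trans (mul-correct f (normal _ d) (normal _ e)) (cong₂ _*_ (normal-correct f d) (normal-correct f e))

  -- (b − a)(d − c) ≥ 0, written without subtraction.
  mixed-product : ∀ {a b c d} → a ≤ b → c ≤ d → b * c + a * d ≤ b * d + a * c
  mixed-product {a} {b} {c} p q with m≤n⇒∃[o]m+o≡n q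
  ... | v , refl = begin
    b * c + a * (c + v)       ≡⟨ cong (b * c +_) (*-distribˡ-+ a c v) ⟩
    b * c + (a * c + a * v)   ≤⟨ +-monoʳ-≤ (b * c) (+-monoʳ-≤ (a * c) (*-monoˡ-≤ v p)) ⟩
    b * c + (a * c + b * v)   ≡⟨ cong (b * c +_) (+-comm (a * c) (b * v)) ⟩
    b * c + (b * v + a * c)   ≡⟨ sym (+-assoc (b * c) (b * v) (a * c)) ⟩
    b * c + b * v + a * c     ≡⟨ cong (_+ a * c) (sym (*-distribˡ-+ b c v)) ⟩
    b * (c + v) + a * c       ∎
    where open ≤-Reasoning

  -- fwd i k vs: the i-th hypothesis times k and the variables vs; bwd: the same for the converse of an equation;
  -- ff i j k: k times the product of two hypotheses.
  data Step : Set where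
    fwd bwd : ℕ → ℕ → List ℕ → Step
    ff : ℕ → ℕ → ℕ → Step

  monomial : ℕ → List ℕ → Expr
  monomial k [] = con k
  monomial k (i ∷ is) = var i :* monomial k is

  -- Only an equation can be used in both directions. Any other backward use degenerates to `0 ≤ 0`,
  -- as does an index out of range in `pick`, so that every list of steps denotes a valid
  -- inequality.
  forward backward : Relation → Expr × Expr
  forward (d :≤ e) = d , e
  forward (d :< e) = con 1 :+ d , e
  forward (d :≡ e) = d , e
  forward absurd = con 0 , con 0
  backward (d :≡ e) = e , d
  backward _ = con 0 , con 0

  Proofs : List Relation → Env → Set
  Proofs [] ρ = ⊤
  Proofs (h ∷ hs) ρ = Holds h ρ × Proofs hs ρ

  Valid : Expr × Expr → Env → Set
  Valid (d , e) ρ = ⟦ d ⟧ ρ ≤ ⟦ e ⟧ ρ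

  forward-valid : ∀ r {ρ} → Holds r ρ → Valid (forward r) ρ
  forward-valid (d :≤ e) h = h
  forward-valid (d :< e) h = h
  forward-valid (d :≡ e) h = ≤-reflexive h

  backward-valid : ∀ r {ρ} → Holds r ρ → Valid (backward r) ρ
  backward-valid (d :≤ e) h = z≤n
  backward-valid (d :< e) h = z≤n
  backward-valid (d :≡ e) h = ≤-reflexive (sym h)

  pick : (Relation → Expr × Expr) → List Relation → ℕ → Expr × Expr
  pick f [] _ = con 0 , con 0
  pick f (h ∷ hs) zero = f h
  pick f (h ∷ hs) (suc i) = pick f hs i

  pick-valid : ∀ f → (∀ r {ρ} → Holds r ρ → Valid (f r) ρ) → ∀ hs i {ρ} → Proofs hs ρ → Valid (pick f hs i) ρ
  pick-valid f v [] i ps = z≤n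
  pick-valid f v (h ∷ hs) zero (p , _) = v h p
  pick-valid f v (h ∷ hs) (suc i) (_ , ps) = pick-valid f v hs i ps

  times : Expr × Expr → Expr × Expr → ℕ → Expr × Expr
  times (a , b) (c , d) k = (b :* c :+ a :* d) :* con k , (b :* d :+ a :* c) :* con k

  times-valid : ∀ p q k {ρ} → Valid p ρ → Valid q ρ → Valid (times p q k) ρ
  times-valid p q k hp hq = *-monoˡ-≤ k (mixed-product hp hq)

  step : List Relation → Step → Expr × Expr
  step hs (fwd i k is) = let d , e = pick forward hs i in d :* monomial k is , e :* monomial k is
  step hs (bwd i k is) = let d , e = pick backward hs i in d :* monomial k is , e :* monomial k is
  step hs (ff i j k) = times (pick forward hs i) (pick forward hs j) k

  step-valid : ∀ hs s {ρ} → Proofs hs ρ → Valid (step hs s) ρ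
  step-valid hs (fwd i k is) ps = *-monoˡ-≤ (⟦ monomial k is ⟧ _) (pick-valid forward forward-valid hs i ps)
  step-valid hs (bwd i k is) ps = *-monoˡ-≤ (⟦ monomial k is ⟧ _) (pick-valid backward backward-valid hs i ps)
  step-valid hs (ff i j k) ps = times-valid (pick forward hs i) (pick forward hs j) k
    (pick-valid forward forward-valid hs i ps) (pick-valid forward forward-valid hs j ps)

  combine : List Relation → List Step → Expr × Expr
  combine hs [] = con 0 , con 0
  combine hs (s ∷ ss) = let l , r = step hs s ; l′ , r′ = combine hs ss in l :+ l′ , r :+ r′

  combine-valid : ∀ hs ss {ρ} → Proofs hs ρ → Valid (combine hs ss) ρ
  combine-valid hs [] ps = z≤n
  combine-valid hs (s ∷ ss) ps = +-mono-≤ (step-valid hs s ps) (combine-valid hs ss ps)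

  -- The certificate c , steps for L ≤ R is a nonnegative combination l ≤ r of the hypotheses such that
  -- c (R − L) − (r − l) has nonnegative coefficients, where c ≥ 1.
  Certificate : Set
  Certificate = ℕ × List Step

  accepts : ℕ → List Relation → Expr → Expr → Certificate → Bool
  accepts n hs L R (c , ss) = let l , r = combine hs ss in
    (1 ≤ᵇ c) ∧ dominated n (normal n (L :* con c :+ r)) (normal n (R :* con c :+ l))

  -- Avoids subtraction: L c + r ≤ R c + l by comparing coefficients, and l ≤ r by the hypotheses,
  -- so L c + r ≤ R c + r, and then r and c cancel.
  accepted : ∀ {n ρ} → Fits n ρ → ∀ hs L R C → T (accepts n hs L R C) → Proofs hs ρ → ⟦ L ⟧ ρ ≤ ⟦ R ⟧ ρ
  accepted {n} {ρ} f hs L R (c , ss) ok ps = let 1≤c , dom = Equivalence.to T-∧ ok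
                                                 l , r = combine hs ss in
    *-cancelʳ-≤ (⟦ L ⟧ ρ) (⟦ R ⟧ ρ) c {{>-nonZero (≤ᵇ⇒≤ 1 c 1≤c)}}
      (+-cancelʳ-≤ (⟦ r ⟧ ρ) _ _ (≤-trans
        (subst₂ _≤_ (normal-correct f (L :* con c :+ r)) (normal-correct f (R :* con c :+ l))
          (dominated-correct f (normal n (L :* con c :+ r)) (normal n (R :* con c :+ l)) dom))
        (+-monoʳ-≤ (⟦ R ⟧ ρ * c) (combine-valid hs ss ps))))

  accepts-goal : ℕ → List Relation → Relation → List Certificate → Bool
  accepts-goal n hs (d :≤ e) (C ∷ []) = accepts n hs d e C
  accepts-goal n hs (d :< e) (C ∷ []) = accepts n hs (con 1 :+ d) e C
  accepts-goal n hs (d :≡ e) (C ∷ C′ ∷ []) = accepts n hs d e C ∧ accepts n hs e d C′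
  accepts-goal n hs absurd (C ∷ []) = accepts n hs (con 1) (con 0) C
  accepts-goal n hs _ _ = false

  accepted-goal : ∀ {n ρ} → Fits n ρ → ∀ hs g Cs → T (accepts-goal n hs g Cs) → Proofs hs ρ → Holds g ρ
  accepted-goal f hs (d :≤ e) (C ∷ []) ok = accepted f hs d e C ok
  accepted-goal f hs (d :< e) (C ∷ []) ok = accepted f hs (con 1 :+ d) e C ok
  accepted-goal f hs (d :≡ e) (C ∷ C′ ∷ []) ok ps = let ok₁ , ok₂ = Equivalence.to T-∧ ok in
    ≤-antisym (accepted f hs d e C ok₁ ps) (accepted f hs e d C′ ok₂ ps)
  accepted-goal f hs absurd (C ∷ []) ok ps = ⊥-elim (n≮0 (accepted f hs (con 1) (con 0) C ok ps))

  abstract-over : ∀ hs g {ρ} → (Proofs hs ρ → Holds g ρ) → Implies hs g ρ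
  abstract-over [] g k = k tt
  abstract-over (h ∷ hs) g k = λ p → abstract-over hs g (λ ps → k (p , ps))

  ForAll : ℕ → (Env → Set) → Set
  ForAll zero P = P []
  ForAll (suc n) P = ∀ x → ForAll n (λ ρ → P (x ∷ ρ))

  for-all : ∀ n {P : Env → Set} → (∀ {ρ} → Fits n ρ → P ρ) → ForAll n P
  for-all zero k = k []
  for-all (suc n) k = λ x → for-all n (λ f → k (x ∷ f))

  Valid-sequent : Sequent → Env → Set
  Valid-sequent (hs ⊢ g) = Implies hs g

  apply : ∀ n → ℕ → N-ary n Expr Sequent → Sequent
  apply zero i s = s
  apply (suc n) i s = apply n (suc i) (s (var i))

  -- Unfolds to a curried statement about `ℕ` in ordinary notation, so that a certified fact is
  -- applied like any other lemma, without reflection at the point of use.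
  Claim : ∀ n → N-ary n Expr Sequent → Set
  Claim n s = ForAll n (Valid-sequent (apply n 0 s))

  checks : ∀ n → Sequent → List Certificate → Bool
  checks n (hs ⊢ g) Cs = accepts-goal n hs g Cs

  -- certify n (λ x₁ … xₙ → hs ⊢ g) Cs proves the ℕ-statement ∀ x₁ … xₙ → hs → g; it is abstract because with-abstraction
  -- would otherwise normalise certificates.
  abstract
    certify : ∀ n s Cs → {_ : T (checks n (apply n 0 s) Cs)} → Claim n s
    certify n s Cs {ok} = for-all n (λ f → sound (apply n 0 s) f ok)
      where
      sound : ∀ q {ρ} → Fits n ρ → T (checks n q Cs) → Valid-sequent q ρ
      sound (hs ⊢ g) f ok = abstract-over hs g (accepted-goal f hs g Cs ok)

module SumFreeSets where

  open Certificates using (certify; _⊢_; _:≤_; _:<_; _:≡_; absurd; con; _:+_; _:*_; _·_; fwd; bwd; ff)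
  import Data.Bool as Bool
  open import Data.Empty using (⊥; ⊥-elim)
  open import Data.List using (List; []; _∷_; _++_; length; map; filter; upTo; cartesianProduct)
  import Data.List.Membership.DecPropositional as DecMembership
  open import Data.List.Membership.Propositional using (_∈_; _∉_; find; lose)
  open import Data.List.Membership.Propositional.Properties
  open import Data.List.Properties using (length-++; length-map; length-upTo)
  open import Data.List.Relation.Unary.All as All using (All; []; _∷_)
  import Data.List.Relation.Unary.All.Properties as All
  open import Data.List.Relation.Unary.AllPairs using ([]; _∷_)
  open import Data.List.Relation.Unary.Any using (Any; any?; here; there)
  open import Data.List.Relation.Unary.Unique.Propositional using (Unique)
  import Data.List.Relation.Unary.Unique.Propositional.Properties as Unique
  open import Data.Nat
  open import Data.Nat.DivMod using (m≡m%n+[m/n]*n; m%n<n)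
  open import Data.Nat.Induction using (<-rec)
  open import Data.Nat.Properties
  open import Data.Product using (_×_; _,_; proj₁; proj₂; ∃-syntax; swap)
  open import Data.Product.Properties using (≡-dec)
  open import Data.Sum using (_⊎_; inj₁; inj₂)
  open import Function using (_∘_; id)
  open import Relation.Binary.PropositionalEquality using (_≡_; _≢_; refl; sym; trans; cong; cong₂; subst; subst₂)
  open import Relation.Nullary using (¬_; Dec; yes; no; ¬?)
  open import Relation.Nullary.Decidable using (_×-dec_; _⊎-dec_)
  open import Relation.Unary using (Decidable)

  -- Counting points of a box

  Pt : Set
  Pt = ℕ × ℕ

  infixl 6 _⊹_
  _⊹_ : Pt → Pt → Pt
  (a , b) ⊹ (c , d) = a + c , b + d

  module _ where
    open DecMembership (≡-dec _≟_ _≟_) public using (_∈?_)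

  -- The pigeonhole principle behind all the counting: the image of the head is deleted from `ys`.
  -- Injectivity is demanded on `xs` only, because maps such as p ↦ x ∸ p₁ are injective only where
  -- they do not truncate.
  length-≤-injection : {A B : Set} (f : A → B) {xs : List A} {ys : List B} → Unique xs →
    (∀ {x} → x ∈ xs → f x ∈ ys) →
    (∀ {x y} → x ∈ xs → y ∈ xs → f x ≡ f y → x ≡ y) → length xs ≤ length ys
  length-≤-injection f [] _ _ = z≤n
  length-≤-injection f {x ∷ xs} {ys} (x∉ ∷ u) into inj with ∈-∃++ (into (here refl))
  ... | us , vs , refl = subst (suc (length xs) ≤_) (sym len)
    (s≤s (length-≤-injection f u into′ (λ p q → inj (there p) (there q))))
    where
    len : length (us ++ f x ∷ vs) ≡ suc (length (us ++ vs))
    len = trans (length-++ us) (trans (+-suc _ _) (cong suc (sym (length-++ us))))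
    into′ : ∀ {y} → y ∈ xs → f y ∈ us ++ vs
    into′ {y} y∈ with ∈-++⁻ us (into (there y∈))
    ... | inj₁ p = ∈-++⁺ˡ p
    ... | inj₂ (there p) = ∈-++⁺ʳ us p
    ... | inj₂ (here e) = ⊥-elim (All.lookup x∉ y∈ (sym (inj (there y∈) (here refl) e)))

  length-≤-⊆ : {A : Set} {xs ys : List A} → Unique xs → (∀ {x} → x ∈ xs → x ∈ ys) → length xs ≤ length ys
  length-≤-⊆ u sub = length-≤-injection id u sub (λ _ _ e → e)

  unique-map : {A B : Set} (f : A → B) {xs : List A} → Unique xs →
    (∀ {x y} → x ∈ xs → y ∈ xs → f x ≡ f y → x ≡ y) → Unique (map f xs)
  unique-map f [] _ = []
  unique-map f (x∉ ∷ u) inj =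
    All.map⁺ (All.tabulate (λ y∈ e → All.lookup x∉ y∈ (inj (here refl) (there y∈) e)))
    ∷ unique-map f u (λ p q → inj (there p) (there q))

  length-filter-split : {A : Set} {P : A → Set} (P? : Decidable P) (xs : List A) →
    length xs ≡ length (filter P? xs) + length (filter (¬? ∘ P?) xs)
  length-filter-split P? [] = refl
  length-filter-split P? (x ∷ xs) with P? x
  ... | yes _ = cong suc (length-filter-split P? xs)
  ... | no _ = trans (cong suc (length-filter-split P? xs)) (sym (+-suc _ _))

  Box : ℕ → ℕ → Pt → Set
  Box X Y (x , y) = (1 ≤ x × x ≤ X) × (1 ≤ y × y ≤ Y)

  range : ℕ → List ℕ
  range n = map suc (upTo n)

  grid : ℕ → ℕ → List Pt
  grid X Y = cartesianProduct (range X) (range Y)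

  grid-unique : ∀ X Y → Unique (grid X Y)
  grid-unique X Y = Unique.cartesianProduct⁺ (range-unique X) (range-unique Y)
    where
    range-unique : ∀ n → Unique (range n)
    range-unique n = Unique.map⁺ suc-injective (Unique.upTo⁺ n)

  ∈-range⁺ : ∀ {n x} → 1 ≤ x → x ≤ n → x ∈ range n
  ∈-range⁺ {x = suc x} _ x<n = ∈-map⁺ suc (∈-upTo⁺ x<n)

  ∈-range⁻ : ∀ {n x} → x ∈ range n → 1 ≤ x × x ≤ n
  ∈-range⁻ p with ∈-map⁻ suc p
  ... | _ , q , refl = s≤s z≤n , ∈-upTo⁻ q

  ∈-grid⁺ : ∀ {X Y p} → Box X Y p → p ∈ grid X Y
  ∈-grid⁺ ((a , b) , (c , d)) = ∈-cartesianProduct⁺ (∈-range⁺ a b) (∈-range⁺ c d)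

  ∈-grid⁻ : ∀ {X Y p} → p ∈ grid X Y → Box X Y p
  ∈-grid⁻ {X} {Y} p with ∈-cartesianProduct⁻ (range X) (range Y) p
  ... | q , r = ∈-range⁻ q , ∈-range⁻ r

  length-cartesianProduct : {A B : Set} (xs : List A) (ys : List B) →
    length (cartesianProduct xs ys) ≡ length xs * length ys
  length-cartesianProduct [] ys = refl
  length-cartesianProduct (x ∷ xs) ys = trans (length-++ (map (x ,_) ys))
    (cong₂ _+_ (length-map (x ,_) ys) (length-cartesianProduct xs ys))

  length-grid : ∀ X Y → length (grid X Y) ≡ X * Y
  length-grid X Y = trans (length-cartesianProduct (range X) (range Y)) (cong₂ _*_ (len X) (len Y))
    where
    len : ∀ n → length (range n) ≡ n
    len n = trans (length-map suc (upTo n)) (length-upTo n)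

  record SumFreeSet (X Y : ℕ) : Set where
    field
      pts : List Pt
      pts-unique : Unique pts
      pts-inBox : ∀ {p} → p ∈ pts → Box X Y p
      pts-sumFree : ∀ {x y} → x ∈ pts → y ∈ pts → x ⊹ y ∉ pts

    size : ℕ
    size = length pts

  open SumFreeSet public

  -- The pairs {hi i, lo i} are pairwise disjoint, and each contains a non-element of S.
  record Pairing {X Y : ℕ} (S : SumFreeSet X Y) (Ms Is : List Pt) (hi lo : Pt → Pt) : Set where
    field
      missing-unique : Unique Ms
      missing-inBox : ∀ {p} → p ∈ Ms → Box X Y p
      missing : ∀ {p} → p ∈ Ms → p ∉ pts S
      index-unique : Unique Is
      hi-inBox : ∀ {i} → i ∈ Is → Box X Y (hi i)
      lo-inBox : ∀ {i} → i ∈ Is → Box X Y (lo i)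
      hi-or-lo : ∀ {i} → i ∈ Is → hi i ∈ pts S → lo i ∉ pts S
      hi-fresh : ∀ {i} → i ∈ Is → hi i ∉ Ms
      lo-fresh : ∀ {i} → i ∈ Is → lo i ∉ Ms
      hi-injective : ∀ {i j} → i ∈ Is → j ∈ Is → hi i ≡ hi j → i ≡ j
      lo-injective : ∀ {i j} → i ∈ Is → j ∈ Is → lo i ≡ lo j → i ≡ j
      hi≢lo : ∀ {i j} → i ∈ Is → j ∈ Is → hi i ≢ lo j

  -- Let `φ` choose from each pair a member outside S, namely `lo` if `hi` belongs to S and `hi`
  -- otherwise. Then S, `Ms` and the chosen points are disjoint parts of the grid.
  pairing-bound : ∀ {X Y} {S : SumFreeSet X Y} {Ms Is hi lo} → Pairing S Ms Is hi lo →
    size S + (length Ms + length Is) ≤ X * Y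
  pairing-bound {X} {Y} {S} {Ms} {Is} {hi} {lo} P = begin
    size S + (length Ms + length Is)              ≡⟨ cong (λ k → size S + (length Ms + k)) (sym (length-map φ Is)) ⟩
    size S + (length Ms + length (map φ Is))      ≡⟨ cong (size S +_) (sym (length-++ Ms)) ⟩
    size S + length (Ms ++ map φ Is)              ≡⟨ sym (length-++ (pts S)) ⟩
    length (pts S ++ (Ms ++ map φ Is))            ≤⟨ length-≤-⊆ all-unique all-inBox ⟩
    length (grid X Y)                             ≡⟨ length-grid X Y ⟩
    X * Y                                         ∎
    where
    open ≤-Reasoning
    open Pairing P
    φ : Pt → Pt
    φ i with hi i ∈? pts S
    ... | yes _ = lo i
    ... | no _ = hi i
    φ-cases : ∀ i → (φ i ≡ lo i × hi i ∈ pts S) ⊎ (φ i ≡ hi i × hi i ∉ pts S)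
    φ-cases i with hi i ∈? pts S
    ... | yes p = inj₁ (refl , p)
    ... | no p = inj₂ (refl , p)
    φ-injective : ∀ {i j} → i ∈ Is → j ∈ Is → φ i ≡ φ j → i ≡ j
    φ-injective {i} {j} p q e with φ-cases i | φ-cases j
    ... | inj₁ (a , _) | inj₁ (b , _) = lo-injective p q (trans (sym a) (trans e b))
    ... | inj₂ (a , _) | inj₂ (b , _) = hi-injective p q (trans (sym a) (trans e b))
    ... | inj₁ (a , _) | inj₂ (b , _) = ⊥-elim (hi≢lo q p (trans (sym b) (trans (sym e) a)))
    ... | inj₂ (a , _) | inj₁ (b , _) = ⊥-elim (hi≢lo p q (trans (sym a) (trans e b)))
    φ-fresh : ∀ {i} → i ∈ Is → φ i ∉ Ms
    φ-fresh {i} p q with φ-cases i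
    ... | inj₁ (a , _) = lo-fresh p (subst (_∈ Ms) a q)
    ... | inj₂ (a , _) = hi-fresh p (subst (_∈ Ms) a q)
    φ-missing : ∀ {i} → i ∈ Is → φ i ∉ pts S
    φ-missing {i} p q with φ-cases i
    ... | inj₁ (a , b) = hi-or-lo p b (subst (_∈ pts S) a q)
    ... | inj₂ (a , b) = b (subst (_∈ pts S) a q)
    φ-inBox : ∀ {i} → i ∈ Is → Box X Y (φ i)
    φ-inBox {i} p with φ-cases i
    ... | inj₁ (a , _) = subst (Box X Y) (sym a) (lo-inBox p)
    ... | inj₂ (a , _) = subst (Box X Y) (sym a) (hi-inBox p)
    rest-missing : ∀ {p} → p ∈ Ms ++ map φ Is → p ∉ pts S
    rest-missing p with ∈-++⁻ Ms p
    ... | inj₁ q = missing q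
    ... | inj₂ q with ∈-map⁻ φ q
    ... | _ , r , refl = φ-missing r
    rest-unique : Unique (Ms ++ map φ Is)
    rest-unique = Unique.++⁺ missing-unique (unique-map φ index-unique φ-injective) disjoint
      where
      disjoint : ∀ {p} → p ∈ Ms × p ∈ map φ Is → ⊥
      disjoint (p , q) with ∈-map⁻ φ q
      ... | _ , r , refl = φ-fresh r p
    all-unique : Unique (pts S ++ (Ms ++ map φ Is))
    all-unique = Unique.++⁺ (pts-unique S) rest-unique (λ (p , q) → rest-missing q p)
    all-inBox : ∀ {p} → p ∈ pts S ++ (Ms ++ map φ Is) → p ∈ grid X Y
    all-inBox p with ∈-++⁻ (pts S) p
    ... | inj₁ q = ∈-grid⁺ (pts-inBox S q)
    ... | inj₂ q with ∈-++⁻ Ms q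
    ... | inj₁ r = ∈-grid⁺ (missing-inBox r)
    ... | inj₂ r with ∈-map⁻ φ r
    ... | _ , s , refl = ∈-grid⁺ (φ-inBox s)

  -- Lattice points of a triangle

  -- The lattice points of the triangle αi + βj < w in ℕ², whose area is w²/(2αβ). The square from
  -- which they are filtered contains all of them as soon as α, β ≥ 1.
  tri : ℕ → ℕ → ℕ → List Pt
  tri α β w = filter (λ p → α * proj₁ p + β * proj₂ p <? w) (cartesianProduct (upTo w) (upTo w))

  tri-unique : ∀ α β w → Unique (tri α β w)
  tri-unique α β w = Unique.filter⁺ _ (Unique.cartesianProduct⁺ (Unique.upTo⁺ w) (Unique.upTo⁺ w))

  ∈-tri⁻ : ∀ α β w {p} → p ∈ tri α β w → α * proj₁ p + β * proj₂ p < w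
  ∈-tri⁻ α β w p = proj₂ (∈-filter⁻ (λ p → α * proj₁ p + β * proj₂ p <? w) {xs = cartesianProduct (upTo w) (upTo w)} p)

  first-coordinate = certify 5 (λ α β i j w → con 1 :≤ α ∷ α :* i :+ β :* j :< w ∷ [] ⊢ i :< w)
    ((1 , fwd 1 1 [] ∷ fwd 0 1 (2 ∷ []) ∷ []) ∷ [])
  second-coordinate = certify 5 (λ α β i j w → con 1 :≤ β ∷ α :* i :+ β :* j :< w ∷ [] ⊢ j :< w)
    ((1 , fwd 1 1 [] ∷ fwd 0 1 (3 ∷ []) ∷ []) ∷ [])

  ∈-tri⁺ : ∀ α β w {p} → 1 ≤ α → 1 ≤ β → α * proj₁ p + β * proj₂ p < w → p ∈ tri α β w
  ∈-tri⁺ α β w {i , j} 1≤α 1≤β h = ∈-filter⁺ (λ p → α * proj₁ p + β * proj₂ p <? w)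
    (∈-cartesianProduct⁺ (∈-upTo⁺ (first-coordinate α β i j w 1≤α h)) (∈-upTo⁺ (second-coordinate α β i j w 1≤β h))) h

  ceiling-step = certify 3 (λ w b β → b :< w :+ β ∷ [] ⊢ b :< (con 1 :+ w) :+ β)
    ((1 , fwd 0 1 [] ∷ []) ∷ [])
  ceiling-up = certify 3 (λ w k β → con 1 :≤ β ∷ β :* k :≤ w ∷ [] ⊢ β :* (con 1 :+ k) :< (con 1 :+ w) :+ β)
    ((1 , fwd 1 1 [] ∷ []) ∷ [])
  ceiling-covers = certify 3 (λ w k β → con 1 :≤ β ∷ w :≤ β :* k ∷ [] ⊢ (con 1 :+ w) :≤ β :* (con 1 :+ k))
    ((1 , fwd 0 1 [] ∷ fwd 1 1 [] ∷ []) ∷ [])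

  ceiling : ∀ β → 1 ≤ β → ∀ w → ∃[ k ] (w ≤ β * k × β * k < w + β)
  ceiling β 1≤β zero = 0 , z≤n , subst (_< β) (sym (*-zeroʳ β)) 1≤β
  ceiling β 1≤β (suc w) with ceiling β 1≤β w
  ... | k , lo , hi with suc w ≤? β * k
  ... | yes p = k , p , ceiling-step w (β * k) β hi
  ... | no p = suc k , ceiling-covers w k β 1≤β lo , ceiling-up w k β 1≤β (≤-pred (≰⇒> p))

  column-below = certify 4 (λ w j k β → (con 1 :+ j) :≤ k ∷ β :* k :< w :+ β ∷ [] ⊢ β :* j :< w)
    ((1 , fwd 1 1 [] ∷ fwd 0 1 (3 ∷ []) ∷ []) ∷ [])
  column-above = certify 6 (λ w i j k β α → k :≤ j ∷ w :≤ β :* k ∷ α :* i :+ β :* j :< w ∷ [] ⊢ absurd)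
    ((1 , fwd 1 1 [] ∷ fwd 2 1 [] ∷ fwd 0 1 (4 ∷ []) ∷ []) ∷ [])
  shift-up = certify 5 (λ α β i j v → α :* i :+ β :* j :< v ∷ [] ⊢ α :* (con 1 :+ i) :+ β :* j :< α :+ v)
    ((1 , fwd 0 1 [] ∷ []) ∷ [])
  shift-down = certify 5 (λ α β i j v → α :* (con 1 :+ i) :+ β :* j :< α :+ v ∷ [] ⊢ α :* i :+ β :* j :< v)
    ((1 , fwd 0 1 [] ∷ []) ∷ [])
  no-shift = certify 5 (λ α β i j w → w :< α ∷ α :* (con 1 :+ i) :+ β :* j :< w ∷ [] ⊢ absurd)
    ((2 , fwd 0 1 [] ∷ fwd 1 1 [] ∷ []) ∷ [])
  lower-step = certify 6 (λ α β v k T t → v :* v :≤ 2 · (α :* β :* T) ∷ α :+ v :≤ β :* k ∷ k :+ T :≤ t ∷ []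
      ⊢ (α :+ v) :* (α :+ v) :≤ 2 · (α :* β :* t))
    ((1 , fwd 0 1 [] ∷ fwd 1 2 (0 ∷ []) ∷ fwd 2 2 (0 ∷ 1 ∷ []) ∷ []) ∷ [])
  lower-last = certify 5 (λ α β w k t → w :< α ∷ w :≤ β :* k ∷ k :≤ t ∷ [] ⊢ w :* w :≤ 2 · (α :* β :* t))
    ((1 , fwd 0 1 (2 ∷ []) ∷ fwd 1 1 (0 ∷ []) ∷ fwd 2 1 (0 ∷ 1 ∷ []) ∷ []) ∷ [])
  upper-step = certify 6 (λ α β v k T t → 2 · (α :* β :* T) :≤ (v :+ α :+ β) :* (v :+ α :+ β) ∷
      β :* k :< α :+ v :+ β ∷ t :≤ k :+ T ∷ [] ⊢ 2 · (α :* β :* t) :≤ (α :+ v :+ α :+ β) :* (α :+ v :+ α :+ β))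
    ((1 , fwd 0 1 [] ∷ fwd 1 2 (0 ∷ []) ∷ fwd 2 2 (0 ∷ 1 ∷ []) ∷ []) ∷ [])
  upper-last = certify 5 (λ α β w k t → β :* k :< w :+ β ∷ t :≤ k ∷ []
      ⊢ 2 · (α :* β :* t) :≤ (w :+ α :+ β) :* (w :+ α :+ β))
    ((1 , fwd 0 2 (0 ∷ []) ∷ fwd 1 2 (0 ∷ 1 ∷ []) ∷ []) ∷ [])

  -- The column i = 0 has ⌈w/β⌉ points, and the remaining ones shifted left by 1 form the triangle
  -- of level w - α. Both bounds follow by induction on w in steps of α, with a single column left
  -- over when w < α.
  module TriangleCount (α β : ℕ) (1≤α : 1 ≤ α) (1≤β : 1 ≤ β) where

    onAxis? : Decidable (λ (p : Pt) → proj₁ p ≡ 0)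
    onAxis? p = proj₁ p ≟ 0

    column inner : ℕ → List Pt
    column w = filter onAxis? (tri α β w)
    inner w = filter (¬? ∘ onAxis?) (tri α β w)

    ∈-column : ∀ {w p} → p ∈ column w → p ∈ tri α β w × proj₁ p ≡ 0
    ∈-column {w} = ∈-filter⁻ onAxis? {xs = tri α β w}

    ∈-inner : ∀ {w p} → p ∈ inner w → p ∈ tri α β w × ¬ proj₁ p ≡ 0
    ∈-inner {w} = ∈-filter⁻ (¬? ∘ onAxis?) {xs = tri α β w}

    axis-value : ∀ j → α * 0 + β * j ≡ β * j
    axis-value j = cong (_+ β * j) (*-zeroʳ α)

    column-lower : ∀ w k → β * k < w + β → k ≤ length (column w)
    column-lower w k h = subst (_≤ length (column w)) (length-upTo k)
      (length-≤-injection (0 ,_) (Unique.upTo⁺ k)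
        (λ {j} p → ∈-filter⁺ onAxis? (∈-tri⁺ α β w 1≤α 1≤β
          (subst (_< w) (sym (axis-value j)) (column-below w j k β (∈-upTo⁻ p) h))) refl)
        (λ _ _ → cong proj₂))

    column-upper : ∀ w k → w ≤ β * k → length (column w) ≤ k
    column-upper w k h = subst (length (column w) ≤_) (length-upTo k)
      (length-≤-injection proj₂ (Unique.filter⁺ onAxis? (tri-unique α β w)) into inj)
      where
      into : ∀ {p} → p ∈ column w → proj₂ p ∈ upTo k
      into {i , j} p with k ≤? j
      ... | yes k≤j = ⊥-elim (column-above w i j k β α k≤j h (∈-tri⁻ α β w (proj₁ (∈-column {w} p))))
      ... | no k≰j = ∈-upTo⁺ (≰⇒> k≰j)
      inj : ∀ {p q} → p ∈ column w → q ∈ column w → proj₂ p ≡ proj₂ q → p ≡ q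
      inj {i , j} {i′ , j′} p q refl with ∈-column {w} p | ∈-column {w} q
      ... | _ , refl | _ , refl = refl

    inner-lower : ∀ v → length (tri α β v) ≤ length (inner (α + v))
    inner-lower v = length-≤-injection (λ p → suc (proj₁ p) , proj₂ p) (tri-unique α β v)
      (λ {p} q → ∈-filter⁺ (¬? ∘ onAxis?)
        (∈-tri⁺ α β (α + v) 1≤α 1≤β (shift-up α β (proj₁ p) (proj₂ p) v (∈-tri⁻ α β v q))) (λ ()))
      (λ { {i , j} {i′ , j′} _ _ refl → refl })

    inner-upper : ∀ v → length (inner (α + v)) ≤ length (tri α β v)
    inner-upper v = length-≤-injection (λ p → pred (proj₁ p) , proj₂ p)
      (Unique.filter⁺ (¬? ∘ onAxis?) (tri-unique α β (α + v))) into inj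
      where
      into : ∀ {p} → p ∈ inner (α + v) → (pred (proj₁ p) , proj₂ p) ∈ tri α β v
      into {zero , j} p = ⊥-elim (proj₂ (∈-inner {α + v} p) refl)
      into {suc i , j} p = ∈-tri⁺ α β v 1≤α 1≤β
        (shift-down α β i j v (∈-tri⁻ α β (α + v) (proj₁ (∈-inner {α + v} p))))
      inj : ∀ {p q} → p ∈ inner (α + v) → q ∈ inner (α + v) →
        (pred (proj₁ p) , proj₂ p) ≡ (pred (proj₁ q) , proj₂ q) → p ≡ q
      inj {zero , _} p _ _ = ⊥-elim (proj₂ (∈-inner {α + v} p) refl)
      inj {suc _ , _} {zero , _} _ q _ = ⊥-elim (proj₂ (∈-inner {α + v} q) refl)
      inj {suc _ , _} {suc _ , _} _ _ refl = refl

    inner-empty : ∀ w → w < α → length (inner w) ≤ 0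
    inner-empty w w<α = length-≤-injection {B = Pt} (λ p → p) {ys = []}
      (Unique.filter⁺ (¬? ∘ onAxis?) (tri-unique α β w)) (λ p → ⊥-elim (impossible p)) (λ p → ⊥-elim (impossible p))
      where
      impossible : ∀ {p} → p ∈ inner w → ⊥
      impossible {zero , j} p = proj₂ (∈-inner {w} p) refl
      impossible {suc i , j} p = no-shift α β i j w w<α (∈-tri⁻ α β w (proj₁ (∈-inner {w} p)))

    split : ∀ w → length (tri α β w) ≡ length (column w) + length (inner w)
    split w = length-filter-split onAxis? (tri α β w)

    lower : ∀ w → w * w ≤ 2 * (α * β * length (tri α β w))
    lower = <-rec _ step
      where
      step : ∀ w → (∀ {v} → v < w → v * v ≤ 2 * (α * β * length (tri α β v))) →
        w * w ≤ 2 * (α * β * length (tri α β w))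
      step w ih with ceiling β 1≤β w
      ... | k , covers , tight with α ≤? w
      ... | no α≰w = lower-last α β w k _ (≰⇒> α≰w) covers
        (≤-trans (column-lower w k tight) (≤-trans (m≤m+n _ _) (≤-reflexive (sym (split w)))))
      ... | yes α≤w with m≤n⇒∃[o]m+o≡n α≤w
      ... | v , refl = lower-step α β v k _ _ (ih (m<n+m v 1≤α)) covers
        (≤-trans (+-mono-≤ (column-lower w k tight) (inner-lower v)) (≤-reflexive (sym (split w))))

    upper : ∀ w → 2 * (α * β * length (tri α β w)) ≤ (w + α + β) * (w + α + β)
    upper = <-rec _ step
      where
      step : ∀ w → (∀ {v} → v < w → 2 * (α * β * length (tri α β v)) ≤ (v + α + β) * (v + α + β)) →
        2 * (α * β * length (tri α β w)) ≤ (w + α + β) * (w + α + β)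
      step w ih with ceiling β 1≤β w
      ... | k , covers , tight with α ≤? w
      ... | no α≰w = upper-last α β w k _ tight (≤-trans (≤-reflexive (split w))
        (≤-trans (+-mono-≤ (column-upper w k covers) (inner-empty w (≰⇒> α≰w))) (≤-reflexive (+-identityʳ k))))
      ... | yes α≤w with m≤n⇒∃[o]m+o≡n α≤w
      ... | v , refl = upper-step α β v k _ _ (ih (m<n+m v 1≤α)) tight
        (≤-trans (≤-reflexive (split w)) (+-mono-≤ (column-upper w k covers) (inner-upper v)))

  tri-lower : ∀ α β w → 1 ≤ α → 1 ≤ β → w * w ≤ 2 * (α * β * length (tri α β w))
  tri-lower α β w p q = TriangleCount.lower α β p q w

  tri-upper : ∀ α β w → 1 ≤ α → 1 ≤ β → 2 * (α * β * length (tri α β w)) ≤ (w + α + β) * (w + α + β)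
  tri-upper α β w p q = TriangleCount.upper α β p q w

  -- Shrinking the box along an element

  ⊹-cancelʳ : ∀ p q a → p ⊹ a ≡ q ⊹ a → p ≡ q
  ⊹-cancelʳ (p₁ , p₂) (q₁ , q₂) (a₁ , a₂) e =
    cong₂ _,_ (+-cancelʳ-≡ a₁ p₁ q₁ (cong proj₁ e)) (+-cancelʳ-≡ a₂ p₂ q₂ (cong proj₂ e))

  Small : ℕ → ℕ → Pt → Set
  Small x y p = proj₁ p ≤ x × proj₂ p ≤ y

  small? : ∀ x y → Decidable (Small x y)
  small? x y p = (proj₁ p ≤? x) ×-dec (proj₂ p ≤? y)

  restrict : ∀ {X Y} → SumFreeSet X Y → ∀ x y → SumFreeSet x y
  restrict {X} {Y} S x y = record
    { pts = filter (small? x y) (pts S)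
    ; pts-unique = Unique.filter⁺ (small? x y) (pts-unique S)
    ; pts-inBox = inBox
    ; pts-sumFree = λ p q r → pts-sumFree S (old p) (old q) (old r)
    }
    where
    old : ∀ {p} → p ∈ filter (small? x y) (pts S) → p ∈ pts S
    old p = proj₁ (∈-filter⁻ (small? x y) {xs = pts S} p)
    inBox : ∀ {p} → p ∈ filter (small? x y) (pts S) → Box x y p
    inBox p with ∈-filter⁻ (small? x y) {xs = pts S} p
    ... | q , (p≤x , p≤y) with pts-inBox S q
    ... | (1≤p , _) , (1≤p′ , _) = (1≤p , p≤x) , (1≤p′ , p≤y)

  widen = certify 4 (λ x t X q → q :≤ x ∷ X :≡ x :+ 2 · t ∷ [] ⊢ q :≤ X)
    ((1 , fwd 0 1 [] ∷ bwd 1 1 [] ∷ []) ∷ [])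
  widen-once = certify 4 (λ x t X q → q :≤ x :+ t ∷ X :≡ x :+ 2 · t ∷ [] ⊢ q :≤ X)
    ((1 , fwd 0 1 [] ∷ bwd 1 1 [] ∷ []) ∷ [])
  translate = certify 4 (λ x t X q → q :≤ x :+ t ∷ X :≡ x :+ 2 · t ∷ [] ⊢ q :+ t :≤ X)
    ((1 , fwd 0 1 [] ∷ bwd 1 1 [] ∷ []) ∷ [])
  untranslate = certify 3 (λ x t q → q :+ t :≤ x :+ t ∷ [] ⊢ q :≤ x)
    ((1 , fwd 0 1 [] ∷ []) ∷ [])
  shrink-count = certify 8 (λ n m i F R P s XY → n :+ (m :+ i) :≤ XY ∷ P :≡ F :+ m ∷ F :≤ s ∷ R :≤ P :+ i ∷ []
      ⊢ n :+ R :≤ XY :+ s)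
    ((1 , fwd 0 1 [] ∷ fwd 1 1 [] ∷ fwd 2 1 [] ∷ fwd 3 1 [] ∷ []) ∷ [])

  -- A translate p + a that fell back into the (x + t) × (y + r) box would come from a point p of
  -- the core [x] × [y]; hence the pairs indexed by the frame are disjoint and avoid the core. In
  -- the core only the gaps of S are counted, which brings in the size of `restrict S x y` and
  -- permits recursion.
  module Shrink {X Y} (S : SumFreeSet X Y) {t r x y : ℕ} (a∈S : (t , r) ∈ pts S)
    (X≡ : X ≡ x + 2 * t) (Y≡ : Y ≡ y + 2 * r) where

    in? : Decidable (_∈ pts S)
    in? = _∈? pts S

    gaps frame : List Pt
    gaps = filter (¬? ∘ in?) (grid x y)
    frame = filter (¬? ∘ small? x y) (grid (x + t) (y + r))

    ∈-gaps : ∀ {p} → p ∈ gaps → Box x y p × p ∉ pts S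
    ∈-gaps p with ∈-filter⁻ (¬? ∘ in?) {xs = grid x y} p
    ... | q , p∉ = ∈-grid⁻ q , p∉

    ∈-frame : ∀ {p} → p ∈ frame → Box (x + t) (y + r) p × ¬ Small x y p
    ∈-frame p with ∈-filter⁻ (¬? ∘ small? x y) {xs = grid (x + t) (y + r)} p
    ... | q , p∉ = ∈-grid⁻ q , p∉

    pairing : Pairing S gaps frame (_⊹ (t , r)) id
    pairing = record
      { missing-unique = Unique.filter⁺ (¬? ∘ in?) (grid-unique x y)
      ; missing-inBox = λ {p} q → let (l₁ , u₁) , (l₂ , u₂) = proj₁ (∈-gaps q) in
          (l₁ , widen x t X (proj₁ p) u₁ X≡) , (l₂ , widen y r Y (proj₂ p) u₂ Y≡)
      ; missing = λ q → proj₂ (∈-gaps q)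
      ; index-unique = Unique.filter⁺ (¬? ∘ small? x y) (grid-unique (x + t) (y + r))
      ; hi-inBox = λ {p} q → let (l₁ , u₁) , (l₂ , u₂) = proj₁ (∈-frame q) in
          (≤-trans l₁ (m≤m+n _ t) , translate x t X (proj₁ p) u₁ X≡) ,
          (≤-trans l₂ (m≤m+n _ r) , translate y r Y (proj₂ p) u₂ Y≡)
      ; lo-inBox = λ {p} q → let (l₁ , u₁) , (l₂ , u₂) = proj₁ (∈-frame q) in
          (l₁ , widen-once x t X (proj₁ p) u₁ X≡) , (l₂ , widen-once y r Y (proj₂ p) u₂ Y≡)
      ; hi-or-lo = λ _ hi∈ lo∈ → pts-sumFree S lo∈ a∈S hi∈
      ; hi-fresh = λ q h → let (_ , u₁) , (_ , u₂) = proj₁ (∈-gaps h) in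
          proj₂ (∈-frame q) (≤-trans (m≤m+n _ t) u₁ , ≤-trans (m≤m+n _ r) u₂)
      ; lo-fresh = λ q h → let (_ , u₁) , (_ , u₂) = proj₁ (∈-gaps h) in proj₂ (∈-frame q) (u₁ , u₂)
      ; hi-injective = λ {p} {q} _ _ → ⊹-cancelʳ p q (t , r)
      ; lo-injective = λ _ _ e → e
      ; hi≢lo = λ { {p} i j refl → let (_ , u₁) , (_ , u₂) = proj₁ (∈-frame j) in
          proj₂ (∈-frame i) (untranslate x t (proj₁ p) u₁ , untranslate y r (proj₂ p) u₂) }
      }

    bound : size S + (x + t) * (y + r) ≤ X * Y + size (restrict S x y)
    bound = shrink-count (size S) (length gaps) (length frame) (length (filter in? (grid x y)))
      ((x + t) * (y + r)) (x * y) (size (restrict S x y)) (X * Y) (pairing-bound pairing)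
      (trans (sym (length-grid x y)) (length-filter-split in? (grid x y))) inside outside
      where
      inside : length (filter in? (grid x y)) ≤ size (restrict S x y)
      inside = length-≤-⊆ (Unique.filter⁺ in? (grid-unique x y)) λ p →
        let p∈ , p∈S = ∈-filter⁻ in? {xs = grid x y} p
            (_ , u₁) , (_ , u₂) = ∈-grid⁻ p∈
        in ∈-filter⁺ (small? x y) p∈S (u₁ , u₂)
      core : length (filter (small? x y) (grid (x + t) (y + r))) ≤ length (grid x y)
      core = length-≤-⊆ (Unique.filter⁺ (small? x y) (grid-unique (x + t) (y + r))) λ p →
        let p∈ , (u₁ , u₂) = ∈-filter⁻ (small? x y) {xs = grid (x + t) (y + r)} p
            (l₁ , _) , (l₂ , _) = ∈-grid⁻ {x + t} {y + r} p∈
        in ∈-grid⁺ ((l₁ , u₁) , (l₂ , u₂))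
      outside : (x + t) * (y + r) ≤ x * y + length frame
      outside = begin
        (x + t) * (y + r)                                                           ≡⟨ sym (length-grid (x + t) (y + r)) ⟩
        length (grid (x + t) (y + r))                                               ≡⟨ length-filter-split (small? x y) (grid (x + t) (y + r)) ⟩
        length (filter (small? x y) (grid (x + t) (y + r))) + length frame          ≤⟨ +-monoˡ-≤ (length frame) core ⟩
        length (grid x y) + length frame                                            ≡⟨ cong (_+ length frame) (length-grid x y) ⟩
        x * y + length frame                                                        ∎
        where open ≤-Reasoning

  within = certify 4 (λ x t X q → q :≤ x ∷ X :≡ t :+ x ∷ [] ⊢ q :≤ X)
    ((1 , fwd 0 1 [] ∷ bwd 1 1 [] ∷ []) ∷ [])
  within-shifted = certify 4 (λ x t X q → q :≤ x ∷ X :≡ t :+ x ∷ [] ⊢ q :+ t :≤ X)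
    ((1 , fwd 0 1 [] ∷ bwd 1 1 [] ∷ []) ∷ [])
  too-far = certify 3 (λ x t q → q :+ t :≤ x ∷ x :< t ∷ [] ⊢ absurd)
    ((1 , fwd 0 1 [] ∷ fwd 1 1 [] ∷ []) ∷ [])

  -- If a is so large that 2a leaves the box, the pairs {q, q + a} are automatically disjoint.
  large-element-bound : ∀ {X Y} (S : SumFreeSet X Y) {t r x y} → (t , r) ∈ pts S → X ≡ t + x → Y ≡ r + y →
    x < t ⊎ y < r → size S + x * y ≤ X * Y
  large-element-bound {X} {Y} S {t} {r} {x} {y} a∈S X≡ Y≡ far =
    subst (λ k → size S + k ≤ X * Y) (length-grid x y) (pairing-bound pairing)
    where
    apart : x < t ⊎ y < r → ∀ {p q} → p ∈ grid x y → q ∈ grid x y → p ⊹ (t , r) ≢ q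
    apart (inj₁ x<t) {p} i j refl = too-far x t (proj₁ p) (proj₂ (proj₁ (∈-grid⁻ {x} {y} j))) x<t
    apart (inj₂ y<r) {p} i j refl = too-far y r (proj₂ p) (proj₂ (proj₂ (∈-grid⁻ {x} {y} j))) y<r
    pairing : Pairing S [] (grid x y) (_⊹ (t , r)) id
    pairing = record
      { missing-unique = []
      ; missing-inBox = λ ()
      ; missing = λ ()
      ; index-unique = grid-unique x y
      ; hi-inBox = λ {p} q → let (l₁ , u₁) , (l₂ , u₂) = ∈-grid⁻ q in
          (≤-trans l₁ (m≤m+n _ t) , within-shifted x t X (proj₁ p) u₁ X≡) ,
          (≤-trans l₂ (m≤m+n _ r) , within-shifted y r Y (proj₂ p) u₂ Y≡)
      ; lo-inBox = λ {p} q → let (l₁ , u₁) , (l₂ , u₂) = ∈-grid⁻ q in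
          (l₁ , within x t X (proj₁ p) u₁ X≡) , (l₂ , within y r Y (proj₂ p) u₂ Y≡)
      ; hi-or-lo = λ _ hi∈ lo∈ → pts-sumFree S lo∈ a∈S hi∈
      ; hi-fresh = λ _ ()
      ; lo-fresh = λ _ ()
      ; hi-injective = λ {p} {q} _ _ → ⊹-cancelʳ p q (t , r)
      ; lo-injective = λ _ _ e → e
      ; hi≢lo = apart far
      }

  averaging-count = certify 5 (λ n p q P XY → n :≡ p :+ q ∷ n :+ (p :+ con 0) :≤ XY ∷ q :+ P :≤ XY ∷ []
      ⊢ 2 · n :+ P :≤ 2 · XY)
    ((1 , fwd 0 1 [] ∷ fwd 1 1 [] ∷ fwd 2 1 [] ∷ []) ∷ [])

  -- No disjointness of pairs is needed: `low` + a misses S, `high` misses the box [x] × [y], and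
  -- the two counts are added. The bound is weak, but it restricts elements that are too small for
  -- the pairing bounds to say anything.
  averaging-bound : ∀ {X Y} (S : SumFreeSet X Y) {t r x y} → (t , r) ∈ pts S → X ≡ t + x → Y ≡ r + y →
    2 * size S + x * y ≤ 2 * (X * Y)
  averaging-bound {X} {Y} S {t} {r} {x} {y} a∈S X≡ Y≡ =
    averaging-count (size S) (length low) (length high) (x * y) (X * Y)
      (length-filter-split (small? x y) (pts S))
      (subst (λ k → size S + (k + 0) ≤ X * Y) (length-map (_⊹ (t , r)) low) (pairing-bound pairing)) outer
    where
    low high : List Pt
    low = filter (small? x y) (pts S)
    high = filter (¬? ∘ small? x y) (pts S)
    ∈-low : ∀ {p} → p ∈ low → p ∈ pts S × Small x y p
    ∈-low = ∈-filter⁻ (small? x y) {xs = pts S}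
    ∈-high : ∀ {p} → p ∈ high → p ∈ pts S × ¬ Small x y p
    ∈-high = ∈-filter⁻ (¬? ∘ small? x y) {xs = pts S}
    shifted-inBox : ∀ {p} → p ∈ map (_⊹ (t , r)) low → Box X Y p
    shifted-inBox q with ∈-map⁻ (_⊹ (t , r)) q
    ... | p , p∈ , refl with ∈-low p∈
    ... | p∈S , (u₁ , u₂) with pts-inBox S p∈S
    ... | (l₁ , _) , (l₂ , _) =
      (≤-trans l₁ (m≤m+n _ t) , within-shifted x t X (proj₁ p) u₁ X≡) ,
      (≤-trans l₂ (m≤m+n _ r) , within-shifted y r Y (proj₂ p) u₂ Y≡)
    shifted-missing : ∀ {p} → p ∈ map (_⊹ (t , r)) low → p ∉ pts S
    shifted-missing q with ∈-map⁻ (_⊹ (t , r)) q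
    ... | p , p∈ , refl = pts-sumFree S (proj₁ (∈-low p∈)) a∈S
    pairing : Pairing S (map (_⊹ (t , r)) low) [] id id
    pairing = record
      { missing-unique = unique-map (_⊹ (t , r)) (Unique.filter⁺ (small? x y) (pts-unique S))
          (λ {p} {q} _ _ → ⊹-cancelʳ p q (t , r))
      ; missing-inBox = shifted-inBox
      ; missing = shifted-missing
      ; index-unique = []
      ; hi-inBox = λ ()
      ; lo-inBox = λ ()
      ; hi-or-lo = λ ()
      ; hi-fresh = λ ()
      ; lo-fresh = λ ()
      ; hi-injective = λ ()
      ; lo-injective = λ ()
      ; hi≢lo = λ ()
      }
    outer : length high + x * y ≤ X * Y
    outer = begin
      length high + x * y              ≡⟨ cong (length high +_) (sym (length-grid x y)) ⟩
      length high + length (grid x y)  ≡⟨ sym (length-++ high) ⟩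
      length (high ++ grid x y)        ≤⟨ length-≤-⊆ both-unique both-inBox ⟩
      length (grid X Y)                ≡⟨ length-grid X Y ⟩
      X * Y                            ∎
      where
      open ≤-Reasoning
      both-unique : Unique (high ++ grid x y)
      both-unique = Unique.++⁺ (Unique.filter⁺ (¬? ∘ small? x y) (pts-unique S)) (grid-unique x y)
        (λ (p , q) → let (_ , u₁) , (_ , u₂) = ∈-grid⁻ q in proj₂ (∈-high p) (u₁ , u₂))
      both-inBox : ∀ {p} → p ∈ high ++ grid x y → p ∈ grid X Y
      both-inBox {p} q with ∈-++⁻ high q
      ... | inj₁ h = ∈-grid⁺ (pts-inBox S (proj₁ (∈-high h)))
      ... | inj₂ h = let (l₁ , u₁) , (l₂ , u₂) = ∈-grid⁻ h in
        ∈-grid⁺ ((l₁ , within x t X (proj₁ p) u₁ X≡) , (l₂ , within y r Y (proj₂ p) u₂ Y≡))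

  -- Pairing through contact points of a supporting line

  lin : ℕ → ℕ → Pt → ℕ
  lin α β p = α * proj₁ p + β * proj₂ p

  corner-tri = certify 10 (λ α β q₁ q₂ i j x y c w → q₁ :+ i :≡ x ∷ q₂ :+ j :≡ y ∷ 2 · c :≤ α :* q₁ :+ β :* q₂ ∷
      α :* x :+ β :* y :< 2 · c :+ w ∷ [] ⊢ α :* i :+ β :* j :< w)
    ((1 , fwd 2 1 [] ∷ fwd 3 1 [] ∷ fwd 0 1 (0 ∷ []) ∷ fwd 1 1 (1 ∷ []) ∷ []) ∷ [])
  corner-apart = certify 7 (λ α β p₁ p₂ t r c → α :* t :+ β :* r :≡ c ∷ c :≤ α :* p₁ :+ β :* p₂ ∷
      α :* (p₁ :+ t) :+ β :* (p₂ :+ r) :< 2 · c ∷ [] ⊢ absurd)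
    ((1 , bwd 0 1 [] ∷ fwd 1 1 [] ∷ fwd 2 1 [] ∷ []) ∷ [])
  corner-fresh = certify 7 (λ α β p₁ p₂ t r c → c :≤ α :* p₁ :+ β :* p₂ ∷ α :* (p₁ :+ t) :+ β :* (p₂ :+ r) :< c ∷
      [] ⊢ absurd)
    ((1 , fwd 0 1 [] ∷ fwd 1 1 [] ∷ []) ∷ [])
  corner-count = certify 7 (λ n F I R T P XY → n :+ (F :+ I) :≤ XY ∷ P :≡ F :+ (I :+ R) ∷ R :≤ T ∷ []
      ⊢ n :+ P :≤ XY :+ T)
    ((1 , fwd 0 1 [] ∷ fwd 1 1 [] ∷ fwd 2 1 [] ∷ []) ∷ [])

  -- Translation by a raises the level by c, so the layer c ≤ `lin` < 2c is paired with points of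
  -- level at least 2c. The points of [x] × [y] above 2c are left unpaired; seen from the corner (x
  -- , y) they lie in a triangle of level w, which is the only loss.
  module Corner {X Y} (S : SumFreeSet X Y) (α β c w : ℕ) {t r x y : ℕ} (1≤α : 1 ≤ α) (1≤β : 1 ≤ β)
    (above : ∀ {p} → p ∈ pts S → c ≤ lin α β p) (a∈S : (t , r) ∈ pts S) (X≡ : X ≡ t + x) (Y≡ : Y ≡ r + y)
    (touch : α * t + β * r ≡ c) (range : α * x + β * y < 2 * c + w) where

    low? : Decidable (λ p → lin α β p < c)
    low? p = lin α β p <? c

    mid? : Decidable (λ p → lin α β p < 2 * c)
    mid? p = lin α β p <? 2 * c

    low rest mid top : List Pt
    low = filter low? (grid x y)
    rest = filter (¬? ∘ low?) (grid x y)
    mid = filter mid? rest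
    top = filter (¬? ∘ mid?) rest

    ∈-low : ∀ {p} → p ∈ low → Box x y p × lin α β p < c
    ∈-low q = let p∈ , h = ∈-filter⁻ low? {xs = grid x y} q in ∈-grid⁻ {x} {y} p∈ , h

    ∈-rest : ∀ {p} → p ∈ rest → Box x y p × c ≤ lin α β p
    ∈-rest q = let p∈ , h = ∈-filter⁻ (¬? ∘ low?) {xs = grid x y} q in ∈-grid⁻ {x} {y} p∈ , ≮⇒≥ h

    ∈-mid : ∀ {p} → p ∈ mid → Box x y p × c ≤ lin α β p × lin α β p < 2 * c
    ∈-mid q = let p∈ , h = ∈-filter⁻ mid? {xs = rest} q in proj₁ (∈-rest p∈) , proj₂ (∈-rest p∈) , h

    ∈-top : ∀ {p} → p ∈ top → Box x y p × 2 * c ≤ lin α β p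
    ∈-top q = let p∈ , h = ∈-filter⁻ (¬? ∘ mid?) {xs = rest} q in proj₁ (∈-rest p∈) , ≮⇒≥ h

    rest-unique : Unique rest
    rest-unique = Unique.filter⁺ (¬? ∘ low?) (grid-unique x y)

    inside : ∀ {p} → Box x y p → Box X Y p
    inside {p} ((l₁ , u₁) , (l₂ , u₂)) = (l₁ , within x t X (proj₁ p) u₁ X≡) , (l₂ , within y r Y (proj₂ p) u₂ Y≡)

    pairing : Pairing S low mid (_⊹ (t , r)) id
    pairing = record
      { missing-unique = Unique.filter⁺ low? (grid-unique x y)
      ; missing-inBox = λ q → inside (proj₁ (∈-low q))
      ; missing = λ q p∈S → <⇒≱ (proj₂ (∈-low q)) (above p∈S)
      ; index-unique = Unique.filter⁺ mid? rest-unique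
      ; hi-inBox = λ {p} q → let (l₁ , u₁) , (l₂ , u₂) = proj₁ (∈-mid q) in
          (≤-trans l₁ (m≤m+n _ t) , within-shifted x t X (proj₁ p) u₁ X≡) ,
          (≤-trans l₂ (m≤m+n _ r) , within-shifted y r Y (proj₂ p) u₂ Y≡)
      ; lo-inBox = λ q → inside (proj₁ (∈-mid q))
      ; hi-or-lo = λ _ hi∈ lo∈ → pts-sumFree S lo∈ a∈S hi∈
      ; hi-fresh = λ {p} q h → corner-fresh α β (proj₁ p) (proj₂ p) t r c (proj₁ (proj₂ (∈-mid q))) (proj₂ (∈-low h))
      ; lo-fresh = λ q h → <⇒≱ (proj₂ (∈-low h)) (proj₁ (proj₂ (∈-mid q)))
      ; hi-injective = λ {p} {q} _ _ → ⊹-cancelʳ p q (t , r)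
      ; lo-injective = λ _ _ e → e
      ; hi≢lo = λ { {p} i j refl →
          corner-apart α β (proj₁ p) (proj₂ p) t r c touch (proj₁ (proj₂ (∈-mid i))) (proj₂ (proj₂ (∈-mid j))) }
      }

    bound : size S + x * y ≤ X * Y + length (tri α β w)
    bound = corner-count (size S) (length low) (length mid) (length top) _ (x * y) (X * Y) (pairing-bound pairing)
      (trans (sym (length-grid x y)) (trans (length-filter-split low? (grid x y))
        (cong (length low +_) (length-filter-split mid? rest)))) top-small
      where
      top-small : length top ≤ length (tri α β w)
      top-small = length-≤-injection (λ p → x ∸ proj₁ p , y ∸ proj₂ p) (Unique.filter⁺ (¬? ∘ mid?) rest-unique) into inj
        where
        into : ∀ {p} → p ∈ top → (x ∸ proj₁ p , y ∸ proj₂ p) ∈ tri α β w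
        into {p₁ , p₂} q = let ((_ , u₁) , (_ , u₂)) , h = ∈-top q in
          ∈-tri⁺ α β w 1≤α 1≤β (corner-tri α β p₁ p₂ (x ∸ p₁) (y ∸ p₂) x y c w (m+[n∸m]≡n u₁) (m+[n∸m]≡n u₂) h range)
        inj : ∀ {p q} → p ∈ top → q ∈ top → (x ∸ proj₁ p , y ∸ proj₂ p) ≡ (x ∸ proj₁ q , y ∸ proj₂ q) → p ≡ q
        inj p q e = let ((_ , u₁) , (_ , u₂)) , _ = ∈-top p ; ((_ , v₁) , (_ , v₂)) , _ = ∈-top q in
          cong₂ _,_ (∸-cancelˡ-≡ u₁ v₁ (cong proj₁ e)) (∸-cancelˡ-≡ u₂ v₂ (cong proj₂ e))

  below-line = certify 6 (λ α β i j c e → α :* i :+ β :* j :< e ∷ e :+ (α :+ β) :≤ c ∷ []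
      ⊢ α :* (con 1 :+ i) :+ β :* (con 1 :+ j) :< c)
    ((1 , fwd 0 1 [] ∷ fwd 1 1 [] ∷ []) ∷ [])
  below-line₁ = certify 6 (λ α β i j c X → con 1 :≤ β ∷ α :* (con 1 :+ i) :+ β :* (con 1 :+ j) :< c ∷
      c :≤ α :* X ∷ X :< (con 1 :+ i) ∷ [] ⊢ absurd)
    ((2 , fwd 0 1 [] ∷ fwd 1 1 [] ∷ fwd 2 1 [] ∷ fwd 3 1 (0 ∷ []) ∷ []) ∷ [])
  below-line₂ = certify 6 (λ α β i j c Y → con 1 :≤ α ∷ α :* (con 1 :+ i) :+ β :* (con 1 :+ j) :< c ∷
      c :≤ β :* Y ∷ Y :< (con 1 :+ j) ∷ [] ⊢ absurd)
    ((2 , fwd 0 1 [] ∷ fwd 1 1 [] ∷ fwd 2 1 [] ∷ fwd 3 1 (1 ∷ []) ∷ []) ∷ [])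

  -- The points strictly below the line lin α β = c, shrunk by α + β because coordinates start at 1.
  module BelowLine {X Y} (S : SumFreeSet X Y) (α β c e : ℕ) (1≤α : 1 ≤ α) (1≤β : 1 ≤ β)
    (above : ∀ {p} → p ∈ pts S → c ≤ lin α β p) (c≤αX : c ≤ α * X) (c≤βY : c ≤ β * Y) (e+≤c : e + (α + β) ≤ c) where

    cut : List Pt
    cut = map (λ p → suc (proj₁ p) , suc (proj₂ p)) (tri α β e)

    length-cut : length cut ≡ length (tri α β e)
    length-cut = length-map _ (tri α β e)

    cut-unique : Unique cut
    cut-unique = unique-map _ (tri-unique α β e) (λ { {i , j} {i′ , j′} _ _ refl → refl })

    cut-below : ∀ {p} → p ∈ cut → lin α β p < c
    cut-below q with ∈-map⁻ _ q
    ... | (i , j) , h , refl = below-line α β i j c e (∈-tri⁻ α β e h) e+≤c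

    cut-missing : ∀ {p} → p ∈ cut → p ∉ pts S
    cut-missing q p∈ = <⇒≱ (cut-below q) (above p∈)

    cut-inBox : ∀ {p} → p ∈ cut → Box X Y p
    cut-inBox {p} q with ∈-map⁻ _ q | cut-below q
    ... | (i , j) , h , refl | below =
      (s≤s z≤n , ≮⇒≥ (λ X< → below-line₁ α β i j c X 1≤β below c≤αX X<)) ,
      (s≤s z≤n , ≮⇒≥ (λ Y< → below-line₂ α β i j c Y 1≤α below c≤βY Y<))

    -- Further missing points D on or above the line.
    module With (D : List Pt) (D-unique : Unique D) (D-inBox : ∀ {p} → p ∈ D → Box X Y p)
      (D-missing : ∀ {p} → p ∈ D → p ∉ pts S) (D-above : ∀ {p} → p ∈ D → c ≤ lin α β p) where

      Ms-unique : Unique (cut ++ D)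
      Ms-unique = Unique.++⁺ cut-unique D-unique (λ (p , q) → <⇒≱ (cut-below p) (D-above q))

      Ms-inBox : ∀ {p} → p ∈ cut ++ D → Box X Y p
      Ms-inBox q with ∈-++⁻ cut q
      ... | inj₁ h = cut-inBox h
      ... | inj₂ h = D-inBox h

      Ms-missing : ∀ {p} → p ∈ cut ++ D → p ∉ pts S
      Ms-missing q with ∈-++⁻ cut q
      ... | inj₁ h = cut-missing h
      ... | inj₂ h = D-missing h

      ∉-Ms : ∀ {p} → c ≤ lin α β p → p ∉ D → p ∉ cut ++ D
      ∉-Ms above-p p∉D q with ∈-++⁻ cut q
      ... | inj₁ h = <⇒≱ (cut-below h) above-p
      ... | inj₂ h = p∉D h

      length-Ms : length (cut ++ D) ≡ length (tri α β e) + length D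
      length-Ms = trans (length-++ cut) (cong (_+ length D) length-cut)

  lo-above = certify 10 (λ α β i j l m x y c w → l :+ i :≡ x ∷ m :+ j :≡ y ∷ α :* x :+ β :* y :≡ c :+ w ∷
      α :* i :+ β :* j :< w ∷ [] ⊢ c :< α :* l :+ β :* m)
    ((1 , bwd 2 1 [] ∷ fwd 3 1 [] ∷ bwd 0 1 (0 ∷ []) ∷ bwd 1 1 (1 ∷ []) ∷ []) ∷ [])
  lo-bounded = certify 11 (λ α β i j l m x y c w A → l :+ i :≡ x ∷ m :+ j :≡ y ∷ α :* x :+ β :* y :≡ c :+ w ∷
      w :≤ A :+ (α :* i :+ β :* j) ∷ [] ⊢ α :* l :+ β :* m :≤ c :+ A)
    ((1 , fwd 2 1 [] ∷ fwd 3 1 [] ∷ fwd 0 1 (0 ∷ []) ∷ fwd 1 1 (1 ∷ []) ∷ []) ∷ [])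
  hi-above = certify 8 (λ α β l m t r c A → c :< α :* l :+ β :* m ∷ α :* t :+ β :* r :≡ A ∷ []
      ⊢ c :+ A :< α :* (l :+ t) :+ β :* (m :+ r))
    ((1 , fwd 0 1 [] ∷ bwd 1 1 [] ∷ []) ∷ [])
  overflow₁ = certify 8 (λ α β x i j k w v → x :+ k :≡ i ∷ α :* i :+ β :* j :< w ∷ w :≤ α :* x :+ v ∷ []
      ⊢ α :* k :+ β :* j :< v)
    ((1 , fwd 1 1 [] ∷ fwd 2 1 [] ∷ fwd 0 1 (0 ∷ []) ∷ []) ∷ [])
  overflow₂ = certify 8 (λ α β y i j k w v → y :+ k :≡ j ∷ α :* i :+ β :* j :< w ∷ w :≤ β :* y :+ v ∷ []
      ⊢ α :* i :+ β :* k :< v)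
    ((1 , fwd 1 1 [] ∷ fwd 2 1 [] ∷ fwd 0 1 (1 ∷ []) ∷ []) ∷ [])
  overflow₃ = certify 4 (λ s w v A → A :+ s :< w ∷ w :≤ A :+ v ∷ [] ⊢ s :< v)
    ((1 , fwd 0 1 [] ∷ fwd 1 1 [] ∷ []) ∷ [])
  single-count = certify 8 (λ n M I P Q R W XY → n :+ (M :+ I) :≤ XY ∷ W :≡ (I :+ R) :+ Q :+ P ∷ []
      ⊢ n :+ (M :+ W) :≤ XY :+ (P :+ Q :+ R))
    ((1 , fwd 0 1 [] ∷ fwd 1 1 [] ∷ []) ∷ [])

  -- The corner triangle is read inwards from (x , y), so every `lo p` has level in (c , c + A] and
  -- every `hi p` has level above c + A. The numbers v₁, v₂, v₃ bound what must be dropped: points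
  -- past the left edge, past the lower edge, and points whose `lo` would rise above c + A. The set
  -- `D` of further missing points avoids each `hi` by its level and each `lo` by lying outside [x]
  -- × [y]. It is empty for the density bound and consists of the gaps of a small box later on.
  module Single {X Y} (S : SumFreeSet X Y) (α β c A w e v₁ v₂ v₃ : ℕ) {t r x y : ℕ} (1≤α : 1 ≤ α) (1≤β : 1 ≤ β)
    (above : ∀ {p} → p ∈ pts S → c ≤ lin α β p) (c≤αX : c ≤ α * X) (c≤βY : c ≤ β * Y)
    (a∈S : (t , r) ∈ pts S) (X≡ : X ≡ t + x) (Y≡ : Y ≡ r + y) (touch : α * t + β * r ≡ A)
    (range : α * x + β * y ≡ c + w) (e+≤c : e + (α + β) ≤ c)
    (w≤₁ : w ≤ α * x + v₁) (w≤₂ : w ≤ β * y + v₂) (w≤₃ : w ≤ A + v₃)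
    (D : List Pt) (D-unique : Unique D) (D-inBox : ∀ {p} → p ∈ D → Box X Y p)
    (D-missing : ∀ {p} → p ∈ D → p ∉ pts S) (D-above : ∀ {p} → p ∈ D → c ≤ lin α β p)
    (D-below : ∀ {p} → p ∈ D → lin α β p ≤ c + A) (D-far : ∀ {p} → p ∈ D → ¬ Small x y p) where

    open BelowLine S α β c e 1≤α 1≤β above c≤αX c≤βY e+≤c
    open With D D-unique D-inBox D-missing D-above

    lo hi : Pt → Pt
    lo p = x ∸ proj₁ p , y ∸ proj₂ p
    hi p = lo p ⊹ (t , r)

    fits₁? : Decidable (λ (p : Pt) → proj₁ p < x)
    fits₁? p = proj₁ p <? x
    fits₂? : Decidable (λ (p : Pt) → proj₂ p < y)
    fits₂? p = proj₂ p <? y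
    fits₃? : Decidable (λ (p : Pt) → w ≤ A + lin α β p)
    fits₃? p = w ≤? A + lin α β p

    T T₁ T₂ Is : List Pt
    T = tri α β w
    T₁ = filter fits₁? T
    T₂ = filter fits₂? T₁
    Is = filter fits₃? T₂

    T₁-unique : Unique T₁
    T₁-unique = Unique.filter⁺ fits₁? (tri-unique α β w)
    T₂-unique : Unique T₂
    T₂-unique = Unique.filter⁺ fits₂? T₁-unique

    ∈-T₁ : ∀ {p} → p ∈ T₁ → lin α β p < w × proj₁ p < x
    ∈-T₁ q = let h , k = ∈-filter⁻ fits₁? {xs = T} q in ∈-tri⁻ α β w h , k

    ∈-T₂ : ∀ {p} → p ∈ T₂ → lin α β p < w × proj₁ p < x × proj₂ p < y
    ∈-T₂ q = let h , k = ∈-filter⁻ fits₂? {xs = T₁} q in proj₁ (∈-T₁ h) , proj₂ (∈-T₁ h) , k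

    ∈-Is : ∀ {p} → p ∈ Is → lin α β p < w × proj₁ p < x × proj₂ p < y × w ≤ A + lin α β p
    ∈-Is q = let h , k = ∈-filter⁻ fits₃? {xs = T₂} q ; a , b , d = ∈-T₂ h in a , b , d , k

    lo-over : ∀ {p} → p ∈ Is → c < lin α β (lo p)
    lo-over {i , j} q = let h , i<x , j<y , _ = ∈-Is q in
      lo-above α β i j (x ∸ i) (y ∸ j) x y c w (m∸n+n≡m (<⇒≤ i<x)) (m∸n+n≡m (<⇒≤ j<y)) range h

    lo-under : ∀ {p} → p ∈ Is → lin α β (lo p) ≤ c + A
    lo-under {i , j} q = let _ , i<x , j<y , h = ∈-Is q in
      lo-bounded α β i j (x ∸ i) (y ∸ j) x y c w A (m∸n+n≡m (<⇒≤ i<x)) (m∸n+n≡m (<⇒≤ j<y)) range h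

    hi-over : ∀ {p} → p ∈ Is → c + A < lin α β (hi p)
    hi-over {i , j} q = hi-above α β (x ∸ i) (y ∸ j) t r c A (lo-over q) touch

    lo-injective : ∀ {p q} → p ∈ Is → q ∈ Is → lo p ≡ lo q → p ≡ q
    lo-injective p q e′ = let _ , a , b , _ = ∈-Is p ; _ , a′ , b′ , _ = ∈-Is q in
      cong₂ _,_ (∸-cancelˡ-≡ (<⇒≤ a) (<⇒≤ a′) (cong proj₁ e′)) (∸-cancelˡ-≡ (<⇒≤ b) (<⇒≤ b′) (cong proj₂ e′))

    pairing : Pairing S (cut ++ D) Is hi lo
    pairing = record
      { missing-unique = Ms-unique
      ; missing-inBox = Ms-inBox
      ; missing = Ms-missing
      ; index-unique = Unique.filter⁺ fits₃? T₂-unique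
      ; hi-inBox = λ {p} q → let _ , i<x , j<y , _ = ∈-Is q in
          (≤-trans (m<n⇒0<n∸m i<x) (m≤m+n _ t) , within-shifted x t X _ (m∸n≤m x (proj₁ p)) X≡) ,
          (≤-trans (m<n⇒0<n∸m j<y) (m≤m+n _ r) , within-shifted y r Y _ (m∸n≤m y (proj₂ p)) Y≡)
      ; lo-inBox = λ {p} q → let _ , i<x , j<y , _ = ∈-Is q in
          (m<n⇒0<n∸m i<x , within x t X _ (m∸n≤m x (proj₁ p)) X≡) ,
          (m<n⇒0<n∸m j<y , within y r Y _ (m∸n≤m y (proj₂ p)) Y≡)
      ; hi-or-lo = λ _ hi∈ lo∈ → pts-sumFree S lo∈ a∈S hi∈
      ; hi-fresh = λ q → ∉-Ms (≤-trans (m≤m+n c A) (<⇒≤ (hi-over q))) (λ h → <⇒≱ (hi-over q) (D-below h))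
      ; lo-fresh = λ {p} q → ∉-Ms (<⇒≤ (lo-over q)) (λ h → D-far h (m∸n≤m x (proj₁ p) , m∸n≤m y (proj₂ p)))
      ; hi-injective = λ {p} {q} i j e′ → lo-injective i j (⊹-cancelʳ (lo p) (lo q) (t , r) e′)
      ; lo-injective = lo-injective
      ; hi≢lo = λ i j e′ → <⇒≱ (hi-over i) (subst (λ p → lin α β p ≤ c + A) (sym e′) (lo-under j))
      }

    bound : size S + (length (tri α β e) + length D + length (tri α β w)) ≤
      X * Y + (length (tri α β v₁) + length (tri α β v₂) + length (tri α β v₃))
    bound = ≤-trans (single-count (size S) _ (length Is) (length (filter (¬? ∘ fits₁?) T))
        (length (filter (¬? ∘ fits₂?) T₁)) (length (filter (¬? ∘ fits₃?) T₂)) (length T) (X * Y)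
        (subst (λ k → size S + (k + length Is) ≤ X * Y) length-Ms (pairing-bound pairing))
        splitting)
      (+-monoʳ-≤ (X * Y) (+-mono-≤ (+-mono-≤ lost₁ lost₂) lost₃))
      where
      splitting : length T ≡ (length Is + length (filter (¬? ∘ fits₃?) T₂)) + length (filter (¬? ∘ fits₂?) T₁)
        + length (filter (¬? ∘ fits₁?) T)
      splitting = trans (length-filter-split fits₁? T) (cong (_+ length (filter (¬? ∘ fits₁?) T))
        (trans (length-filter-split fits₂? T₁) (cong (_+ length (filter (¬? ∘ fits₂?) T₁)) (length-filter-split fits₃? T₂))))
      lost₁ : length (filter (¬? ∘ fits₁?) T) ≤ length (tri α β v₁)
      lost₁ = length-≤-injection (λ p → proj₁ p ∸ x , proj₂ p) (Unique.filter⁺ (¬? ∘ fits₁?) (tri-unique α β w))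
        (λ {p} q → let h , k = ∈-filter⁻ (¬? ∘ fits₁?) {xs = T} q in
          ∈-tri⁺ α β v₁ 1≤α 1≤β (overflow₁ α β x (proj₁ p) (proj₂ p) _ w v₁ (m+[n∸m]≡n (≮⇒≥ k)) (∈-tri⁻ α β w h) w≤₁))
        (λ p q e′ → let _ , k = ∈-filter⁻ (¬? ∘ fits₁?) {xs = T} p ; _ , k′ = ∈-filter⁻ (¬? ∘ fits₁?) {xs = T} q in
          cong₂ _,_ (∸-cancelʳ-≡ (≮⇒≥ k) (≮⇒≥ k′) (cong proj₁ e′)) (cong proj₂ e′))
      lost₂ : length (filter (¬? ∘ fits₂?) T₁) ≤ length (tri α β v₂)
      lost₂ = length-≤-injection (λ p → proj₁ p , proj₂ p ∸ y) (Unique.filter⁺ (¬? ∘ fits₂?) T₁-unique)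
        (λ {p} q → let h , k = ∈-filter⁻ (¬? ∘ fits₂?) {xs = T₁} q in
          ∈-tri⁺ α β v₂ 1≤α 1≤β (overflow₂ α β y (proj₁ p) (proj₂ p) _ w v₂ (m+[n∸m]≡n (≮⇒≥ k)) (proj₁ (∈-T₁ h)) w≤₂))
        (λ p q e′ → let _ , k = ∈-filter⁻ (¬? ∘ fits₂?) {xs = T₁} p ; _ , k′ = ∈-filter⁻ (¬? ∘ fits₂?) {xs = T₁} q in
          cong₂ _,_ (cong proj₁ e′) (∸-cancelʳ-≡ (≮⇒≥ k) (≮⇒≥ k′) (cong proj₂ e′)))
      lost₃ : length (filter (¬? ∘ fits₃?) T₂) ≤ length (tri α β v₃)
      lost₃ = length-≤-⊆ (Unique.filter⁺ (¬? ∘ fits₃?) T₂-unique)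
        (λ {p} q → let h , k = ∈-filter⁻ (¬? ∘ fits₃?) {xs = T₂} q in
          ∈-tri⁺ α β v₃ 1≤α 1≤β (overflow₃ (lin α β p) w v₃ A (≰⇒> k) w≤₃))

  both-row = certify 10 (λ α β X Y i j w A B b → α :* X :+ β :* Y :≡ A :+ B :+ w ∷ α :* i :+ β :* j :< w ∷
      Y :≤ j ∷ α :* b :≤ B ∷ α :* X :≤ A :+ α :* b ∷ [] ⊢ absurd)
    ((1 , bwd 0 1 [] ∷ fwd 1 1 [] ∷ fwd 3 1 [] ∷ fwd 4 1 [] ∷ fwd 2 1 (1 ∷ []) ∷ []) ∷ [])
  both-hi = certify 11 (λ α β X Y p q i j w A B → p :+ i :≡ X ∷ q :+ j :≡ Y ∷ α :* X :+ β :* Y :≡ A :+ B :+ w ∷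
      α :* i :+ β :* j :< w ∷ [] ⊢ A :+ B :< α :* p :+ β :* q)
    ((1 , bwd 2 1 [] ∷ fwd 3 1 [] ∷ bwd 0 1 (0 ∷ []) ∷ bwd 1 1 (1 ∷ []) ∷ []) ∷ [])
  both-hi-bounded = certify 12 (λ α β X Y p q i j w A B c → p :+ i :≡ X ∷ q :+ j :≡ Y ∷
      α :* X :+ β :* Y :≡ A :+ B :+ w ∷ w :≤ c :+ (α :* i :+ β :* j) ∷ [] ⊢ α :* p :+ β :* q :≤ A :+ B :+ c)
    ((1 , fwd 2 1 [] ∷ fwd 3 1 [] ∷ fwd 0 1 (0 ∷ []) ∷ fwd 1 1 (1 ∷ []) ∷ []) ∷ [])
  both-past-a = certify 5 (λ X p i d t → p :+ i :≡ X ∷ i :< d ∷ t :+ d :≤ X ∷ [] ⊢ t :< p)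
    ((1 , bwd 0 1 [] ∷ fwd 1 1 [] ∷ fwd 2 1 [] ∷ []) ∷ [])
  both-past-b₁ = certify 9 (λ α β p q t r b A B → A :+ B :< α :* p :+ β :* q ∷ q :≤ r ∷ α :* t :+ β :* r :≡ A ∷
      α :* b :≤ B ∷ p :≤ b ∷ [] ⊢ absurd)
    ((1 , fwd 0 1 [] ∷ fwd 2 1 [] ∷ fwd 3 1 [] ∷ fwd 1 1 (1 ∷ []) ∷ fwd 4 1 (0 ∷ []) ∷ []) ∷ [])
  both-past-b₂ = certify 9 (λ α β p q b s A B X → A :+ B :< α :* p :+ β :* q ∷ q :≤ s ∷ α :* b :+ β :* s :≡ B ∷
      α :* X :≤ A :+ α :* b ∷ p :≤ X ∷ [] ⊢ absurd)
    ((1 , fwd 0 1 [] ∷ fwd 2 1 [] ∷ fwd 3 1 [] ∷ fwd 1 1 (1 ∷ []) ∷ fwd 4 1 (0 ∷ []) ∷ []) ∷ [])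
  both-lo-above = certify 9 (λ α β l m t r A B c → A :+ B :< α :* (l :+ t) :+ β :* (m :+ r) ∷
      α :* t :+ β :* r :≡ A ∷ c :≤ B ∷ [] ⊢ c :< α :* l :+ β :* m)
    ((1 , fwd 0 1 [] ∷ fwd 1 1 [] ∷ fwd 2 1 [] ∷ []) ∷ [])
  both-lo-below = certify 9 (λ α β l m t r A B c → α :* (l :+ t) :+ β :* (m :+ r) :≤ A :+ B :+ c ∷
      α :* t :+ β :* r :≡ A ∷ c :≤ A ∷ [] ⊢ α :* l :+ β :* m :≤ A :+ B)
    ((1 , fwd 0 1 [] ∷ bwd 1 1 [] ∷ fwd 2 1 [] ∷ []) ∷ [])
  both-crossing = certify 8 (λ X p q d t l i j → p :+ i :≡ X ∷ q :+ j :≡ X ∷ i :< d ∷ p :≡ l :+ t ∷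
      q :≡ l :+ (t :+ d) ∷ [] ⊢ absurd)
    ((1 , bwd 0 1 [] ∷ fwd 1 1 [] ∷ fwd 2 1 [] ∷ fwd 3 1 [] ∷ bwd 4 1 [] ∷ []) ∷ [])
  part-of-value = certify 5 (λ α β b s B → α :* b :+ β :* s :≡ B ∷ [] ⊢ α :* b :≤ B)
    ((1 , fwd 0 1 [] ∷ []) ∷ [])
  both-count = certify 7 (λ n M I P Q W XY → n :+ (M :+ I) :≤ XY ∷ W :≡ (I :+ Q) :+ P ∷ []
      ⊢ n :+ (M :+ W) :≤ XY :+ (P :+ Q))
    ((1 , fwd 0 1 [] ∷ fwd 1 1 [] ∷ []) ∷ [])

  -- Points to the left of a + (b − a) are matched downwards through a or b according to their height; within
  -- horizontal distance d = b₁ − a₁ of the right edge the two kinds of partners cannot collide.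
  module Both {X Y} (S : SumFreeSet X Y) (α β c A B w e v₁ v₂ : ℕ) {t r d s : ℕ} (1≤α : 1 ≤ α) (1≤β : 1 ≤ β)
    (above : ∀ {p} → p ∈ pts S → c ≤ lin α β p) (c≤αX : c ≤ α * X) (c≤βY : c ≤ β * Y)
    (a∈S : (t , r) ∈ pts S) (b∈S : (t + d , s) ∈ pts S)
    (touch-a : α * t + β * r ≡ A) (touch-b : α * (t + d) + β * s ≡ B)
    (range : α * X + β * Y ≡ A + B + w) (steep : α * X ≤ A + α * (t + d)) (e+≤c : e + (α + β) ≤ c)
    (w≤₁ : w ≤ α * d + v₁) (w≤₂ : w ≤ c + v₂)
    (D : List Pt) (D-unique : Unique D) (D-inBox : ∀ {p} → p ∈ D → Box X Y p)
    (D-missing : ∀ {p} → p ∈ D → p ∉ pts S) (D-above : ∀ {p} → p ∈ D → c ≤ lin α β p)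
    (D-below : ∀ {p} → p ∈ D → lin α β p ≤ A + B)
    (D-far-a : ∀ {p} → p ∈ D → ¬ Box X Y (p ⊹ (t , r))) (D-far-b : ∀ {p} → p ∈ D → ¬ Box X Y (p ⊹ (t + d , s))) where

    open BelowLine S α β c e 1≤α 1≤β above c≤αX c≤βY e+≤c
    open With D D-unique D-inBox D-missing D-above

    c≤A : c ≤ A
    c≤A = ≤-trans (above a∈S) (≤-reflexive touch-a)
    c≤B : c ≤ B
    c≤B = ≤-trans (above b∈S) (≤-reflexive touch-b)
    b≤X : t + d ≤ X
    b≤X = proj₂ (proj₁ (pts-inBox S b∈S))
    αb≤B : α * (t + d) ≤ B
    αb≤B = part-of-value α β (t + d) s B touch-b

    hi lo : Pt → Pt
    hi p = X ∸ proj₁ p , Y ∸ proj₂ p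
    lo p with r <? proj₂ (hi p)
    ... | yes _ = proj₁ (hi p) ∸ t , proj₂ (hi p) ∸ r
    ... | no _ = proj₁ (hi p) ∸ (t + d) , proj₂ (hi p) ∸ s

    fits₁? : Decidable (λ (p : Pt) → proj₁ p < d)
    fits₁? p = proj₁ p <? d
    fits₂? : Decidable (λ (p : Pt) → w ≤ c + lin α β p)
    fits₂? p = w ≤? c + lin α β p

    T T₁ Is : List Pt
    T = tri α β w
    T₁ = filter fits₁? T
    Is = filter fits₂? T₁

    T₁-unique : Unique T₁
    T₁-unique = Unique.filter⁺ fits₁? (tri-unique α β w)

    ∈-T₁ : ∀ {p} → p ∈ T₁ → lin α β p < w × proj₁ p < d
    ∈-T₁ q = let h , k = ∈-filter⁻ fits₁? {xs = T} q in ∈-tri⁻ α β w h , k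

    ∈-Is : ∀ {p} → p ∈ Is → lin α β p < w × proj₁ p < d × w ≤ c + lin α β p
    ∈-Is q = let h , k = ∈-filter⁻ fits₂? {xs = T₁} q in proj₁ (∈-T₁ h) , proj₂ (∈-T₁ h) , k

    column<X : ∀ {p} → p ∈ Is → proj₁ p < X
    column<X q = ≤-trans (proj₁ (proj₂ (∈-Is q))) (≤-trans (m≤n+m d t) b≤X)

    row<Y : ∀ {p} → p ∈ Is → proj₂ p < Y
    row<Y {i , j} q = ≰⇒> (λ Y≤j → both-row α β X Y i j w A B (t + d) range (proj₁ (∈-Is q)) Y≤j αb≤B steep)

    hi₁ : ∀ {p} → p ∈ Is → proj₁ (hi p) + proj₁ p ≡ X
    hi₁ q = m∸n+n≡m (<⇒≤ (column<X q))
    hi₂ : ∀ {p} → p ∈ Is → proj₂ (hi p) + proj₂ p ≡ Y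
    hi₂ q = m∸n+n≡m (<⇒≤ (row<Y q))

    hi-over : ∀ {p} → p ∈ Is → A + B < lin α β (hi p)
    hi-over {i , j} q = both-hi α β X Y (X ∸ i) (Y ∸ j) i j w A B (hi₁ q) (hi₂ q) range (proj₁ (∈-Is q))

    hi-under : ∀ {p} → p ∈ Is → lin α β (hi p) ≤ A + B + c
    hi-under {i , j} q = both-hi-bounded α β X Y (X ∸ i) (Y ∸ j) i j w A B c (hi₁ q) (hi₂ q) range (proj₂ (proj₂ (∈-Is q)))

    hi-inBox : ∀ {p} → p ∈ Is → Box X Y (hi p)
    hi-inBox {i , j} q = (m<n⇒0<n∸m (column<X q) , m∸n≤m X i) , (m<n⇒0<n∸m (row<Y q) , m∸n≤m Y j)

    data Partner (p : Pt) : Set where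
      via-a : 1 ≤ proj₁ (lo p) → 1 ≤ proj₂ (lo p) → hi p ≡ lo p ⊹ (t , r) → Partner p
      via-b : 1 ≤ proj₁ (lo p) → 1 ≤ proj₂ (lo p) → hi p ≡ lo p ⊹ (t + d , s) → Partner p

    partner : ∀ {p} → p ∈ Is → Partner p
    partner {p} q with r <? proj₂ (hi p) | via-a {p} | via-b {p}
    ... | yes r< | a | _ = a (m<n⇒0<n∸m t<) (m<n⇒0<n∸m r<)
        (cong₂ _,_ (sym (m∸n+n≡m (<⇒≤ t<))) (sym (m∸n+n≡m (<⇒≤ r<))))
      where
      t< : t < proj₁ (hi p)
      t< = both-past-a X (proj₁ (hi p)) (proj₁ p) d t (hi₁ q) (proj₁ (proj₂ (∈-Is q))) b≤X
    ... | no r≮ | _ | b = b (m<n⇒0<n∸m b₁<) (m<n⇒0<n∸m b₂<)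
        (cong₂ _,_ (sym (m∸n+n≡m (<⇒≤ b₁<))) (sym (m∸n+n≡m (<⇒≤ b₂<))))
      where
      b₁< : t + d < proj₁ (hi p)
      b₁< = ≰⇒> (both-past-b₁ α β (proj₁ (hi p)) (proj₂ (hi p)) t r (t + d) A B (hi-over q) (≮⇒≥ r≮) touch-a αb≤B)
      -- If the upper point were at height at most s, its level above A + B would force its column
      -- past (A + αb₁)/α, where b₁ = t + d, and by `steep` this is beyond the right edge.
      b₂< : s < proj₂ (hi p)
      b₂< = ≰⇒> (λ h → both-past-b₂ α β (proj₁ (hi p)) (proj₂ (hi p)) (t + d) s A B X (hi-over q) h touch-b steep (m∸n≤m X (proj₁ p)))

    lo-inBox : ∀ {p} → p ∈ Is → Box X Y (lo p)
    lo-inBox {p} q with partner q | hi-inBox q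
    ... | via-a l₁ l₂ e′ | (_ , u₁) , (_ , u₂) =
      (l₁ , ≤-trans (m≤m+n _ t) (subst (_≤ X) (cong proj₁ e′) u₁)) , (l₂ , ≤-trans (m≤m+n _ r) (subst (_≤ Y) (cong proj₂ e′) u₂))
    ... | via-b l₁ l₂ e′ | (_ , u₁) , (_ , u₂) =
      (l₁ , ≤-trans (m≤m+n _ (t + d)) (subst (_≤ X) (cong proj₁ e′) u₁)) , (l₂ , ≤-trans (m≤m+n _ s) (subst (_≤ Y) (cong proj₂ e′) u₂))

    lo-over : ∀ {p} → p ∈ Is → c < lin α β (lo p)
    lo-over {p} q with partner q
    ... | via-a _ _ e′ = both-lo-above α β (proj₁ (lo p)) (proj₂ (lo p)) t r A B c
      (subst (λ h → A + B < lin α β h) e′ (hi-over q)) touch-a c≤B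
    ... | via-b _ _ e′ = both-lo-above α β (proj₁ (lo p)) (proj₂ (lo p)) (t + d) s B A c
      (subst (_< lin α β (lo p ⊹ (t + d , s))) (+-comm A B) (subst (λ h → A + B < lin α β h) e′ (hi-over q))) touch-b c≤A

    lo-under : ∀ {p} → p ∈ Is → lin α β (lo p) ≤ A + B
    lo-under {p} q with partner q
    ... | via-a _ _ e′ = both-lo-below α β (proj₁ (lo p)) (proj₂ (lo p)) t r A B c
      (subst (λ h → lin α β h ≤ A + B + c) e′ (hi-under q)) touch-a c≤A
    ... | via-b _ _ e′ = subst (lin α β (lo p) ≤_) (+-comm B A)
      (both-lo-below α β (proj₁ (lo p)) (proj₂ (lo p)) (t + d) s B A c
        (subst (λ k → lin α β (lo p ⊹ (t + d , s)) ≤ k + c) (+-comm A B)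
          (subst (λ h → lin α β h ≤ A + B + c) e′ (hi-under q))) touch-b c≤B)

    hi-injective : ∀ {p q} → p ∈ Is → q ∈ Is → hi p ≡ hi q → p ≡ q
    hi-injective p q e′ = cong₂ _,_ (∸-cancelˡ-≡ (<⇒≤ (column<X p)) (<⇒≤ (column<X q)) (cong proj₁ e′))
      (∸-cancelˡ-≡ (<⇒≤ (row<Y p)) (<⇒≤ (row<Y q)) (cong proj₂ e′))

    crossing : ∀ {p q} → p ∈ Is → q ∈ Is → ∀ l → hi p ≡ l ⊹ (t , r) → hi q ≡ l ⊹ (t + d , s) → ⊥
    crossing {p} {q} i j l e₁ e₂ = both-crossing X (proj₁ (hi p)) (proj₁ (hi q)) d t (proj₁ l) (proj₁ p) (proj₁ q)
      (hi₁ i) (hi₁ j) (proj₁ (proj₂ (∈-Is i))) (cong proj₁ e₁) (cong proj₁ e₂)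

    lo-injective : ∀ {p q} → p ∈ Is → q ∈ Is → lo p ≡ lo q → p ≡ q
    lo-injective {p} {q} i j e′ with partner i | partner j
    ... | via-a _ _ a | via-a _ _ b = hi-injective i j (trans a (trans (cong (_⊹ (t , r)) e′) (sym b)))
    ... | via-b _ _ a | via-b _ _ b = hi-injective i j (trans a (trans (cong (_⊹ (t + d , s)) e′) (sym b)))
    ... | via-a _ _ a | via-b _ _ b = ⊥-elim (crossing i j (lo p) a (trans b (cong (_⊹ (t + d , s)) (sym e′))))
    ... | via-b _ _ a | via-a _ _ b = ⊥-elim (crossing j i (lo p) (trans b (cong (_⊹ (t , r)) (sym e′))) a)

    hi-or-lo : ∀ {p} → p ∈ Is → hi p ∈ pts S → lo p ∉ pts S
    hi-or-lo q hi∈ lo∈ with partner q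
    ... | via-a _ _ e′ = pts-sumFree S lo∈ a∈S (subst (_∈ pts S) e′ hi∈)
    ... | via-b _ _ e′ = pts-sumFree S lo∈ b∈S (subst (_∈ pts S) e′ hi∈)

    lo∉D : ∀ {p} → p ∈ Is → lo p ∉ D
    lo∉D q h with partner q
    ... | via-a _ _ e′ = D-far-a h (subst (Box X Y) e′ (hi-inBox q))
    ... | via-b _ _ e′ = D-far-b h (subst (Box X Y) e′ (hi-inBox q))

    pairing : Pairing S (cut ++ D) Is hi lo
    pairing = record
      { missing-unique = Ms-unique
      ; missing-inBox = Ms-inBox
      ; missing = Ms-missing
      ; index-unique = Unique.filter⁺ fits₂? T₁-unique
      ; hi-inBox = hi-inBox
      ; lo-inBox = lo-inBox
      ; hi-or-lo = hi-or-lo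
      ; hi-fresh = λ q → ∉-Ms (≤-trans (≤-trans c≤A (m≤m+n A B)) (<⇒≤ (hi-over q))) (λ h → <⇒≱ (hi-over q) (D-below h))
      ; lo-fresh = λ q → ∉-Ms (<⇒≤ (lo-over q)) (lo∉D q)
      ; hi-injective = hi-injective
      ; lo-injective = lo-injective
      ; hi≢lo = λ i j e′ → <⇒≱ (hi-over i) (subst (λ p → lin α β p ≤ A + B) (sym e′) (lo-under j))
      }

    bound : size S + (length (tri α β e) + length D + length (tri α β w)) ≤
      X * Y + (length (tri α β v₁) + length (tri α β v₂))
    bound = ≤-trans (both-count (size S) _ (length Is) (length (filter (¬? ∘ fits₁?) T))
        (length (filter (¬? ∘ fits₂?) T₁)) (length T) (X * Y)
        (subst (λ k → size S + (k + length Is) ≤ X * Y) length-Ms (pairing-bound pairing))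
        (trans (length-filter-split fits₁? T)
          (cong (_+ length (filter (¬? ∘ fits₁?) T)) (length-filter-split fits₂? T₁))))
      (+-monoʳ-≤ (X * Y) (+-mono-≤ lost₁ lost₂))
      where
      lost₁ : length (filter (¬? ∘ fits₁?) T) ≤ length (tri α β v₁)
      lost₁ = length-≤-injection (λ p → proj₁ p ∸ d , proj₂ p) (Unique.filter⁺ (¬? ∘ fits₁?) (tri-unique α β w))
        (λ {p} q → let h , k = ∈-filter⁻ (¬? ∘ fits₁?) {xs = T} q in
          ∈-tri⁺ α β v₁ 1≤α 1≤β (overflow₁ α β d (proj₁ p) (proj₂ p) _ w v₁ (m+[n∸m]≡n (≮⇒≥ k)) (∈-tri⁻ α β w h) w≤₁))
        (λ p q e′ → let _ , k = ∈-filter⁻ (¬? ∘ fits₁?) {xs = T} p ; _ , k′ = ∈-filter⁻ (¬? ∘ fits₁?) {xs = T} q in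
          cong₂ _,_ (∸-cancelʳ-≡ (≮⇒≥ k) (≮⇒≥ k′) (cong proj₁ e′)) (cong proj₂ e′))
      lost₂ : length (filter (¬? ∘ fits₂?) T₁) ≤ length (tri α β v₂)
      lost₂ = length-≤-⊆ (Unique.filter⁺ (¬? ∘ fits₂?) T₁-unique)
        (λ {p} q → let h , k = ∈-filter⁻ (¬? ∘ fits₂?) {xs = T₁} q in
          ∈-tri⁺ α β v₂ 1≤α 1≤β (overflow₃ (lin α β p) w v₂ c (≰⇒> k) w≤₂))

  -- The hull edge crossing the diagonal

  least : {A : Set} (_≼_ : A → A → Set) → (∀ x y → x ≼ y ⊎ y ≼ x) → (∀ {x y z} → x ≼ y → y ≼ z → x ≼ z) →
    ∀ x xs → ∃[ m ] (m ∈ x ∷ xs × (∀ {y} → y ∈ x ∷ xs → m ≼ y))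
  least _≼_ total trans′ x [] with total x x
  ... | inj₁ h = x , here refl , λ { (here refl) → h }
  ... | inj₂ h = x , here refl , λ { (here refl) → h }
  least _≼_ total trans′ x (y ∷ ys) with least _≼_ total trans′ y ys
  ... | m , m∈ , m≤ with total x m
  ... | inj₂ m≤x = m , there m∈ , λ { (here refl) → m≤x ; (there q) → m≤ q }
  ... | inj₁ x≤m with total x x
  ... | inj₁ h = x , here refl , λ { (here refl) → h ; (there q) → trans′ x≤m (m≤ q) }
  ... | inj₂ h = x , here refl , λ { (here refl) → h ; (there q) → trans′ x≤m (m≤ q) }

  cancel-left = certify 3 (λ k a b → con 1 :≤ k ∷ b :< a ∷ k :* a :≤ k :* b ∷ [] ⊢ absurd)
    ((1 , fwd 0 1 [] ∷ fwd 2 1 [] ∷ fwd 1 1 (0 ∷ []) ∷ []) ∷ [])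

  *-cancel-≤ : ∀ k a b → 1 ≤ k → k * a ≤ k * b → a ≤ b
  *-cancel-≤ k a b 1≤k h with a ≤? b
  ... | yes p = p
  ... | no p = ⊥-elim (cancel-left k a b 1≤k (≰⇒> p) h)

  -- A fraction num / den, compared by cross-multiplication.
  record Fraction : Set where
    constructor _÷_⟨_⟩
    field
      num den : ℕ
      den-positive : 1 ≤ den

  _≼_ : Fraction → Fraction → Set
  (n ÷ d ⟨ _ ⟩) ≼ (n′ ÷ d′ ⟨ _ ⟩) = n * d′ ≤ n′ * d

  cross-trans = certify 6 (λ n₁ d₁ n₂ d₂ n₃ d₃ → n₁ :* d₂ :≤ n₂ :* d₁ ∷ n₂ :* d₃ :≤ n₃ :* d₂ ∷ []
      ⊢ d₂ :* (n₁ :* d₃) :≤ d₂ :* (n₃ :* d₁))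
    ((1 , fwd 0 1 (5 ∷ []) ∷ fwd 1 1 (1 ∷ []) ∷ []) ∷ [])

  ≼-trans : ∀ {f g h} → f ≼ g → g ≼ h → f ≼ h
  ≼-trans {n₁ ÷ d₁ ⟨ _ ⟩} {n₂ ÷ d₂ ⟨ p ⟩} {n₃ ÷ d₃ ⟨ _ ⟩} h k =
    *-cancel-≤ d₂ (n₁ * d₃) (n₃ * d₁) p (cross-trans n₁ d₁ n₂ d₂ n₃ d₃ h k)

  ≼-total : ∀ f g → f ≼ g ⊎ g ≼ f
  ≼-total (n ÷ d ⟨ _ ⟩) (n′ ÷ d′ ⟨ _ ⟩) = ≤-total (n * d′) (n′ * d)

  odd-weight′ = certify 2 (λ k z → [] ⊢ k :+ ((con 1 :+ k) :+ con 0) :+ con 1 :+ 2 · z :≡ 2 · ((con 1 :+ k) :+ z))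
    ((1 , []) ∷ (1 , []) ∷ [])

  odd-weight : ∀ k z → pred (2 * suc k) + 1 + 2 * z ≡ 2 * (suc k + z)
  odd-weight = odd-weight′

  -- For a = (a₁, a₂) write a = a₁Y and A = a₂X, and similarly for the other points, so that the diagonal of the
  -- box becomes the diagonal of a square.  The hull edge is found as the pair (a, b), a above and b below the
  -- diagonal, whose connecting segment meets the line A − a = −1/2 lowest; no lattice point lies on that line,
  -- which keeps all the weights wa = 2(A − a) + 1 and wb = 2(b − B) − 1 positive.
  orient-down′ = certify 6 (λ ga gb gx wa wb wx →
      (wb :* ga :+ wa :* gb) :* (wa :+ wx) :≤ (wx :* ga :+ wa :* gx) :* (wa :+ wb) ∷ []
      ⊢ wa :* (wb :* ga :+ gb :* wa :+ gb :* wx) :≤ wa :* (wx :* ga :+ gx :* wa :+ gx :* wb))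
    ((1 , fwd 0 1 [] ∷ []) ∷ [])
  orient-up′ = certify 6 (λ ga gb gx wa wb wx →
      (wb :* ga :+ wa :* gb) :* (wx :+ wb) :≤ (wb :* gx :+ wx :* gb) :* (wa :+ wb) ∷ []
      ⊢ wb :* (ga :* wx :+ ga :* wb :+ wa :* gb) :≤ wb :* (gx :* wa :+ gx :* wb :+ wx :* gb))
    ((1 , fwd 0 1 [] ∷ []) ∷ [])
  orient-down″ = certify 9 (λ a A b B x Z wa wb wx → wa :+ 2 · a :≡ con 1 :+ 2 · A ∷
      wb :+ con 1 :+ 2 · B :≡ 2 · b ∷ wx :+ con 1 :+ 2 · Z :≡ 2 · x ∷
      wb :* (a :+ A) :+ (b :+ B) :* wa :+ (b :+ B) :* wx :≤ wx :* (a :+ A) :+ (x :+ Z) :* wa :+ (x :+ Z) :* wb ∷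
      [] ⊢ b :* A :+ a :* Z :+ B :* x :≤ a :* B :+ A :* x :+ b :* Z)
    ((4 , fwd 3 1 [] ∷ bwd 0 1 (2 ∷ []) ∷ bwd 0 1 (3 ∷ []) ∷ fwd 0 1 (4 ∷ []) ∷ fwd 0 1 (5 ∷ []) ∷ bwd 1 1 (0 ∷
     []) ∷ bwd 1 1 (1 ∷ []) ∷ fwd 1 1 (4 ∷ []) ∷ fwd 1 1 (5 ∷ []) ∷ fwd 2 1 (0 ∷ []) ∷ fwd 2 1 (1 ∷ []) ∷
     bwd 2 1 (2 ∷ []) ∷ bwd 2 1 (3 ∷ []) ∷ []) ∷ [])
  orient-up″ = certify 9 (λ a A b B x Z wa wb wx → wa :+ 2 · a :≡ con 1 :+ 2 · A ∷ wb :+ con 1 :+ 2 · B :≡ 2 · b ∷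
      wx :+ 2 · x :≡ con 1 :+ 2 · Z ∷
      (a :+ A) :* wx :+ (a :+ A) :* wb :+ wa :* (b :+ B) :≤ (x :+ Z) :* wa :+ (x :+ Z) :* wb :+ wx :* (b :+ B) ∷
      [] ⊢ b :* A :+ a :* Z :+ B :* x :≤ a :* B :+ A :* x :+ b :* Z)
    ((4 , fwd 3 1 [] ∷ bwd 0 1 (2 ∷ []) ∷ bwd 0 1 (3 ∷ []) ∷ fwd 0 1 (4 ∷ []) ∷ fwd 0 1 (5 ∷ []) ∷ bwd 1 1 (0 ∷
     []) ∷ bwd 1 1 (1 ∷ []) ∷ fwd 1 1 (4 ∷ []) ∷ fwd 1 1 (5 ∷ []) ∷ bwd 2 1 (0 ∷ []) ∷ bwd 2 1 (1 ∷ []) ∷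
     fwd 2 1 (2 ∷ []) ∷ fwd 2 1 (3 ∷ []) ∷ []) ∷ [])

  -- For x below the diagonal the pair (a , b) is compared with (a , x). Once the common factor `wa`
  -- is cancelled, comparing the two crossing heights is the sign of the orientation determinant of
  -- a, b, x.
  orient-down : ∀ a A b B x Z wa wb wx → 1 ≤ wa → wa + 2 * a ≡ 1 + 2 * A → wb + 1 + 2 * B ≡ 2 * b →
    wx + 1 + 2 * Z ≡ 2 * x →
    (wb * (a + A) + wa * (b + B)) * (wa + wx) ≤ (wx * (a + A) + wa * (x + Z)) * (wa + wb) →
    b * A + a * Z + B * x ≤ a * B + A * x + b * Z
  orient-down a A b B x Z wa wb wx 1≤wa ea eb ex h = orient-down″ a A b B x Z wa wb wx ea eb ex
    (*-cancel-≤ wa (wb * (a + A) + (b + B) * wa + (b + B) * wx) (wx * (a + A) + (x + Z) * wa + (x + Z) * wb) 1≤wa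
      (orient-down′ (a + A) (b + B) (x + Z) wa wb wx h))

  orient-up : ∀ a A b B x Z wa wb wx → 1 ≤ wb → wa + 2 * a ≡ 1 + 2 * A → wb + 1 + 2 * B ≡ 2 * b →
    wx + 2 * x ≡ 1 + 2 * Z →
    (wb * (a + A) + wa * (b + B)) * (wx + wb) ≤ (wb * (x + Z) + wx * (b + B)) * (wa + wb) →
    b * A + a * Z + B * x ≤ a * B + A * x + b * Z
  orient-up a A b B x Z wa wb wx 1≤wb ea eb ex h = orient-up″ a A b B x Z wa wb wx ea eb ex
    (*-cancel-≤ wb ((a + A) * wx + (a + A) * wb + wa * (b + B)) ((x + Z) * wa + (x + Z) * wb + wx * (b + B)) 1≤wb
      (orient-up′ (a + A) (b + B) (x + Z) wa wb wx h))

  -- x lies on or above the line through a and b.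
  Above : Pt → Pt → Pt → Set
  Above (a₁ , a₂) (b₁ , b₂) (x₁ , x₂) = b₁ * a₂ + a₁ * x₂ + b₂ * x₁ ≤ a₁ * b₂ + a₂ * x₁ + b₁ * x₂

  descale = certify 8 (λ X Y a₁ a₂ b₁ b₂ x₁ x₂ →
      (b₁ :* Y) :* (a₂ :* X) :+ (a₁ :* Y) :* (x₂ :* X) :+ (b₂ :* X) :* (x₁ :* Y) :≤ (a₁ :* Y) :* (b₂ :* X) :+ (a₂ :* X) :* (x₁ :* Y) :+ (b₁ :* Y) :* (x₂ :* X) ∷
      [] ⊢ (X :* Y) :* (b₁ :* a₂ :+ a₁ :* x₂ :+ b₂ :* x₁) :≤ (X :* Y) :* (a₁ :* b₂ :+ a₂ :* x₁ :+ b₁ :* x₂))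
    ((1 , fwd 0 1 [] ∷ []) ∷ [])
  cross-strict = certify 4 (λ a A b B → a :≤ A ∷ B :< b ∷ con 1 :≤ A ∷ [] ⊢ a :* B :< b :* A)
    ((1 , fwd 2 1 [] ∷ fwd 0 1 (3 ∷ []) ∷ fwd 1 1 (1 ∷ []) ∷ []) ∷ [])
  cross-strict′ = certify 6 (λ X Y a₁ a₂ b₁ b₂ → (a₁ :* Y) :* (b₂ :* X) :< (b₁ :* Y) :* (a₂ :* X) ∷ []
      ⊢ (X :* Y) :* (a₁ :* b₂) :< (X :* Y) :* (b₁ :* a₂))
    ((1 , fwd 0 1 [] ∷ []) ∷ [])
  left-of = certify 5 (λ a₁ a₂ b₁ b₂ Y → a₁ :* b₂ :< b₁ :* a₂ ∷
      b₁ :* a₂ :+ a₁ :* Y :+ b₂ :* con 0 :≤ a₁ :* b₂ :+ a₂ :* con 0 :+ b₁ :* Y ∷ b₁ :≤ a₁ ∷ [] ⊢ absurd)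
    ((1 , fwd 0 1 [] ∷ fwd 1 1 [] ∷ fwd 2 1 (4 ∷ []) ∷ []) ∷ [])
  below-of = certify 5 (λ a₁ a₂ b₁ b₂ X → a₁ :* b₂ :< b₁ :* a₂ ∷
      b₁ :* a₂ :+ a₁ :* con 0 :+ b₂ :* X :≤ a₁ :* b₂ :+ a₂ :* X :+ b₁ :* con 0 ∷ a₂ :≤ b₂ ∷ [] ⊢ absurd)
    ((1 , fwd 0 1 [] ∷ fwd 1 1 [] ∷ fwd 2 1 (4 ∷ []) ∷ []) ∷ [])
  edge-above = certify 6 (λ α β a₁ b₂ x₁ x₂ →
      (a₁ :+ β) :* (b₂ :+ α) :+ a₁ :* x₂ :+ b₂ :* x₁ :≤ a₁ :* b₂ :+ (b₂ :+ α) :* x₁ :+ (a₁ :+ β) :* x₂ ∷ []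
      ⊢ α :* a₁ :+ β :* (b₂ :+ α) :≤ α :* x₁ :+ β :* x₂)
    ((1 , fwd 0 1 [] ∷ []) ∷ [])
  edge-X = certify 5 (λ α β a₁ b₂ X →
      (a₁ :+ β) :* (b₂ :+ α) :+ a₁ :* con 0 :+ b₂ :* X :≤ a₁ :* b₂ :+ (b₂ :+ α) :* X :+ (a₁ :+ β) :* con 0 ∷ []
      ⊢ α :* a₁ :+ β :* (b₂ :+ α) :≤ α :* X)
    ((1 , fwd 0 1 [] ∷ []) ∷ [])
  edge-Y = certify 5 (λ α β a₁ b₂ Y →
      (a₁ :+ β) :* (b₂ :+ α) :+ a₁ :* Y :+ b₂ :* con 0 :≤ a₁ :* b₂ :+ (b₂ :+ α) :* con 0 :+ (a₁ :+ β) :* Y ∷ []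
      ⊢ α :* a₁ :+ β :* (b₂ :+ α) :≤ β :* Y)
    ((1 , fwd 0 1 [] ∷ []) ∷ [])

  -- A supporting line lin α β = c of S whose contact points a and b lie on different sides of the diagonal; the
  -- corners (0 , Y) and (X , 0) are allowed as contact points, which forces both intercepts to be inside the box.
  record Edge {X Y : ℕ} (S : SumFreeSet X Y) : Set where
    field
      α β a₁ a₂ b₂ : ℕ
      1≤α : 1 ≤ α
      1≤β : 1 ≤ β
      a₂≡ : a₂ ≡ b₂ + α
    c : ℕ
    c = α * a₁ + β * a₂
    field
      a∈ : (a₁ , a₂) ∈ pts S ⊎ (a₁ ≡ 0 × a₂ ≡ Y)
      b∈ : (a₁ + β , b₂) ∈ pts S ⊎ (a₁ + β ≡ X × b₂ ≡ 0)
      above : ∀ {p} → p ∈ pts S → c ≤ lin α β p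
      c≤αX : c ≤ α * X
      c≤βY : c ≤ β * Y
      a-left : a₁ * Y ≤ a₂ * X
      b-right : b₂ * X ≤ (a₁ + β) * Y

  module HullEdge {X Y} (S : SumFreeSet X Y) (1≤X : 1 ≤ X) (1≤Y : 1 ≤ Y) where

    up? : Decidable (λ (p : Pt) → proj₁ p * Y ≤ proj₂ p * X)
    up? p = proj₁ p * Y ≤? proj₂ p * X

    Up Down : List Pt
    Up = (0 , Y) ∷ filter up? (pts S)
    Down = (X , 0) ∷ filter (¬? ∘ up?) (pts S)

    g wU wD : Pt → ℕ
    g p = proj₁ p * Y + proj₂ p * X
    wU p = suc (2 * (proj₂ p * X ∸ proj₁ p * Y))
    wD p = pred (2 * (proj₁ p * Y ∸ proj₂ p * X))

    1≤XY : 1 ≤ X * Y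
    1≤XY = *-mono-≤ 1≤X 1≤Y

    Up-left : ∀ {p} → p ∈ Up → proj₁ p * Y ≤ proj₂ p * X
    Up-left (here refl) = z≤n
    Up-left (there q) = proj₂ (∈-filter⁻ up? {xs = pts S} q)

    Down-right : ∀ {p} → p ∈ Down → proj₂ p * X < proj₁ p * Y
    Down-right (here refl) = 1≤XY
    Down-right (there q) = ≰⇒> (proj₂ (∈-filter⁻ (¬? ∘ up?) {xs = pts S} q))

    wU-eq : ∀ {p} → p ∈ Up → wU p + 2 * (proj₁ p * Y) ≡ 1 + 2 * (proj₂ p * X)
    wU-eq {p} q = cong suc (trans (sym (*-distribˡ-+ 2 (proj₂ p * X ∸ proj₁ p * Y) _)) (cong (2 *_) (m∸n+n≡m (Up-left q))))

    wD-positive : ∀ {p} → p ∈ Down → 1 ≤ wD p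
    wD-positive {p} q with proj₁ p * Y ∸ proj₂ p * X | m<n⇒0<n∸m (Down-right q)
    ... | suc k | _ = subst (1 ≤_) (sym (+-suc k (k + 0))) (s≤s z≤n)

    wD-eq : ∀ {p} → p ∈ Down → wD p + 1 + 2 * (proj₂ p * X) ≡ 2 * (proj₁ p * Y)
    wD-eq {p} q with proj₁ p * Y ∸ proj₂ p * X in eq | m<n⇒0<n∸m (Down-right q)
    ... | suc k | _ = trans (odd-weight k (proj₂ p * X))
      (cong (2 *_) (trans (cong (_+ proj₂ p * X) (sym eq)) (m∸n+n≡m (<⇒≤ (Down-right q)))))

    -- The value of `g`, the sum of the rescaled coordinates, where the segment from a to b crosses
    -- the line A - a = -1/2. The weights are the doubled offsets of the two ends from that line,
    -- each attached to the opposite end.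
    level : Pt × Pt → Fraction
    level (a , b) = (wD b * g a + wU a * g b) ÷ (wU a + wD b) ⟨ s≤s z≤n ⟩

    descaled : ∀ a b x → proj₁ b * Y * (proj₂ a * X) + proj₁ a * Y * (proj₂ x * X) + proj₂ b * X * (proj₁ x * Y) ≤
      proj₁ a * Y * (proj₂ b * X) + proj₂ a * X * (proj₁ x * Y) + proj₁ b * Y * (proj₂ x * X) → Above a b x
    descaled (a₁ , a₂) (b₁ , b₂) (x₁ , x₂) h = *-cancel-≤ (X * Y) _ _ 1≤XY (descale X Y a₁ a₂ b₁ b₂ x₁ x₂ h)

    Lowest : Pt → Pt → Set
    Lowest a b = ∀ {x y} → x ∈ Up → y ∈ Down → level (a , b) ≼ level (x , y)

    above-Down : ∀ a b → a ∈ Up → b ∈ Down → Lowest a b → ∀ {x} → x ∈ Down → Above a b x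
    above-Down a b a∈ b∈ low {x} q = descaled a b x
      (orient-down (proj₁ a * Y) (proj₂ a * X) (proj₁ b * Y) (proj₂ b * X) (proj₁ x * Y) (proj₂ x * X) (wU a) (wD b) (wD x)
        (s≤s z≤n) (wU-eq a∈) (wD-eq b∈) (wD-eq q) (low a∈ q))

    above-Up : ∀ a b → a ∈ Up → b ∈ Down → Lowest a b → ∀ {x} → x ∈ Up → Above a b x
    above-Up a b a∈ b∈ low {x} q = descaled a b x
      (orient-up (proj₁ a * Y) (proj₂ a * X) (proj₁ b * Y) (proj₂ b * X) (proj₁ x * Y) (proj₂ x * X) (wU a) (wD b) (wU x)
        (wD-positive b∈) (wU-eq a∈) (wD-eq b∈) (wU-eq q) (low q b∈))

    above-S : ∀ a b → a ∈ Up → b ∈ Down → Lowest a b → ∀ {x} → x ∈ pts S → Above a b x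
    above-S a b a∈ b∈ low {x} q with up? x
    ... | yes h = above-Up a b a∈ b∈ low (there (∈-filter⁺ up? q h))
    ... | no h = above-Down a b a∈ b∈ low (there (∈-filter⁺ (¬? ∘ up?) q h))

    positive-height : ∀ {p} → p ∈ Up → 1 ≤ proj₂ p
    positive-height (here refl) = 1≤Y
    positive-height (there q) = proj₁ (proj₂ (pts-inBox S (proj₁ (∈-filter⁻ up? {xs = pts S} q))))

    Up-origin : ∀ {p} → p ∈ Up → p ∈ pts S ⊎ (proj₁ p ≡ 0 × proj₂ p ≡ Y)
    Up-origin (here refl) = inj₂ (refl , refl)
    Up-origin (there q) = inj₁ (proj₁ (∈-filter⁻ up? {xs = pts S} q))

    Down-origin : ∀ {p} → p ∈ Down → p ∈ pts S ⊎ (proj₁ p ≡ X × proj₂ p ≡ 0)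
    Down-origin (here refl) = inj₂ (refl , refl)
    Down-origin (there q) = inj₁ (proj₁ (∈-filter⁻ (¬? ∘ up?) {xs = pts S} q))

    -- Since b is strictly below the diagonal and a is not, a₁b₂ < b₁a₂. As the corners (0 , Y) and
    -- (X , 0) are not below the line through a and b, this forces a₁ < b₁ and b₂ < a₂, so the
    -- normal vector (a₂ - b₂ , b₁ - a₁) has positive entries.
    build : ∀ a b → a ∈ Up → b ∈ Down → (∀ {x} → x ∈ pts S → Above a b x) → Above a b (X , 0) → Above a b (0 , Y) → Edge S
    build (a₁ , a₂) (b₁ , b₂) a∈ b∈ above aboveX aboveY
      with m≤n⇒∃[o]m+o≡n (≰⇒> (left-of a₁ a₂ b₁ b₂ Y strict aboveY))
         | m≤n⇒∃[o]m+o≡n (≰⇒> (below-of a₁ a₂ b₁ b₂ X strict aboveX))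
      where
      strict : a₁ * b₂ < b₁ * a₂
      strict = *-cancelˡ-< (X * Y) _ _ (cross-strict′ X Y a₁ a₂ b₁ b₂
        (cross-strict (a₁ * Y) (a₂ * X) (b₁ * Y) (b₂ * X) (Up-left a∈) (Down-right b∈) (*-mono-≤ (positive-height a∈) 1≤X)))
    ... | β , refl | α , refl = edge (suc α) (suc β) (+-suc a₁ β) (+-suc b₂ α)
      where
      edge : ∀ α′ β′ → a₁ + β′ ≡ suc a₁ + β → b₂ + α′ ≡ suc b₂ + α → {{NonZero α′}} → {{NonZero β′}} → Edge S
      edge α′ β′ e₁ e₂ = record
        { α = α′ ; β = β′ ; a₁ = a₁ ; a₂ = suc b₂ + α ; b₂ = b₂
        ; 1≤α = >-nonZero⁻¹ α′ ; 1≤β = >-nonZero⁻¹ β′ ; a₂≡ = sym e₂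
        ; a∈ = Up-origin a∈
        ; b∈ = subst (λ k → (k , b₂) ∈ pts S ⊎ (k ≡ X × b₂ ≡ 0)) (sym e₁) (Down-origin b∈)
        ; above = λ {p} q → conv (edge-above α′ β′ a₁ b₂ (proj₁ p) (proj₂ p) (conv′ (above q)))
        ; c≤αX = conv (edge-X α′ β′ a₁ b₂ X (conv′ aboveX))
        ; c≤βY = conv (edge-Y α′ β′ a₁ b₂ Y (conv′ aboveY))
        ; a-left = Up-left a∈
        ; b-right = subst (λ k → b₂ * X ≤ k * Y) (sym e₁) (<⇒≤ (Down-right b∈))
        }
        where
        conv : ∀ {k} → α′ * a₁ + β′ * (b₂ + α′) ≤ k → α′ * a₁ + β′ * (suc b₂ + α) ≤ k
        conv {k} = subst (λ z → α′ * a₁ + β′ * z ≤ k) e₂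
        conv′ : ∀ {x₁ x₂} → Above (a₁ , suc b₂ + α) (suc a₁ + β , b₂) (x₁ , x₂) → Above (a₁ , b₂ + α′) (a₁ + β′ , b₂) (x₁ , x₂)
        conv′ {x₁} {x₂} = subst₂ (λ y z → Above (a₁ , y) (z , b₂) (x₁ , x₂)) (sym e₂) (sym e₁)

    edge-of-lowest : ∀ a b → a ∈ Up → b ∈ Down → Lowest a b → Edge S
    edge-of-lowest a b a∈ b∈ low = build a b a∈ b∈ (above-S a b a∈ b∈ low)
      (above-Down a b a∈ b∈ low (here refl)) (above-Up a b a∈ b∈ low (here refl))

    lowest : ∃[ m ] (m ∈ ((0 , Y) , (X , 0)) ∷ cartesianProduct Up Down ×
      (∀ {y} → y ∈ ((0 , Y) , (X , 0)) ∷ cartesianProduct Up Down → level m ≼ level y))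
    lowest = least (λ p q → level p ≼ level q) (λ p q → ≼-total (level p) (level q))
      (λ {p} {q} {r} → ≼-trans {level p} {level q} {level r}) ((0 , Y) , (X , 0)) (cartesianProduct Up Down)

    edge-of-least : ∀ {m} → m ∈ ((0 , Y) , (X , 0)) ∷ cartesianProduct Up Down →
      (∀ {y} → y ∈ ((0 , Y) , (X , 0)) ∷ cartesianProduct Up Down → level m ≼ level y) → Edge S
    edge-of-least {a , b} (here refl) low = edge-of-lowest a b (here refl) (here refl)
      (λ {x} {y} p q → low {x , y} (there (∈-cartesianProduct⁺ p q)))
    edge-of-least {a , b} (there m∈) low = edge-of-lowest a b (proj₁ (∈-cartesianProduct⁻ Up Down m∈))
      (proj₂ (∈-cartesianProduct⁻ Up Down m∈)) (λ {x} {y} p q → low {x , y} (there (∈-cartesianProduct⁺ p q)))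

    hull : Edge S
    hull = edge-of-least {proj₁ lowest} (proj₁ (proj₂ lowest)) (λ {y} → proj₂ (proj₂ lowest) {y})

  hullEdge : ∀ {X Y} (S : SumFreeSet X Y) → 1 ≤ X → 1 ≤ Y → Edge S
  hullEdge S 1≤X 1≤Y = HullEdge.hull S 1≤X 1≤Y

  -- The bound from the hull edge

  square-nonneg = certify 2 (λ x d → [] ⊢ 2 · (x :* (x :+ d)) :≤ x :* x :+ (x :+ d) :* (x :+ d))
    ((1 , []) ∷ [])

  2xy-ordered : ∀ x y → x ≤ y → 2 * (x * y) ≤ x * x + y * y
  2xy-ordered x y p with m≤n⇒∃[o]m+o≡n p
  ... | d , refl = square-nonneg x d

  2xy≤x²+y² : ∀ x y → 2 * (x * y) ≤ x * x + y * y
  2xy≤x²+y² x y with ≤-total x y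
  ... | inj₁ p = 2xy-ordered x y p
  ... | inj₂ p = subst₂ _≤_ (cong (2 *_) (*-comm y x)) (+-comm (y * y) (x * x)) (2xy-ordered y x p)

  -- The bounds on u, v and z are squared and added, with the mixed term from v² controlled by the
  -- last hypothesis, an instance of 2xy ≤ x² + y². The factor 49 has to stay below 50, the
  -- coefficient at which the surplus h² + g² enters `total`.
  deficit-H = certify 5 (λ h g u v z → 3 · u :≤ h ∷ 100 · v :≤ 11 · h :+ 36 · g ∷ 34 · z :≤ 7 · h ∷
      12 · (h :* g) :≤ 4 · (h :* h) :+ 9 · (g :* g) ∷ []
      ⊢ 250 · (u :* u :+ v :* v :+ z :* z) :≤ 49 · (h :* h :+ g :* g))
    ((42840 , fwd 3 79016 [] ∷ fwd 0 3570000 (2 ∷ []) ∷ fwd 0 1190000 (0 ∷ []) ∷ fwd 1 107100 (3 ∷ []) ∷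
     fwd 1 11781 (0 ∷ []) ∷ fwd 1 38556 (1 ∷ []) ∷ fwd 2 315000 (4 ∷ []) ∷ fwd 2 66215 (0 ∷ []) ∷ []) ∷ [])
  scaled-square = certify 2 (λ h g → 2 · (2 · h :* (3 · g)) :≤ 2 · h :* (2 · h) :+ 3 · g :* (3 · g) ∷ []
      ⊢ 12 · (h :* g) :≤ 4 · (h :* h) :+ 9 · (g :* g))
    ((1 , fwd 0 1 [] ∷ []) ∷ [])
  slack-H = certify 3 (λ c h w → c :+ h :≡ 2 · w ∷ 20 · w :≤ 27 · c ∷ [] ⊢ 10 · h :≤ 17 · c)
    ((1 , fwd 0 10 [] ∷ fwd 1 1 [] ∷ []) ∷ [])
  steep-H = certify 4 (λ c h w u → c :+ h :≡ 2 · w ∷ 3 · u :+ c :≤ 2 · w ∷ [] ⊢ 3 · u :≤ h)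
    ((1 , bwd 0 1 [] ∷ fwd 1 1 [] ∷ []) ∷ [])
  level-H = certify 4 (λ c h w z → c :+ h :≡ 2 · w ∷ 10 · h :≤ 17 · c ∷ c :+ z :≡ w ∷ [] ⊢ 34 · z :≤ 7 · h)
    ((1 , bwd 0 17 [] ∷ fwd 1 1 [] ∷ fwd 2 34 [] ∷ []) ∷ [])
  -- From 20w ≤ 27c follows 2c + w ≤ (67/20)c, so cV/(2c + w) is at least (20/67)V and at most
  -- (47/67)V - c remains for v.
  position-H′ = certify 4 (λ c w V v → v :* (2 · c :+ w) :+ c :* (2 · c :+ w) :+ c :* V :≤ V :* (2 · c :+ w) ∷
      20 · w :≤ 27 · c ∷ [] ⊢ (2 · c :+ w) :* (67 · v :+ 67 · c) :≤ (2 · c :+ w) :* (47 · V))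
    ((1 , fwd 0 67 [] ∷ fwd 1 1 (2 ∷ []) ∷ []) ∷ [])
  position-H = certify 7 (λ c h w U V g v → 67 · v :+ 67 · c :≤ 47 · V ∷ U :+ V :≡ 2 · c :+ w ∷ V :≤ U :+ g ∷
      c :+ h :≡ 2 · w ∷ 10 · h :≤ 17 · c ∷ [] ⊢ 100 · v :≤ 11 · h :+ 36 · g)
    ((67 , fwd 0 100 [] ∷ fwd 1 2374 [] ∷ fwd 2 2374 [] ∷ bwd 3 1187 [] ∷ fwd 4 45 [] ∷ []) ∷ [])
  position-L = certify 5 (λ c w U V v → v :* (2 · c :+ w) :+ c :* (2 · c :+ w) :+ c :* V :≤ V :* (2 · c :+ w) ∷
      2 · w :≤ c ∷ c :≤ U ∷ U :+ V :≡ 2 · c :+ w ∷ con 1 :≤ v ∷ con 1 :≤ c ∷ [] ⊢ absurd)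
    ((9 , fwd 0 4 [] ∷ fwd 5 9 [] ∷ fwd 1 3 (0 ∷ []) ∷ fwd 1 2 (1 ∷ []) ∷ fwd 2 4 (0 ∷ []) ∷ fwd 2 4 (1 ∷ []) ∷
     fwd 3 4 (0 ∷ []) ∷ fwd 3 4 (1 ∷ []) ∷ fwd 4 8 (0 ∷ []) ∷ fwd 5 1 (0 ∷ []) ∷ []) ∷ [])
  steep-L = certify 3 (λ c w u → 2 · w :≤ c ∷ 3 · u :+ c :≤ 2 · w ∷ con 1 :≤ u ∷ [] ⊢ absurd)
    ((3 , fwd 0 1 [] ∷ fwd 1 1 [] ∷ fwd 2 3 [] ∷ []) ∷ [])
  level-L = certify 3 (λ c w z → 2 · w :≤ c ∷ c :+ z :≡ w ∷ con 1 :≤ z ∷ [] ⊢ absurd)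
    ((2 , fwd 0 1 [] ∷ fwd 1 2 [] ∷ fwd 2 2 [] ∷ []) ∷ [])

  positive-part : ∀ k w → w ∸ k ≡ 0 ⊎ k + (w ∸ k) ≡ w
  positive-part k w with ≤-total w k
  ... | inj₁ p = inj₁ (m≤n⇒m∸n≡0 p)
  ... | inj₂ p = inj₂ (m+[n∸m]≡n p)

  zero-or-positive : ∀ v → (1 ≤ v → ⊥) → v ≡ 0
  zero-or-positive zero _ = refl
  zero-or-positive (suc v) h = ⊥-elim (h (s≤s z≤n))

  -- The three ways in which part of the corner triangle may fail to be matched, in units where c is the level
  -- of the supporting line and w the level of the corner triangle.
  module Deficit (c w U V h g : ℕ) (1≤c : 1 ≤ c) (U+V≡ : U + V ≡ 2 * c + w) (c≤U : c ≤ U) (c≤V : c ≤ V)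
    (20w≤27c : 20 * w ≤ 27 * c) (U≤V+g : U ≤ V + g) (V≤U+g : V ≤ U + g) where

    Steep Level : ℕ → Set
    Steep u = u ≡ 0 ⊎ 3 * u + c ≤ 2 * w
    Level z = z ≡ 0 ⊎ c + z ≡ w

    -- Says v ≤ V - c - cV/(2c + w) without division. For a contact point (t , r) on the left of the
    -- diagonal, αt is at most the share cU/(U + V) of the level c, which limits the overflow v = V
    -- - 2c + αt.
    Positional : ℕ → ℕ → Set
    Positional V v = v ≡ 0 ⊎ v * (2 * c + w) + c * (2 * c + w) + c * V ≤ V * (2 * c + w)

    Bounded : ℕ → ℕ → ℕ → Set
    Bounded u v z = 250 * (u * u + v * v + z * z) ≤ 49 * (h * h + g * g)

    deficit-high : ∀ u v z → c + h ≡ 2 * w → Steep u → Positional U v ⊎ Positional V v → Level z → Bounded u v z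
    deficit-high u v z c+h≡2w su pv lz = deficit-H h g u v z (steep su) (position pv) (level lz)
        (scaled-square h g (2xy≤x²+y² (2 * h) (3 * g)))
      where
      10h≤17c : 10 * h ≤ 17 * c
      10h≤17c = slack-H c h w c+h≡2w 20w≤27c
      steep : Steep u → 3 * u ≤ h
      steep (inj₁ refl) = z≤n
      steep (inj₂ p) = steep-H c h w u c+h≡2w p
      level : Level z → 34 * z ≤ 7 * h
      level (inj₁ refl) = z≤n
      level (inj₂ p) = level-H c h w z c+h≡2w 10h≤17c p
      instance
        σ≢0 : NonZero (2 * c + w)
        σ≢0 = >-nonZero (≤-trans 1≤c (≤-trans (m≤m+n c (c + 0)) (m≤m+n (2 * c) w)))
      position : Positional U v ⊎ Positional V v → 100 * v ≤ 11 * h + 36 * g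
      position (inj₁ (inj₁ refl)) = z≤n
      position (inj₂ (inj₁ refl)) = z≤n
      position (inj₁ (inj₂ p)) = position-H c h w V U g v
        (*-cancelˡ-≤ (2 * c + w) (position-H′ c w U v p 20w≤27c)) (trans (+-comm V U) U+V≡) U≤V+g c+h≡2w 10h≤17c
      position (inj₂ (inj₂ p)) = position-H c h w U V g v
        (*-cancelˡ-≤ (2 * c + w) (position-H′ c w V v p 20w≤27c)) U+V≡ V≤U+g c+h≡2w 10h≤17c

    -- For 2w ≤ c the corner triangle is so small that it is matched completely, and all three
    -- overflows vanish.
    deficit-low : ∀ u v z → 2 * w + h ≡ c → Steep u → Positional U v ⊎ Positional V v → Level z → Bounded u v z
    deficit-low u v z 2w+h≡c su pv lz = subst (λ k → 250 * k ≤ 49 * (h * h + g * g)) (sym all-zero) z≤n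
      where
      2w≤c : 2 * w ≤ c
      2w≤c = m+n≤o⇒m≤o (2 * w) (≤-reflexive 2w+h≡c)
      steep : Steep u → u ≡ 0
      steep (inj₁ p) = p
      steep (inj₂ p) = zero-or-positive u (steep-L c w u 2w≤c p)
      level : Level z → z ≡ 0
      level (inj₁ p) = p
      level (inj₂ p) = zero-or-positive z (level-L c w z 2w≤c p)
      position : Positional U v ⊎ Positional V v → v ≡ 0
      position (inj₁ (inj₁ p)) = p
      position (inj₂ (inj₁ p)) = p
      position (inj₁ (inj₂ p)) = zero-or-positive v
        (λ 1≤v → position-L c w V U v p 2w≤c c≤V (trans (+-comm V U) U+V≡) 1≤v 1≤c)
      position (inj₂ (inj₂ p)) = zero-or-positive v
        (λ 1≤v → position-L c w U V v p 2w≤c c≤U U+V≡ 1≤v 1≤c)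
      all-zero : u * u + v * v + z * z ≡ 0
      all-zero with steep su | position pv | level lz
      ... | refl | refl | refl = refl

    deficit : ∀ {u v z} → c + h ≡ 2 * w ⊎ 2 * w + h ≡ c → Steep u → Positional U v ⊎ Positional V v → Level z → Bounded u v z
    deficit {u} {v} {z} (inj₁ p) = deficit-high u v z p
    deficit {u} {v} {z} (inj₂ p) = deficit-low u v z p

  -- Chebyshev's sum inequality 2(Ua + VA) ≥ (U + V)(a + A) for similarly ordered pairs, obtained
  -- from the product of the first two hypotheses.
  s-bound = certify 6 (λ U V a A P k → U :≤ V ∷ a :≤ A ∷ P :* con 239 :≤ (a :+ A) :* con 400 ∷
      k :≡ U :* a :+ V :* A ∷ [] ⊢ P :* ((U :+ V) :* con 239) :≤ k :* con 800)
    ((1 , bwd 3 800 [] ∷ fwd 2 1 (0 ∷ []) ∷ fwd 2 1 (1 ∷ []) ∷ ff 0 1 400 ∷ []) ∷ [])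
  spread = certify 4 (λ U V c w → U :+ V :≡ 2 · c :+ w ∷ (U :+ V) :* con 239 :≤ c :* con 800 ∷ []
      ⊢ 20 · w :≤ 27 · c)
    ((239 , bwd 0 4780 [] ∷ fwd 1 20 [] ∷ []) ∷ [])
  -- Keeps g² and h² instead of discarding them: they pay for the overflows, and for a near-extremal
  -- set what is left of them bounds g and h.
  squares = certify 7 (λ U V c w g h P → U :+ V :≡ 2 · c :+ w ∷ U :* V :≡ P ∷ U :+ g :≡ V ∷ c :+ h :≡ 2 · w ∷ []
      ⊢ 4 · P :+ g :* g :+ h :* h :≤ 5 · (c :* c) :+ 5 · (w :* w))
    ((1 , bwd 1 4 [] ∷ fwd 0 1 (0 ∷ []) ∷ fwd 0 1 (1 ∷ []) ∷ fwd 0 2 (2 ∷ []) ∷ fwd 0 1 (3 ∷ []) ∷ bwd 2 1 (0 ∷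
     []) ∷ fwd 2 1 (1 ∷ []) ∷ fwd 2 1 (4 ∷ []) ∷ bwd 3 1 (2 ∷ []) ∷ fwd 3 2 (3 ∷ []) ∷ fwd 3 1 (5 ∷ []) ∷ []) ∷
     [])
  squares′ = certify 7 (λ U V c w g h P → U :+ V :≡ 2 · c :+ w ∷ U :* V :≡ P ∷ U :+ g :≡ V ∷ 2 · w :+ h :≡ c ∷ []
      ⊢ 4 · P :+ g :* g :+ h :* h :≤ 5 · (c :* c) :+ 5 · (w :* w))
    ((1 , bwd 1 4 [] ∷ fwd 0 1 (0 ∷ []) ∷ fwd 0 1 (1 ∷ []) ∷ fwd 0 2 (2 ∷ []) ∷ fwd 0 1 (3 ∷ []) ∷ bwd 2 1 (0 ∷
     []) ∷ fwd 2 1 (1 ∷ []) ∷ fwd 2 1 (4 ∷ []) ∷ fwd 3 1 (2 ∷ []) ∷ bwd 3 2 (3 ∷ []) ∷ fwd 3 1 (5 ∷ []) ∷ []) ∷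
     [])
  -- Adds up the areas. The surplus g² + h² enters with coefficient 50 and the overflows use 49 of
  -- it, so a single copy survives. Passing from areas to lattice points costs multiples of cε only,
  -- because u, v, z ≤ w ≤ 1.35c.
  total = certify 17 (λ N P m ε c e w u v z h g Te Tw Tu Tv Tz →
      N :+ (Te :+ con 0 :+ Tw) :≤ P :+ (Tu :+ Tv :+ Tz) ∷ e :* e :≤ 2 · (m :* Te) ∷ w :* w :≤ 2 · (m :* Tw) ∷
      2 · (m :* Tu) :≤ (u :+ ε) :* (u :+ ε) ∷ 2 · (m :* Tv) :≤ (v :+ ε) :* (v :+ ε) ∷
      2 · (m :* Tz) :≤ (z :+ ε) :* (z :+ ε) ∷ e :+ ε :≡ c ∷
      4 · (m :* P) :+ g :* g :+ h :* h :≤ 5 · (c :* c) :+ 5 · (w :* w) ∷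
      250 · (u :* u :+ v :* v :+ z :* z) :≤ 49 · (h :* h :+ g :* g) ∷ u :≤ w ∷ v :≤ w ∷ z :≤ w ∷
      20 · w :≤ 27 · c ∷ ε :≤ c ∷ []
      ⊢ m :* N :* con 500 :+ (h :* h :+ g :* g) :≤ m :* P :* con 300 :+ c :* ε :* con 3100)
    ((1 , fwd 1 250 [] ∷ fwd 2 250 [] ∷ fwd 3 250 [] ∷ fwd 4 250 [] ∷ fwd 5 250 [] ∷ fwd 7 50 [] ∷ fwd 8 1 [] ∷
     fwd 0 500 (2 ∷ []) ∷ bwd 6 250 (5 ∷ []) ∷ fwd 6 250 (3 ∷ []) ∷ bwd 6 250 (4 ∷ []) ∷ fwd 9 500 (3 ∷ []) ∷
     fwd 10 500 (3 ∷ []) ∷ fwd 11 500 (3 ∷ []) ∷ fwd 12 75 (3 ∷ []) ∷ fwd 13 500 (3 ∷ []) ∷ []) ∷ [])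
  -- Because both intercepts lie inside the box, the rounding error turns into a boundary term X + Y
  -- that does not depend on the slope of the edge.
  errors = certify 5 (λ c α β X Y → c :≤ α :* X ∷ c :≤ β :* Y ∷ [] ⊢ c :* (α :+ β) :≤ α :* β :* (X :+ Y))
    ((1 , fwd 0 1 (2 ∷ []) ∷ fwd 1 1 (1 ∷ []) ∷ []) ∷ [])
  final = certify 8 (λ m N h g P c ε Q →
      m :* N :* con 500 :+ (h :* h :+ g :* g) :≤ m :* P :* con 300 :+ c :* ε :* con 3100 ∷ c :* ε :≤ Q ∷ []
      ⊢ m :* N :* con 500 :+ (h :* h :+ g :* g) :≤ m :* P :* con 300 :+ Q :* con 3100)
    ((1 , fwd 0 1 [] ∷ fwd 1 3100 [] ∷ []) ∷ [])
  room = certify 5 (λ α β X Y c → con 4 :≤ X ∷ con 4 :≤ Y ∷ (α :* X :+ β :* Y) :* con 239 :≤ c :* con 800 ∷ []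
      ⊢ α :+ β :≤ c)
    ((800 , fwd 2 1 [] ∷ fwd 0 200 (0 ∷ []) ∷ fwd 1 200 (1 ∷ []) ∷ []) ∷ [])
  positional = certify 6 (λ c U V v k w → k :* (U :+ V) :≤ c :* U ∷ v :+ 2 · c :≡ V :+ k ∷ U :+ V :≡ 2 · c :+ w ∷
      [] ⊢ v :* (2 · c :+ w) :+ c :* (2 · c :+ w) :+ c :* V :≤ V :* (2 · c :+ w))
    ((1 , fwd 0 1 [] ∷ fwd 1 2 (0 ∷ []) ∷ fwd 1 1 (5 ∷ []) ∷ bwd 2 1 (4 ∷ []) ∷ fwd 2 1 (0 ∷ []) ∷ []) ∷ [])
  tilt = certify 6 (λ α β a₁ a₂ X Y → a₁ :* Y :≤ a₂ :* X ∷ []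
      ⊢ α :* a₁ :* (α :* X :+ β :* Y) :≤ (α :* a₁ :+ β :* a₂) :* (α :* X))
    ((1 , fwd 0 1 (0 ∷ 1 ∷ []) ∷ []) ∷ [])
  steep-a = certify 4 (λ w c k v → w :+ c :≤ 3 · k ∷ k :+ v :≡ w ∷ [] ⊢ 3 · v :+ c :≤ 2 · w)
    ((1 , fwd 0 1 [] ∷ fwd 1 3 [] ∷ []) ∷ [])
  both-steep = certify 6 (λ c w p q d v → 3 · p :< w :+ c ∷ 3 · q :< w :+ c ∷ d :+ p :+ q :≡ c :+ w ∷
      d :+ v :≡ w ∷ [] ⊢ 3 · v :+ c :≤ 2 · w)
    ((1 , fwd 0 1 [] ∷ fwd 1 1 [] ∷ bwd 2 3 [] ∷ fwd 3 3 [] ∷ []) ∷ [])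
  both-flat = certify 5 (λ c w p b U → 3 · p :< w :+ c ∷ 20 · w :≤ 27 · c ∷ U :≡ b :+ p ∷ [] ⊢ U :≤ c :+ b)
    ((60 , fwd 0 20 [] ∷ fwd 1 1 [] ∷ fwd 2 60 [] ∷ []) ∷ [])
  corner-range = certify 10 (λ α β t r x y X Y c w → X :≡ t :+ x ∷ Y :≡ r :+ y ∷ α :* t :+ β :* r :≡ c ∷
      α :* X :+ β :* Y :≡ 2 · c :+ w ∷ [] ⊢ α :* x :+ β :* y :≡ c :+ w)
    ((1 , bwd 2 1 [] ∷ fwd 3 1 [] ∷ bwd 0 1 (0 ∷ []) ∷ bwd 1 1 (1 ∷ []) ∷ []) ∷ (1 , fwd 2 1 [] ∷ bwd 3 1 [] ∷
     fwd 0 1 (0 ∷ []) ∷ fwd 1 1 (1 ∷ []) ∷ []) ∷ [])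
  both-range = certify 6 (λ α β X Y c w → α :* X :+ β :* Y :≡ 2 · c :+ w ∷ [] ⊢ α :* X :+ β :* Y :≡ c :+ c :+ w)
    ((1 , fwd 0 1 [] ∷ []) ∷ (1 , bwd 0 1 [] ∷ []) ∷ [])
  scale-level = certify 6 (λ α β a₁ a₂ X Y → []
      ⊢ (α :* a₁ :+ β :* a₂) :* (X :* Y) :≡ α :* X :* (a₁ :* Y) :+ β :* Y :* (a₂ :* X))
    ((1 , []) ∷ (1 , []) ∷ [])
  descale-level = certify 3 (λ P σ c → P :* σ :≤ c :* P :* con 800 ∷ [] ⊢ P :* σ :≤ P :* (c :* con 800))
    ((1 , fwd 0 1 [] ∷ []) ∷ [])
  contact-b = certify 5 (λ α β a₁ a₂ b₂ → a₂ :≡ b₂ :+ α ∷ [] ⊢ α :* (a₁ :+ β) :+ β :* b₂ :≡ α :* a₁ :+ β :* a₂)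
    ((1 , bwd 0 1 (1 ∷ []) ∷ []) ∷ (1 , fwd 0 1 (1 ∷ []) ∷ []) ∷ [])
  -- The lengths αβ, αx and βy, taken between the contact points and from them to the right and
  -- upper edges, add up to c + w, so one of them is at least (c + w)/3. According to which one it
  -- is, matching through both points, through b or through a has a steep overflow of at most (2w -
  -- c)/3.
  distance-ab = certify 10 (λ α β a₁ a₂ b₂ x y X Y w → X :≡ a₁ :+ β :+ x ∷ Y :≡ a₂ :+ y ∷ a₂ :≡ b₂ :+ α ∷
      α :* X :+ β :* Y :≡ 2 · (α :* a₁ :+ β :* a₂) :+ w ∷ []
      ⊢ α :* β :+ α :* x :+ β :* y :≡ α :* a₁ :+ β :* a₂ :+ w)
    ((1 , fwd 3 1 [] ∷ bwd 0 1 (0 ∷ []) ∷ bwd 1 1 (1 ∷ []) ∷ []) ∷ (1 , bwd 3 1 [] ∷ fwd 0 1 (0 ∷ []) ∷ fwd 1 1 (1 ∷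
     []) ∷ []) ∷ [])
  overshoot-a = certify 10 (λ α β t r x X Y c w v → X :≡ t :+ x ∷ α :* X :+ β :* Y :≡ 2 · c :+ w ∷
      α :* x :+ v :≡ w ∷ [] ⊢ v :+ 2 · c :≡ β :* Y :+ α :* t)
    ((1 , bwd 1 1 [] ∷ fwd 2 1 [] ∷ fwd 0 1 (0 ∷ []) ∷ []) ∷ (1 , fwd 1 1 [] ∷ bwd 2 1 [] ∷ bwd 0 1 (0 ∷ []) ∷ []) ∷
     [])
  virtual-a = certify 8 (λ α b X x Y β c w → β :* Y :≡ c ∷ α :* X :+ β :* Y :≡ 2 · c :+ w ∷ X :≡ b :+ x ∷
      α :* b :≤ c ∷ [] ⊢ w :≤ α :* x)
    ((1 , fwd 0 1 [] ∷ bwd 1 1 [] ∷ fwd 3 1 [] ∷ fwd 2 1 (0 ∷ []) ∷ []) ∷ [])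
  both-virtual = certify 4 (λ U V c w → U :≡ c ∷ V :≡ c ∷ U :+ V :≡ 2 · c :+ w ∷ [] ⊢ w :≤ con 0)
    ((1 , fwd 0 1 [] ∷ fwd 1 1 [] ∷ bwd 2 1 [] ∷ []) ∷ [])

  product = certify 4 (λ α β X Y → [] ⊢ α :* X :* (β :* Y) :≡ α :* β :* (X :* Y))
    ((1 , []) ∷ (1 , []) ∷ [])

  record MainBound {X Y} (S : SumFreeSet X Y) (E : Edge S) : Set where
    open Edge E
    field
      w h g : ℕ
      w-def : α * X + β * Y ≡ 2 * c + w
      h-def : c + h ≡ 2 * w ⊎ 2 * w + h ≡ c
      g-def : α * X + g ≡ β * Y ⊎ β * Y + g ≡ α * X
      bound : α * β * size S * 500 + (h * h + g * g) ≤ α * β * (X * Y) * 300 + α * β * (X + Y) * 3100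

  swap-sum : ∀ a b c → a + b + c ≡ b + a + c
  swap-sum a b c = cong (_+ c) (+-comm a b)

  module MainProof {X Y} (S : SumFreeSet X Y) (E : Edge S) (4≤X : 4 ≤ X) (4≤Y : 4 ≤ Y)
    (heavy : ∀ {p} → p ∈ pts S → X * Y * 239 ≤ (proj₁ p * Y + proj₂ p * X) * 400) where

    open Edge E

    U V : ℕ
    U = α * X
    V = β * Y

    1≤XY : 1 ≤ X * Y
    1≤XY = *-mono-≤ (≤-trans (s≤s z≤n) 4≤X) (≤-trans (s≤s z≤n) 4≤Y)

    239≤400 : ∀ k → k * 239 ≤ k * 400
    239≤400 k = *-monoʳ-≤ k (m≤m+n 239 161)

    heavy-a : X * Y * 239 ≤ (a₁ * Y + a₂ * X) * 400
    heavy-a with a∈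
    ... | inj₁ a∈S = heavy a∈S
    ... | inj₂ (e₁ , e₂) = subst (λ k → X * Y * 239 ≤ k * 400) value (239≤400 (X * Y))
      where
      value : X * Y ≡ a₁ * Y + a₂ * X
      value = trans (*-comm X Y) (cong₂ (λ i j → i * Y + j * X) (sym e₁) (sym e₂))

    heavy-b : X * Y * 239 ≤ (b₂ * X + (a₁ + β) * Y) * 400
    heavy-b with b∈
    ... | inj₁ b∈S = subst (λ k → X * Y * 239 ≤ k * 400) (+-comm ((a₁ + β) * Y) (b₂ * X)) (heavy b∈S)
    ... | inj₂ (e₁ , e₂) = subst (λ k → X * Y * 239 ≤ k * 400)
      (cong₂ (λ i j → j * X + i * Y) (sym e₁) (sym e₂)) (239≤400 (X * Y))

    touch-b : α * (a₁ + β) + β * b₂ ≡ c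
    touch-b = contact-b α β a₁ a₂ b₂ a₂≡

    σ-bound : (U + V) * 239 ≤ c * 800
    σ-bound = *-cancel-≤ (X * Y) ((U + V) * 239) (c * 800) 1≤XY
      (descale-level (X * Y) ((U + V) * 239) c σ-bound′)
      where
      σ-bound′ : X * Y * ((U + V) * 239) ≤ c * (X * Y) * 800
      -- Each contact point is ordered by its side of the diagonal; the one ordered in the same way
      -- as U and V is used.
      σ-bound′ with ≤-total U V
      ... | inj₁ U≤V = s-bound U V (a₁ * Y) (a₂ * X) (X * Y) (c * (X * Y)) U≤V a-left heavy-a (scale-level α β a₁ a₂ X Y)
      ... | inj₂ V≤U = subst (λ k → X * Y * (k * 239) ≤ c * (X * Y) * 800) (+-comm V U)
        (s-bound V U (b₂ * X) ((a₁ + β) * Y) (X * Y) (c * (X * Y)) V≤U b-right heavy-b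
          (trans (cong (_* (X * Y)) (sym touch-b)) (trans (scale-level α β (a₁ + β) b₂ X Y) (+-comm (U * ((a₁ + β) * Y)) (V * (b₂ * X))))))

    c≤ : 2 * c ≤ U + V
    c≤ = subst (_≤ U + V) (cong (c +_) (sym (+-identityʳ c))) (+-mono-≤ c≤αX c≤βY)

    w : ℕ
    w = proj₁ (m≤n⇒∃[o]m+o≡n c≤)
    w-def : U + V ≡ 2 * c + w
    w-def = sym (proj₂ (m≤n⇒∃[o]m+o≡n c≤))

    20w≤27c : 20 * w ≤ 27 * c
    20w≤27c = spread U V c w w-def σ-bound

    ε≤c : α + β ≤ c
    ε≤c = room α β X Y c 4≤X 4≤Y σ-bound
    e : ℕ
    e = c ∸ (α + β)
    e-def : e + (α + β) ≡ c
    e-def = m∸n+n≡m ε≤c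

    1≤c : 1 ≤ c
    1≤c = ≤-trans 1≤α (≤-trans (m≤m+n α β) ε≤c)

    distance : ∀ a b → ∃[ d ] (a + d ≡ b ⊎ b + d ≡ a)
    distance a b with ≤-total a b
    ... | inj₁ p = let d , q = m≤n⇒∃[o]m+o≡n p in d , inj₁ q
    ... | inj₂ p = let d , q = m≤n⇒∃[o]m+o≡n p in d , inj₂ q

    h g : ℕ
    h = proj₁ (distance c (2 * w))
    g = proj₁ (distance U V)
    h-def : c + h ≡ 2 * w ⊎ 2 * w + h ≡ c
    h-def = proj₂ (distance c (2 * w))
    g-def : U + g ≡ V ⊎ V + g ≡ U
    g-def = proj₂ (distance U V)

    within-g : ∀ {a b d} → a + d ≡ b ⊎ b + d ≡ a → a ≤ b + d × b ≤ a + d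
    within-g {a} {b} {d} (inj₁ refl) = ≤-trans (m≤m+n a d) (m≤m+n (a + d) d) , ≤-refl
    within-g {a} {b} {d} (inj₂ refl) = ≤-refl , ≤-trans (m≤m+n b d) (m≤m+n (b + d) d)

    open Deficit c w U V h g 1≤c w-def c≤αX c≤βY 20w≤27c (proj₁ (within-g g-def)) (proj₂ (within-g g-def))

    UV≡ : U * V ≡ α * β * (X * Y)
    UV≡ = product α β X Y

    squares-bound : 4 * (α * β * (X * Y)) + g * g + h * h ≤ 5 * (c * c) + 5 * (w * w)
    squares-bound with g-def | h-def
    ... | inj₁ p | inj₁ q = squares U V c w g h (α * β * (X * Y)) w-def UV≡ p q
    ... | inj₁ p | inj₂ q = squares′ U V c w g h (α * β * (X * Y)) w-def UV≡ p q
    ... | inj₂ p | inj₁ q = squares V U c w g h (α * β * (X * Y)) (trans (+-comm V U) w-def) (trans (*-comm V U) UV≡) p q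
    ... | inj₂ p | inj₂ q = squares′ V U c w g h (α * β * (X * Y)) (trans (+-comm V U) w-def) (trans (*-comm V U) UV≡) p q

    upper : ∀ v → 2 * (α * β * length (tri α β v)) ≤ (v + (α + β)) * (v + (α + β))
    upper v = subst (λ k → 2 * (α * β * length (tri α β v)) ≤ k * k) (+-assoc v α β) (tri-upper α β v 1≤α 1≤β)

    matched : ℕ
    matched = size S + (length (tri α β e) + 0 + length (tri α β w))

    Goal : Set
    Goal = α * β * size S * 500 + (h * h + g * g) ≤ α * β * (X * Y) * 300 + α * β * (X + Y) * 3100

    conclude : ∀ {u v z Tu Tv Tz} → size S + (length (tri α β e) + 0 + length (tri α β w)) ≤ X * Y + (Tu + Tv + Tz) →
      2 * (α * β * Tu) ≤ (u + (α + β)) * (u + (α + β)) → 2 * (α * β * Tv) ≤ (v + (α + β)) * (v + (α + β)) →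
      2 * (α * β * Tz) ≤ (z + (α + β)) * (z + (α + β)) →
      u ≤ w → v ≤ w → z ≤ w → Steep u → Positional U v ⊎ Positional V v → Level z → Goal
    conclude {u} {v} {z} {Tu} {Tv} {Tz} count hu hv hz u≤ v≤ z≤ su pv lz =
      final (α * β) (size S) h g (X * Y) c (α + β) (α * β * (X + Y))
        (total (size S) (X * Y) (α * β) (α + β) c e w u v z h g (length (tri α β e)) (length (tri α β w)) Tu Tv Tz
          count (tri-lower α β e 1≤α 1≤β) (tri-lower α β w 1≤α 1≤β) hu hv hz
          e-def squares-bound (deficit h-def su pv lz) u≤ v≤ z≤ 20w≤27c ε≤c)
        (errors c α β X Y c≤αX c≤βY)

    covered : ∀ k → w ≤ k + (w ∸ k)
    covered k = m≤n+m∸n w k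

    e+≤c : e + (α + β) ≤ c
    e+≤c = ≤-reflexive e-def

    steep-part : ∀ k → w + c ≤ 3 * k → Steep (w ∸ k)
    steep-part k h′ with positive-part k w
    ... | inj₁ p = inj₁ p
    ... | inj₂ p = inj₂ (steep-a w c k (w ∸ k) h′ p)

    flat-part : ∀ k → w ≤ k → Steep (w ∸ k)
    flat-part k w≤k = inj₁ (m≤n⇒m∸n≡0 w≤k)

    level-part : Level (w ∸ c)
    level-part = positive-part c w

    positional-a : ∀ {t r x} → X ≡ t + x → α * t + β * r ≡ c → t * Y ≤ r * X → Positional V (w ∸ α * x)
    positional-a {t} {r} {x} X≡ touch left with positive-part (α * x) w
    ... | inj₁ p = inj₁ p
    ... | inj₂ p = inj₂ (positional c U V (w ∸ α * x) (α * t) w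
      (subst (λ k → α * t * (U + V) ≤ k * U) touch (tilt α β t r X Y left))
      (overshoot-a α β t r x X Y c w (w ∸ α * x) X≡ w-def p) w-def)

    positional-b : ∀ {t r y} → Y ≡ r + y → α * t + β * r ≡ c → r * X ≤ t * Y → Positional U (w ∸ β * y)
    positional-b {t} {r} {y} Y≡ touch right with positive-part (β * y) w
    ... | inj₁ p = inj₁ p
    ... | inj₂ p = inj₂ (positional c V U (w ∸ β * y) (β * r) w
      (subst₂ (λ k l → β * r * k ≤ l * V) refl (trans (+-comm (β * r) (α * t)) touch) (tilt β α r t Y X right))
      (overshoot-a β α r t y Y X c w (w ∸ β * y) Y≡ (trans (+-comm V U) w-def) p) (trans (+-comm V U) w-def))

    -- One contact point suffices when it is not too close to the side on which the deficit is only "steep".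
    through-a : ∀ {t r x y} → (t , r) ∈ pts S → X ≡ t + x → Y ≡ r + y → α * t + β * r ≡ c → t * Y ≤ r * X →
      Steep (w ∸ β * y) → Goal
    through-a {t} {r} {x} {y} a∈S X≡ Y≡ touch left steep = conclude {w ∸ β * y} {w ∸ α * x} {w ∸ c}
      (subst (λ k → matched ≤ X * Y + k) (swap-sum (length (tri α β (w ∸ α * x))) (length (tri α β (w ∸ β * y))) _)
        (Single.bound S α β c c w e (w ∸ α * x) (w ∸ β * y) (w ∸ c) 1≤α 1≤β above c≤αX c≤βY a∈S X≡ Y≡ touch
          (corner-range α β t r x y X Y c w X≡ Y≡ touch w-def) e+≤c (covered (α * x)) (covered (β * y)) (covered c)
          [] [] (λ ()) (λ ()) (λ ()) (λ ()) (λ ())))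
      (upper (w ∸ β * y)) (upper (w ∸ α * x)) (upper (w ∸ c)) (m∸n≤m w (β * y)) (m∸n≤m w (α * x)) (m∸n≤m w c)
      steep (inj₂ (positional-a X≡ touch left)) level-part

    through-b : ∀ {t r x y} → (t , r) ∈ pts S → X ≡ t + x → Y ≡ r + y → α * t + β * r ≡ c → r * X ≤ t * Y →
      Steep (w ∸ α * x) → Goal
    through-b {t} {r} {x} {y} b∈S X≡ Y≡ touch right steep = conclude {w ∸ α * x} {w ∸ β * y} {w ∸ c}
      (Single.bound S α β c c w e (w ∸ α * x) (w ∸ β * y) (w ∸ c) 1≤α 1≤β above c≤αX c≤βY b∈S X≡ Y≡ touch
        (corner-range α β t r x y X Y c w X≡ Y≡ touch w-def) e+≤c (covered (α * x)) (covered (β * y)) (covered c)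
        [] [] (λ ()) (λ ()) (λ ()) (λ ()) (λ ()))
      (upper (w ∸ α * x)) (upper (w ∸ β * y)) (upper (w ∸ c)) (m∸n≤m w (α * x)) (m∸n≤m w (β * y)) (m∸n≤m w c)
      steep (inj₁ (positional-b Y≡ touch right)) level-part

    through-both : ∀ {x y} → (a₁ , a₂) ∈ pts S → (a₁ + β , b₂) ∈ pts S → X ≡ a₁ + β + x → Y ≡ a₂ + y →
      3 * (α * x) < w + c → 3 * (β * y) < w + c → Goal
    through-both {x} {y} a∈S b∈S X≡ Y≡ hx hy = conclude {w ∸ α * β} {0} {w ∸ c} {Tv = 0}
      (subst (λ k → matched ≤ X * Y + k) (cong (_+ length (tri α β (w ∸ c))) (sym (+-identityʳ (length (tri α β (w ∸ α * β))))))
        (Both.bound S α β c c c w e (w ∸ α * β) (w ∸ c) 1≤α 1≤β above c≤αX c≤βY a∈S b∈S refl touch-b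
          (both-range α β X Y c w w-def) (both-flat c w (α * x) (α * (a₁ + β)) U hx 20w≤27c (trans (cong (α *_) X≡) (*-distribˡ-+ α (a₁ + β) x)))
          e+≤c (covered (α * β)) (covered c) [] [] (λ ()) (λ ()) (λ ()) (λ ()) (λ ()) (λ ())))
      (upper (w ∸ α * β)) (subst (_≤ (α + β) * (α + β)) (sym (cong (2 *_) (*-zeroʳ (α * β)))) z≤n) (upper (w ∸ c))
      (m∸n≤m w (α * β)) z≤n (m∸n≤m w c) steep (inj₁ (inj₁ refl)) level-part
      where
      steep : Steep (w ∸ α * β)
      steep with positive-part (α * β) w
      ... | inj₁ p = inj₁ p
      ... | inj₂ p = inj₂ (both-steep c w (α * x) (β * y) (α * β) (w ∸ α * β) hx hy
        (distance-ab α β a₁ a₂ b₂ x y X Y w X≡ Y≡ a₂≡ w-def) p)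

    through-neither : w ≤ 0 → Goal
    through-neither w≤0 = conclude {0} {0} {0} {0} {0} {0} count zero-tri zero-tri zero-tri z≤n z≤n z≤n
      (inj₁ refl) (inj₁ (inj₁ refl)) (inj₁ refl)
      where
      open BelowLine S α β c e 1≤α 1≤β above c≤αX c≤βY e+≤c
      zero-tri : 2 * (α * β * 0) ≤ (0 + (α + β)) * (0 + (α + β))
      zero-tri = subst (_≤ (α + β) * (α + β)) (sym (cong (2 *_) (*-zeroʳ (α * β)))) z≤n
      pairing : Pairing S cut [] (λ p → p) (λ p → p)
      pairing = record
        { missing-unique = cut-unique
        ; missing-inBox = cut-inBox
        ; missing = cut-missing
        ; index-unique = []
        ; hi-inBox = λ ()
        ; lo-inBox = λ ()
        ; hi-or-lo = λ ()
        ; hi-fresh = λ ()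
        ; lo-fresh = λ ()
        ; hi-injective = λ ()
        ; lo-injective = λ ()
        ; hi≢lo = λ ()
        }
      count : matched ≤ X * Y + 0
      count = subst₂ (λ k l → size S + (k + 0 + l) ≤ X * Y + 0) length-cut
        (cong (λ k → length (tri α β k)) (sym (n≤0⇒n≡0 w≤0)))
        (subst₂ _≤_ (cong (size S +_) (sym (+-identityʳ (length cut + 0)))) (sym (+-identityʳ (X * Y))) (pairing-bound pairing))

    goal : Goal
    goal with a∈ | b∈
    ... | inj₁ a∈S | inj₁ b∈S with pts-inBox S a∈S | pts-inBox S b∈S
    ... | (_ , a₁≤X) , (_ , a₂≤Y) | (_ , b₁≤X) , (_ , b₂≤Y)
      with m≤n⇒∃[o]m+o≡n a₁≤X | m≤n⇒∃[o]m+o≡n a₂≤Y | m≤n⇒∃[o]m+o≡n b₁≤X | m≤n⇒∃[o]m+o≡n b₂≤Y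
    ... | xa , Xa | ya , Ya | xb , Xb | yb , Yb with w + c ≤? 3 * (β * ya) | w + c ≤? 3 * (α * xb)
    ... | yes p | _ = through-a a∈S (sym Xa) (sym Ya) refl a-left (steep-part (β * ya) p)
    ... | no _ | yes q = through-b b∈S (sym Xb) (sym Yb) touch-b b-right (steep-part (α * xb) q)
    ... | no p | no q = through-both a∈S b∈S (sym Xb) (sym Ya) (≰⇒> q) (≰⇒> p)
    -- A contact point that is merely a corner of the box offers no translation. But then the line
    -- meets that corner, βY = c, and matching through the other contact point has no steep overflow
    -- at all.
    goal | inj₂ (e₁ , e₂) | inj₁ b∈S with pts-inBox S b∈S
    ... | (_ , b₁≤X) , (_ , b₂≤Y) with m≤n⇒∃[o]m+o≡n b₁≤X | m≤n⇒∃[o]m+o≡n b₂≤Y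
    ... | xb , Xb | yb , Yb = through-b b∈S (sym Xb) (sym Yb) touch-b b-right
      (flat-part (α * xb) (virtual-a α (a₁ + β) X xb Y β c w V≡c w-def (sym Xb) (part-of-value α β (a₁ + β) b₂ c touch-b)))
      where
      V≡c : β * Y ≡ c
      V≡c = sym (trans (cong₂ (λ i j → α * i + β * j) e₁ e₂) (cong (_+ β * Y) (*-zeroʳ α)))
    goal | inj₁ a∈S | inj₂ (e₁ , e₂) with pts-inBox S a∈S
    ... | (_ , a₁≤X) , (_ , a₂≤Y) with m≤n⇒∃[o]m+o≡n a₁≤X | m≤n⇒∃[o]m+o≡n a₂≤Y
    ... | xa , Xa | ya , Ya = through-a a∈S (sym Xa) (sym Ya) refl a-left
      (flat-part (β * ya) (virtual-a β a₂ Y ya X α c w U≡c (trans (+-comm V U) w-def) (sym Ya) (m≤n+m (β * a₂) (α * a₁))))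
      where
      U≡c : α * X ≡ c
      U≡c = trans (trans (sym (+-identityʳ (α * X))) (trans (cong (α * X +_) (sym (*-zeroʳ β)))
        (cong₂ (λ i j → α * i + β * j) (sym e₁) (sym e₂)))) touch-b
    goal | inj₂ (e₁ , e₂) | inj₂ (e₃ , e₄) = through-neither (both-virtual U V c w U≡c V≡c w-def)
      where
      V≡c : β * Y ≡ c
      V≡c = sym (trans (cong₂ (λ i j → α * i + β * j) e₁ e₂) (cong (_+ β * Y) (*-zeroʳ α)))
      U≡c : α * X ≡ c
      U≡c = trans (trans (sym (+-identityʳ (α * X))) (trans (cong (α * X +_) (sym (*-zeroʳ β)))
        (cong₂ (λ i j → α * i + β * j) (sym e₃) (sym e₄)))) touch-b

  main-bound : ∀ {X Y} (S : SumFreeSet X Y) (E : Edge S) → 4 ≤ X → 4 ≤ Y →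
    (∀ {p} → p ∈ pts S → X * Y * 239 ≤ (proj₁ p * Y + proj₂ p * X) * 400) → MainBound S E
  main-bound S E 4≤X 4≤Y heavy = record { w = w ; h = h ; g = g ; w-def = w-def ; h-def = h-def ; g-def = g-def ; bound = goal }
    where open MainProof S E 4≤X 4≤Y heavy

  -- The density bound for rectangles

  least-in : {A : Set} (f : A → ℕ) {xs : List A} {x : A} → x ∈ xs → ∃[ m ] (m ∈ xs × (∀ {y} → y ∈ xs → f m ≤ f y))
  least-in f {x ∷ xs} _ = least (λ p q → f p ≤ f q) (λ p q → ≤-total (f p) (f q)) ≤-trans x xs

  -- weight X Y p = XY (p₁/X + p₂/Y)
  weight : ℕ → ℕ → Pt → ℕ
  weight X Y p = proj₁ p * Y + proj₂ p * X

  area : Pt → ℕ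
  area p = proj₁ p * proj₂ p

  corner-area = certify 6 (λ X Y t r x y → X :≡ t :+ x ∷ Y :≡ r :+ y ∷ []
      ⊢ x :* y :+ (t :* Y :+ r :* X) :≡ X :* Y :+ t :* r)
    ((1 , bwd 0 1 (1 ∷ []) ∷ fwd 0 1 (3 ∷ []) ∷ bwd 1 1 (4 ∷ []) ∷ []) ∷ (1 , fwd 0 1 (1 ∷ []) ∷ bwd 0 1 (3 ∷ []) ∷
     fwd 1 1 (4 ∷ []) ∷ []) ∷ [])
  small-sum = certify 2 (λ X Y → con 2 :≤ X ∷ con 2 :≤ Y ∷ [] ⊢ X :+ Y :≤ X :* Y)
    ((1 , fwd 0 1 [] ∷ fwd 1 1 [] ∷ ff 0 1 1 ∷ []) ∷ [])
  corner-triangle = certify 4 (λ P s w T → 2 · (P :* T) :≤ (w :+ s) :* (w :+ s) ∷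
      w :* con 100 :≤ P :* con 29 :+ s :* con 100 ∷ s :≤ P ∷ []
      ⊢ P :* (T :* con 2000) :≤ P :* (P :* con 85 :+ s :* con 6000))
    ((10 , fwd 0 10000 [] ∷ fwd 1 100 (2 ∷ []) ∷ fwd 1 29 (0 ∷ []) ∷ fwd 1 300 (1 ∷ []) ∷ fwd 2 40000 (1 ∷ []) ∷
     []) ∷ [])
  corner-total = certify 7 (λ n z P T c q s → n :+ z :≤ P :+ T ∷ z :+ c :≡ P :+ q ∷
      T :* con 2000 :≤ P :* con 85 :+ s :* con 6000 ∷ c :* con 400 :≤ P :* con 239 ∷
      P :* con 81 :≤ q :* con 1000 ∷ [] ⊢ n :* con 50 :≤ P :* con 29 :+ s :* con 150)
    ((40 , fwd 0 2000 [] ∷ bwd 1 2000 [] ∷ fwd 2 1 [] ∷ fwd 3 5 [] ∷ fwd 4 2 [] ∷ []) ∷ [])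
  corner-reach = certify 4 (λ P c w k → k :+ c :≡ 2 · P ∷ 2 · P :< 3 · c :+ w ∷ [] ⊢ k :< 2 · c :+ w)
    ((1 , fwd 0 1 [] ∷ fwd 1 1 [] ∷ []) ∷ [])
  corner-rest = certify 4 (λ P c k s → P :* con 57 :≤ c :* con 100 ∷ 3 · c :+ k :≡ 2 · P ∷ con 1 :≤ s ∷ []
      ⊢ (con 1 :+ k) :* con 100 :≤ P :* con 29 :+ s :* con 100)
    ((1 , fwd 0 3 [] ∷ fwd 1 100 [] ∷ fwd 2 100 [] ∷ []) ∷ [])
  corner-rest₀ = certify 2 (λ P s → con 1 :≤ s ∷ [] ⊢ con 1 :* con 100 :≤ P :* con 29 :+ s :* con 100)
    ((1 , fwd 0 100 [] ∷ []) ∷ [])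
  corner-fits = certify 3 (λ P c k → 3 · c :+ k :≡ 2 · P ∷ [] ⊢ 2 · P :< 3 · c :+ (con 1 :+ k))
    ((1 , bwd 0 1 [] ∷ []) ∷ [])
  corner-fits₀ = certify 2 (λ P c → 2 · P :≤ 3 · c ∷ [] ⊢ 2 · P :< 3 · c :+ con 1)
    ((1 , fwd 0 1 [] ∷ []) ∷ [])
  corner-opposite = certify 6 (λ X Y t r x y → X :≡ t :+ x ∷ Y :≡ r :+ y ∷ []
      ⊢ (Y :* x :+ X :* y) :+ (t :* Y :+ r :* X) :≡ 2 · (X :* Y))
    ((1 , bwd 0 1 (1 ∷ []) ∷ bwd 1 1 (0 ∷ []) ∷ []) ∷ (1 , fwd 0 1 (1 ∷ []) ∷ fwd 1 1 (0 ∷ []) ∷ []) ∷ [])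

  swap-weight : ∀ X Y p → weight X Y p ≡ lin Y X p
  swap-weight X Y p = cong₂ _+_ (*-comm (proj₁ p) Y) (*-comm (proj₂ p) X)

  module Core {X Y} (S : SumFreeSet X Y) (E : Edge S) (4≤X : 4 ≤ X) (4≤Y : 4 ≤ Y)
    (not-light : ∀ {p} → p ∈ pts S → X * Y * 57 ≤ weight X Y p * 100)
    (light-central : ∀ {p} → p ∈ pts S → X * Y * 239 ≤ weight X Y p * 400 ⊎ X * Y * 81 ≤ area p * 1000) where

    1≤X : 1 ≤ X
    1≤X = ≤-trans (s≤s z≤n) 4≤X
    1≤Y : 1 ≤ Y
    1≤Y = ≤-trans (s≤s z≤n) 4≤Y

    P s : ℕ
    P = X * Y
    s = X + Y

    s≤P : s ≤ P
    s≤P = small-sum X Y (≤-trans (s≤s (s≤s z≤n)) 4≤X) (≤-trans (s≤s (s≤s z≤n)) 4≤Y)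

    1≤s : 1 ≤ s
    1≤s = ≤-trans 1≤X (m≤m+n X Y)

    width : ∀ c → P * 57 ≤ c * 100 → ∃[ w ] (2 * P < 3 * c + w × w * 100 ≤ P * 29 + s * 100)
    width c h with ≤-total (3 * c) (2 * P)
    ... | inj₁ p = let k , e = m≤n⇒∃[o]m+o≡n p in suc k , corner-fits P c k e , corner-rest P c k s h e 1≤s
    ... | inj₂ p = 1 , corner-fits₀ P c p , corner-rest₀ P s 1≤s

    -- Let c be the minimal weight and T the size of the corner triangle above level 2c. Up to
    -- boundary terms |S| ≤ T + c - tr, which is at most 0.0425 + 0.5975 - 0.081 of XY, comfortably
    -- below 0.58. A set with a light element is therefore far from extremal.
    light-bound : ∀ {a} → a ∈ pts S → (∀ {p} → p ∈ pts S → weight X Y a ≤ weight X Y p) →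
      weight X Y a * 400 ≤ P * 239 → P * 81 ≤ area a * 1000 → size S * 50 ≤ P * 29 + s * 150
    light-bound {t , r} a∈S minimal light central with pts-inBox S a∈S
    ... | (_ , t≤X) , (_ , r≤Y) with m≤n⇒∃[o]m+o≡n t≤X | m≤n⇒∃[o]m+o≡n r≤Y | width (t * Y + r * X) (not-light a∈S)
    ... | x , X≡ | y , Y≡ | w , fits , narrow =
      corner-total (size S) (x * y) P (length (tri Y X w)) (t * Y + r * X) (t * r) s
        (Corner.bound S Y X (t * Y + r * X) w 1≤Y 1≤X
          (λ {p} q → subst (t * Y + r * X ≤_) (swap-weight X Y p) (minimal q)) a∈S (sym X≡) (sym Y≡) (sym (swap-weight X Y (t , r)))
          (corner-reach P (t * Y + r * X) w (Y * x + X * y) (corner-opposite X Y t r x y (sym X≡) (sym Y≡)) fits))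
        (corner-area X Y t r x y (sym X≡) (sym Y≡))
        (*-cancel-≤ P _ _ (*-mono-≤ 1≤X 1≤Y) (corner-triangle P s w (length (tri Y X w)) upper narrow s≤P))
        light central
      where
      upper : 2 * (P * length (tri Y X w)) ≤ (w + s) * (w + s)
      upper = subst₂ (λ k l → 2 * (k * length (tri Y X w)) ≤ l * l) (*-comm Y X)
        (trans (+-assoc w Y X) (cong (w +_) (+-comm Y X))) (tri-upper Y X w 1≤Y 1≤X)

    heavy? : Decidable (λ (p : Pt) → P * 239 ≤ weight X Y p * 400)
    heavy? p = P * 239 ≤? weight X Y p * 400

    result : size S * 50 ≤ P * 29 + s * 150 ⊎ MainBound S E
    result = by-lightness (any? (λ p → ¬? (heavy? p)) (pts S))
      where
      from-light : ∀ {p} → p ∈ pts S → ¬ P * 239 ≤ weight X Y p * 400 → size S * 50 ≤ P * 29 + s * 150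
      from-light p∈ light with least-in (weight X Y) p∈
      ... | a , a∈ , minimal with light-central a∈
      ... | inj₁ h = ⊥-elim (light (≤-trans h (*-monoˡ-≤ 400 (minimal p∈))))
      ... | inj₂ h = light-bound a∈ minimal (≤-trans (*-monoˡ-≤ 400 (minimal p∈)) (<⇒≤ (≰⇒> light))) h
      by-lightness : Dec (Any (λ p → ¬ P * 239 ≤ weight X Y p * 400) (pts S)) → size S * 50 ≤ P * 29 + s * 150 ⊎ MainBound S E
      by-lightness (yes some) = let p , p∈ , light = find some in inj₁ (from-light p∈ light)
      by-lightness (no none) = inj₂ (main-bound S E 4≤X 4≤Y heavy)
        where
        heavy : ∀ {p} → p ∈ pts S → P * 239 ≤ weight X Y p * 400
        heavy {p} q with heavy? p
        ... | yes h = h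
        ... | no h = ⊥-elim (none (lose q h))

  -- Passing to the core is consistent with density 3/5 if XY - (x + t)(y + r) ≤ (3/5)(XY - xy), and
  -- this is exactly 7tr ≤ tY + rX.
  rect-shrink = certify 6 (λ n n′ t r x y → n :+ (x :+ t) :* (y :+ r) :≤ (x :+ 2 · t) :* (y :+ 2 · r) :+ n′ ∷
      n′ :* con 5 :≤ x :* y :* con 3 :+ (x :+ y) :* con 40 ∷
      7 · (t :* r) :≤ t :* (y :+ 2 · r) :+ r :* (x :+ 2 · t) ∷ []
      ⊢ n :* con 5 :≤ (x :+ 2 · t) :* (y :+ 2 · r) :* con 3 :+ ((x :+ 2 · t) :+ (y :+ 2 · r)) :* con 40)
    ((1 , fwd 0 5 [] ∷ fwd 1 1 [] ∷ fwd 2 1 [] ∷ []) ∷ [])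
  rect-large = certify 4 (λ n P z s → n :+ z :≤ P ∷ P :* con 2 :≤ z :* con 5 ∷ []
      ⊢ n :* con 5 :≤ P :* con 3 :+ s :* con 40)
    ((1 , fwd 0 5 [] ∷ fwd 1 1 [] ∷ []) ∷ [])
  rect-light = certify 3 (λ n P s → n :* con 50 :≤ P :* con 29 :+ s :* con 150 ∷ []
      ⊢ n :* con 5 :≤ P :* con 3 :+ s :* con 40)
    ((10 , fwd 0 1 [] ∷ []) ∷ [])
  rect-main = certify 6 (λ m n P s h g →
      m :* n :* con 500 :+ (h :* h :+ g :* g) :≤ m :* P :* con 300 :+ m :* s :* con 3100 ∷ []
      ⊢ m :* (n :* con 5) :≤ m :* (P :* con 3 :+ s :* con 40))
    ((100 , fwd 0 1 [] ∷ []) ∷ [])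
  thin₁ = certify 3 (λ n X Y → n :≤ X :* Y ∷ X :< con 4 ∷ []
      ⊢ n :* con 5 :≤ X :* Y :* con 3 :+ (X :+ Y) :* con 40)
    ((1 , fwd 0 5 [] ∷ fwd 1 2 (2 ∷ []) ∷ []) ∷ [])
  thin₂ = certify 3 (λ n X Y → n :≤ X :* Y ∷ Y :< con 4 ∷ []
      ⊢ n :* con 5 :≤ X :* Y :* con 3 :+ (X :+ Y) :* con 40)
    ((1 , fwd 0 5 [] ∷ fwd 1 2 (1 ∷ []) ∷ []) ∷ [])
  central-weight = certify 3 (λ q P g → 4 · (q :* P) :≤ g :* g ∷ g :< 7 · q ∷ [] ⊢ g :* (4 · P) :≤ g :* (7 · g))
    ((1 , fwd 0 7 [] ∷ fwd 1 4 (1 ∷ []) ∷ []) ∷ [])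
  central-light = certify 2 (λ P g → 4 · P :≤ 7 · g ∷ [] ⊢ P :* con 57 :≤ g :* con 100)
    ((4 , fwd 0 57 [] ∷ []) ∷ [])
  central-area = certify 3 (λ P g q → 4 · P :≤ 7 · g ∷ g :< 7 · q ∷ [] ⊢ P :* con 81 :≤ q :* con 1000)
    ((4 , fwd 0 81 [] ∷ fwd 1 567 [] ∷ []) ∷ [])
  outer-heavy = certify 4 (λ z P g q → z :* con 5 :< P :* con 2 ∷ z :+ g :≡ P :+ q ∷ []
      ⊢ P :* con 239 :≤ g :* con 400)
    ((3 , fwd 0 239 [] ∷ bwd 1 1195 [] ∷ []) ∷ [])
  outer-light = certify 2 (λ P g → P :* con 239 :≤ g :* con 400 ∷ [] ⊢ P :* con 57 :≤ g :* con 100)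
    ((4 , fwd 0 1 [] ∷ []) ∷ [])
  product-weight = certify 4 (λ t r X Y → 2 · (t :* Y :* (r :* X)) :≤ t :* Y :* (t :* Y) :+ r :* X :* (r :* X) ∷
      [] ⊢ 4 · (t :* r :* (X :* Y)) :≤ (t :* Y :+ r :* X) :* (t :* Y :+ r :* X))
    ((1 , fwd 0 1 [] ∷ []) ∷ [])
  shrinks = certify 2 (λ x t → con 1 :≤ t ∷ [] ⊢ x :< x :+ 2 · t)
    ((1 , fwd 0 1 [] ∷ []) ∷ [])
  far-half = certify 3 (λ t x X → X :≡ t :+ x ∷ X :< 2 · t ∷ [] ⊢ x :< t)
    ((1 , bwd 0 1 [] ∷ fwd 1 1 [] ∷ []) ∷ [])

  -- Induction on X works because shrinking along an element removes 2t ≥ 2 columns. The constant 40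
  -- dominates the boundary errors of all cases: 31 from the hull edge, 15 from a light element, and
  -- the trivial bound for boxes with a side below 4.
  rectangle-bound : ∀ X Y (S : SumFreeSet X Y) → size S * 5 ≤ X * Y * 3 + (X + Y) * 40
  rectangle-bound = <-rec _ step
    where
    Claim : ℕ → Set
    Claim X = ∀ Y (S : SumFreeSet X Y) → size S * 5 ≤ X * Y * 3 + (X + Y) * 40

    step : ∀ X → (∀ {x} → x < X → Claim x) → Claim X
    step X ih Y S = by-size (4 ≤? X) (4 ≤? Y)
      where
      crude : size S ≤ X * Y
      crude = subst (size S ≤_) (length-grid X Y) (length-≤-⊆ (pts-unique S) (λ p → ∈-grid⁺ (pts-inBox S p)))

      Small-shift : Pt → Set
      Small-shift p = (2 * proj₁ p ≤ X × 2 * proj₂ p ≤ Y) × 7 * area p ≤ weight X Y p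
      small-shift? : Decidable Small-shift
      small-shift? p = ((2 * proj₁ p ≤? X) ×-dec (2 * proj₂ p ≤? Y)) ×-dec (7 * area p ≤? weight X Y p)

      Large-shift : Pt → Set
      Large-shift p = (X < 2 * proj₁ p ⊎ Y < 2 * proj₂ p) × X * Y * 2 ≤ (X ∸ proj₁ p) * (Y ∸ proj₂ p) * 5
      large-shift? : Decidable Large-shift
      large-shift? p = ((X <? 2 * proj₁ p) ⊎-dec (Y <? 2 * proj₂ p)) ×-dec (X * Y * 2 ≤? (X ∸ proj₁ p) * (Y ∸ proj₂ p) * 5)

      shrunk : ∀ {p} → p ∈ pts S → Small-shift p → size S * 5 ≤ X * Y * 3 + (X + Y) * 40
      shrunk {t , r} p∈ ((2t≤X , 2r≤Y) , cheap) with m≤n⇒∃[o]m+o≡n 2t≤X | m≤n⇒∃[o]m+o≡n 2r≤Y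
      ... | x , eX | y , eY = go (trans (sym eX) (+-comm (2 * t) x)) (trans (sym eY) (+-comm (2 * r) y))
        where
        go : X ≡ x + 2 * t → Y ≡ y + 2 * r → size S * 5 ≤ X * Y * 3 + (X + Y) * 40
        go refl refl = rect-shrink (size S) (size (restrict S x y)) t r x y (Shrink.bound S p∈ refl refl)
          (ih (shrinks x t (proj₁ (proj₁ (pts-inBox S p∈)))) y (restrict S x y)) cheap

      large : ∀ {p} → p ∈ pts S → Large-shift p → size S * 5 ≤ X * Y * 3 + (X + Y) * 40
      large {t , r} p∈ (far , big) = rect-large (size S) (X * Y) ((X ∸ t) * (Y ∸ r)) (X + Y)
        (large-element-bound S p∈ X≡ Y≡ (halves far)) big
        where
        X≡ : X ≡ t + (X ∸ t)
        X≡ = sym (m+[n∸m]≡n (proj₂ (proj₁ (pts-inBox S p∈))))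
        Y≡ : Y ≡ r + (Y ∸ r)
        Y≡ = sym (m+[n∸m]≡n (proj₂ (proj₂ (pts-inBox S p∈))))
        halves : X < 2 * t ⊎ Y < 2 * r → X ∸ t < t ⊎ Y ∸ r < r
        halves (inj₁ h) = inj₁ (far-half t (X ∸ t) X X≡ h)
        halves (inj₂ h) = inj₂ (far-half r (Y ∸ r) Y Y≡ h)

      module Generic (4≤X : 4 ≤ X) (4≤Y : 4 ≤ Y) (no-small : ∀ {p} → p ∈ pts S → ¬ Small-shift p)
        (no-large : ∀ {p} → p ∈ pts S → ¬ Large-shift p) where

        -- With g the weight and q = tr, the arithmetic-geometric mean inequality gives 4qXY ≤ g²,
        -- so g < 7q leaves g ≥ (4/7)XY and then q > (4/49)XY. The constants 57/100 and 81/1000 are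
        -- these fractions rounded down.
        central : ∀ {t r} → (t , r) ∈ pts S → weight X Y (t , r) < 7 * (t * r) → 4 * (X * Y) ≤ 7 * weight X Y (t , r)
        central {t} {r} p∈ h = *-cancel-≤ (weight X Y (t , r)) (4 * (X * Y)) (7 * weight X Y (t , r)) positive
          (central-weight (t * r) (X * Y) (weight X Y (t , r)) (product-weight t r X Y (2xy≤x²+y² (t * Y) (r * X))) h)
          where
          positive : 1 ≤ weight X Y (t , r)
          positive = ≤-trans (*-mono-≤ (proj₁ (proj₁ (pts-inBox S p∈))) (≤-trans (s≤s z≤n) 4≤Y)) (m≤m+n (t * Y) (r * X))

        -- Since (X - t)(Y - r) = XY - g + tr, an element for which the large shift is insufficient
        -- has weight g above (3/5)XY. The weaker 239/400 leaves room for the approximate version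
        -- needed in the near-extremal case.
        outer : ∀ {t r} → (t , r) ∈ pts S → X < 2 * t ⊎ Y < 2 * r → X * Y * 239 ≤ weight X Y (t , r) * 400
        outer {t} {r} p∈ far = outer-heavy ((X ∸ t) * (Y ∸ r)) (X * Y) (weight X Y (t , r)) (t * r)
          (≰⇒> (λ big → no-large p∈ (far , big)))
          (corner-area X Y t r (X ∸ t) (Y ∸ r) (sym (m+[n∸m]≡n (proj₂ (proj₁ (pts-inBox S p∈))))) (sym (m+[n∸m]≡n (proj₂ (proj₂ (pts-inBox S p∈))))))

        classify : ∀ {t r} → (t , r) ∈ pts S → weight X Y (t , r) < 7 * (t * r) ⊎ X * Y * 239 ≤ weight X Y (t , r) * 400
        classify {t} {r} p∈ with 2 * t ≤? X | 2 * r ≤? Y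
        ... | no h | _ = inj₂ (outer p∈ (inj₁ (≰⇒> h)))
        ... | yes _ | no h = inj₂ (outer p∈ (inj₂ (≰⇒> h)))
        ... | yes h | yes k = inj₁ (≰⇒> (λ cheap → no-small p∈ ((h , k) , cheap)))

        not-light : ∀ {p} → p ∈ pts S → X * Y * 57 ≤ weight X Y p * 100
        not-light {t , r} p∈ with classify p∈
        ... | inj₁ h = central-light (X * Y) (weight X Y (t , r)) (central p∈ h)
        ... | inj₂ h = outer-light (X * Y) (weight X Y (t , r)) h

        light-central : ∀ {p} → p ∈ pts S → X * Y * 239 ≤ weight X Y p * 400 ⊎ X * Y * 81 ≤ area p * 1000
        light-central {t , r} p∈ with classify p∈
        ... | inj₁ h = inj₂ (central-area (X * Y) (weight X Y (t , r)) (t * r) (central p∈ h) h)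
        ... | inj₂ h = inj₁ h

        conclusion : Edge S → size S * 5 ≤ X * Y * 3 + (X + Y) * 40
        conclusion E with Core.result S E 4≤X 4≤Y not-light light-central
        ... | inj₁ h = rect-light (size S) (X * Y) (X + Y) h
        ... | inj₂ M = *-cancel-≤ (α * β) _ _ (*-mono-≤ 1≤α 1≤β)
          (rect-main (α * β) (size S) (X * Y) (X + Y) h g bound)
          where
          open Edge E using (α; β; 1≤α; 1≤β)
          open MainBound M using (h; g; bound)

      by-size : Dec (4 ≤ X) → Dec (4 ≤ Y) → size S * 5 ≤ X * Y * 3 + (X + Y) * 40
      by-size (no h) _ = thin₁ (size S) X Y crude (≰⇒> h)
      by-size (yes _) (no h) = thin₂ (size S) X Y crude (≰⇒> h)
      by-size (yes 4≤X) (yes 4≤Y) with any? small-shift? (pts S)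
      ... | yes some = let p , p∈ , h = find some in shrunk p∈ h
      ... | no none with any? large-shift? (pts S)
      ... | yes some = let p , p∈ , h = find some in large p∈ h
      ... | no none′ = Generic.conclusion 4≤X 4≤Y (λ p∈ h → none (lose p∈ h)) (λ p∈ h → none′ (lose p∈ h))
        (hullEdge S (≤-trans (s≤s z≤n) 4≤X) (≤-trans (s≤s z≤n) 4≤Y))

  -- Near-extremal sets have a diagonal supporting line

  average-weight = certify 6 (λ z Q g q k D → 2 · k :+ z :≤ 2 · Q ∷ z :+ g :≡ Q :+ q ∷
      Q :* D :* con 3 :≤ k :* D :* con 5 :+ Q ∷ con 40 :≤ D ∷ [] ⊢ D :* (Q :* con 19) :≤ D :* (g :* con 100))
    ((1 , fwd 2 40 [] ∷ fwd 0 100 (5 ∷ []) ∷ bwd 1 100 (5 ∷ []) ∷ fwd 3 1 (1 ∷ []) ∷ []) ∷ [])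
  near-shrink = certify 8 (λ k k′ t r x y D n → k :+ (x :+ t) :* (y :+ r) :≤ (x :+ 2 · t) :* (y :+ 2 · r) :+ k′ ∷
      k′ :* con 5 :≤ x :* y :* con 3 :+ (x :+ y) :* con 40 ∷ n :≡ x :+ 2 · t ∷ n :≡ y :+ 2 · r ∷
      (x :+ 2 · t) :* (y :+ 2 · r) :* D :* con 3 :≤ k :* D :* con 5 :+ (x :+ 2 · t) :* (y :+ 2 · r) ∷ []
      ⊢ D :* (t :* (y :+ 2 · r) :+ r :* (x :+ 2 · t)) :≤ D :* (t :* r :* con 7) :+ (x :+ 2 · t) :* (y :+ 2 · r) :+ D :* n :* con 80)
    ((1 , fwd 4 1 [] ∷ fwd 0 5 (6 ∷ []) ∷ fwd 1 1 (6 ∷ []) ∷ bwd 2 40 (6 ∷ []) ∷ bwd 3 40 (6 ∷ []) ∷ []) ∷ [])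
  near-central = certify 5 (λ D g q Q n → D :* g :≤ D :* (q :* con 7) :+ Q :+ D :* n :* con 80 ∷ con 2000 :≤ D ∷
      D :* n :* con 160000 :≤ D :* Q ∷ [] ⊢ D :* (g :* con 1000) :≤ D :* (q :* con 7000 :+ Q))
    ((2 , fwd 0 2000 [] ∷ fwd 2 1 [] ∷ fwd 1 1 (3 ∷ []) ∷ []) ∷ [])
  -- With ξ = g/Q the hypotheses give ξ ≤ (7/4)ξ² + 1/1000, which allows only ξ near 0 or ξ above
  -- 57/100. The small root is ruled out by g ≥ 19Q/100, for which `averaging-bound` is there.
  central-gap = certify 3 (λ Q g q → 4 · (q :* Q) :≤ g :* g ∷ Q :* con 19 :≤ g :* con 100 ∷
      g :* con 1000 :≤ q :* con 7000 :+ Q ∷ g :* con 100 :< Q :* con 57 ∷ con 1 :≤ Q ∷ [] ⊢ absurd)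
    ((149 , fwd 0 70000 [] ∷ fwd 1 7 [] ∷ fwd 4 149 [] ∷ fwd 2 40 (0 ∷ []) ∷ fwd 3 132 (0 ∷ []) ∷ fwd 4 17 (0 ∷
     []) ∷ ff 1 3 7 ∷ []) ∷ [])
  central-area′ = certify 3 (λ Q g q → Q :* con 57 :≤ g :* con 100 ∷ g :* con 1000 :≤ q :* con 7000 :+ Q ∷ []
      ⊢ Q :* con 81 :≤ q :* con 1000)
    ((7 , fwd 0 10 [] ∷ fwd 1 1 [] ∷ []) ∷ [])
  near-outer = certify 6 (λ k z Q g q D → k :+ z :≤ Q ∷ z :+ g :≡ Q :+ q ∷
      Q :* D :* con 3 :≤ k :* D :* con 5 :+ Q ∷ con 100 :≤ D ∷ [] ⊢ D :* (Q :* con 239) :≤ D :* (g :* con 400))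
    ((299 , fwd 2 23900 [] ∷ fwd 0 119500 (5 ∷ []) ∷ bwd 1 119500 (5 ∷ []) ∷ fwd 3 239 (2 ∷ []) ∷ []) ∷ [])
  near-light = certify 4 (λ k Q n D → k :* con 50 :≤ Q :* con 29 :+ (n :+ n) :* con 150 ∷
      Q :* D :* con 3 :≤ k :* D :* con 5 :+ Q ∷ con 100 :≤ D ∷ n :* con 1000 :≤ Q ∷ con 1 :≤ Q ∷ [] ⊢ absurd)
    ((600 , fwd 1 100 [] ∷ fwd 4 600 [] ∷ fwd 0 10 (3 ∷ []) ∷ fwd 2 7 (1 ∷ []) ∷ fwd 3 3 (3 ∷ []) ∷ []) ∷ [])
  near-main = certify 7 (λ m k Q n D h g →
      m :* k :* con 500 :+ (h :* h :+ g :* g) :≤ m :* Q :* con 300 :+ m :* (n :+ n) :* con 3100 ∷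
      Q :* D :* con 3 :≤ k :* D :* con 5 :+ Q ∷ D :* n :* con 62 :≤ Q ∷ []
      ⊢ D :* (h :* h :+ g :* g) :≤ m :* Q :* con 200)
    ((1 , fwd 0 1 (4 ∷ []) ∷ fwd 1 100 (0 ∷ []) ∷ fwd 2 100 (0 ∷ []) ∷ []) ∷ [])

  -- Both intercepts are within a factor 1 + O(1/R) of 4n/5.
  record NearExtremal {n : ℕ} (S : SumFreeSet n n) (R : ℕ) : Set where
    field
      sums : ∀ {p} → p ∈ pts S → n * R * 4 ≤ (proj₁ p + proj₂ p) * R * 5 + n * 3
      a b : Pt
      a∈ : a ∈ pts S
      b∈ : b ∈ pts S
      a-left : proj₁ a ≤ proj₂ a
      b-right : proj₂ b ≤ proj₁ b
      a-low : (proj₁ a + proj₂ a) * R * 5 ≤ n * R * 4 + n * 11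
      b-low : (proj₁ b + proj₂ b) * R * 5 ≤ n * R * 4 + n * 11

  root = certify 2 (λ x y → y :< x ∷ x :* x :≤ y :* y ∷ [] ⊢ absurd)
    ((1 , fwd 0 1 [] ∷ fwd 1 1 [] ∷ fwd 0 1 (0 ∷ []) ∷ fwd 0 1 (1 ∷ []) ∷ []) ∷ [])

  square-cancel : ∀ x y → x * x ≤ y * y → x ≤ y
  square-cancel x y h with x ≤? y
  ... | yes p = p
  ... | no p = ⊥-elim (root x y (≰⇒> p) h)

  divide = certify 5 (λ R m Q D k → D :≡ R :* R :* con 200 ∷ D :* k :≤ m :* Q :* con 200 ∷ []
      ⊢ 200 · (R :* R :* k) :≤ 200 · (m :* Q))
    ((1 , fwd 1 1 [] ∷ bwd 0 1 (4 ∷ []) ∷ []) ∷ [])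
  part-root = certify 5 (λ R h g U V → R :* R :* (h :* h :+ g :* g) :≤ U :* V ∷ U :≤ V ∷ []
      ⊢ R :* h :* (R :* h) :≤ V :* V)
    ((1 , fwd 0 1 [] ∷ fwd 1 1 (4 ∷ []) ∷ []) ∷ [])
  part-root′ = certify 5 (λ R h g U V → R :* R :* (h :* h :+ g :* g) :≤ U :* V ∷ U :≤ V ∷ []
      ⊢ R :* g :* (R :* g) :≤ V :* V)
    ((1 , fwd 0 1 [] ∷ fwd 1 1 (4 ∷ []) ∷ []) ∷ [])
  level-lower = certify 7 (λ R h g U V c w → R :* h :≤ V ∷ R :* g :≤ V ∷ U :+ g :≡ V ∷ U :+ V :≡ 2 · c :+ w ∷
      c :+ h :≡ 2 · w ∷ [] ⊢ V :* R :* con 4 :≤ c :* R :* con 5 :+ V :* con 3)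
    ((1 , fwd 0 1 [] ∷ fwd 1 2 [] ∷ bwd 2 2 (0 ∷ []) ∷ fwd 3 2 (0 ∷ []) ∷ bwd 4 1 (0 ∷ []) ∷ []) ∷ [])
  level-lower′ = certify 7 (λ R h g U V c w → R :* h :≤ V ∷ R :* g :≤ V ∷ U :+ g :≡ V ∷ U :+ V :≡ 2 · c :+ w ∷
      2 · w :+ h :≡ c ∷ [] ⊢ V :* R :* con 4 :≤ c :* R :* con 5 :+ V :* con 3)
    ((1 , fwd 1 2 [] ∷ bwd 2 2 (0 ∷ []) ∷ fwd 3 2 (0 ∷ []) ∷ fwd 4 1 (0 ∷ []) ∷ []) ∷ [])
  level-upper = certify 7 (λ R h g U V c w → R :* h :≤ V ∷ R :* g :≤ V ∷ U :+ g :≡ V ∷ U :+ V :≡ 2 · c :+ w ∷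
      c :+ h :≡ 2 · w ∷ [] ⊢ c :* R :* con 5 :≤ V :* R :* con 4 :+ V)
    ((1 , fwd 2 2 (0 ∷ []) ∷ bwd 3 2 (0 ∷ []) ∷ fwd 4 1 (0 ∷ []) ∷ []) ∷ [])
  level-upper′ = certify 7 (λ R h g U V c w → R :* h :≤ V ∷ R :* g :≤ V ∷ U :+ g :≡ V ∷ U :+ V :≡ 2 · c :+ w ∷
      2 · w :+ h :≡ c ∷ [] ⊢ c :* R :* con 5 :≤ V :* R :* con 4 :+ V)
    ((1 , fwd 0 1 [] ∷ fwd 2 2 (0 ∷ []) ∷ bwd 3 2 (0 ∷ []) ∷ bwd 4 1 (0 ∷ []) ∷ []) ∷ [])
  sum-lower = certify 5 (λ R V c n s → V :* R :* con 4 :≤ c :* R :* con 5 :+ V :* con 3 ∷ n :* c :≤ V :* s ∷ []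
      ⊢ V :* (n :* R :* con 4) :≤ V :* (s :* R :* con 5 :+ n :* con 3))
    ((1 , fwd 0 1 (3 ∷ []) ∷ fwd 1 5 (0 ∷ []) ∷ []) ∷ [])
  sum-upper = certify 7 (λ R V U g c n s → c :* R :* con 5 :≤ V :* R :* con 4 :+ V ∷ U :* s :≤ n :* c ∷
      R :* g :≤ V ∷ U :+ g :≡ V ∷ s :≤ 2 · n ∷ []
      ⊢ V :* (s :* R :* con 5) :≤ V :* (n :* R :* con 4 :+ n :* con 11))
    ((1 , fwd 0 1 (5 ∷ []) ∷ fwd 1 5 (0 ∷ []) ∷ fwd 2 5 (6 ∷ []) ∷ bwd 3 5 (0 ∷ 6 ∷ []) ∷ fwd 4 5 (1 ∷ []) ∷ []) ∷
     [])
  weighted-sum = certify 7 (λ α β n x y c V → c :≤ α :* x :+ β :* y ∷ α :* n :≤ V ∷ β :* n :≤ V ∷ []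
      ⊢ n :* c :≤ V :* (x :+ y))
    ((1 , fwd 0 1 (2 ∷ []) ∷ fwd 1 1 (3 ∷ []) ∷ fwd 2 1 (4 ∷ []) ∷ []) ∷ [])
  weighted-contact = certify 7 (λ α β n x y c U → α :* x :+ β :* y :≡ c ∷ U :≤ α :* n ∷ U :≤ β :* n ∷ []
      ⊢ U :* (x :+ y) :≤ n :* c)
    ((1 , fwd 0 1 (2 ∷ []) ∷ fwd 1 1 (3 ∷ []) ∷ fwd 2 1 (4 ∷ []) ∷ []) ∷ [])
  corner-contact = certify 2 (λ n R → (con 0 :+ n) :* R :* con 5 :≤ n :* R :* con 4 :+ n :* con 11 ∷ con 12 :≤ R ∷
      con 1 :≤ n ∷ [] ⊢ absurd)
    ((1 , fwd 0 1 [] ∷ fwd 2 1 [] ∷ fwd 1 1 (0 ∷ []) ∷ []) ∷ [])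
  corner-contact′ = certify 2 (λ n R → (n :+ con 0) :* R :* con 5 :≤ n :* R :* con 4 :+ n :* con 11 ∷
      con 12 :≤ R ∷ con 1 :≤ n ∷ [] ⊢ absurd)
    ((1 , fwd 0 1 [] ∷ fwd 2 1 [] ∷ fwd 1 1 (0 ∷ []) ∷ []) ∷ [])
  double-sum = certify 3 (λ x y n → x :≤ n ∷ y :≤ n ∷ [] ⊢ x :+ y :≤ 2 · n)
    ((1 , fwd 0 1 [] ∷ fwd 1 1 [] ∷ []) ∷ [])

  -- Here 5c = 2(U + V) + (c - 2w) = 4V - 2g ± h, while the surviving squares give g, h ≤ V/R. The
  -- level therefore differs from 4V/5 by O(V/R).
  module Levels (α β c w h g n R : ℕ) (1≤R : 1 ≤ R)
    (w-def : α * n + β * n ≡ 2 * c + w) (h-def : c + h ≡ 2 * w ⊎ 2 * w + h ≡ c) (g-def : α * n + g ≡ β * n)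
    (small : R * R * (h * h + g * g) ≤ α * n * (β * n)) where

    U V : ℕ
    U = α * n
    V = β * n

    U≤V : U ≤ V
    U≤V = m+n≤o⇒m≤o U (≤-reflexive g-def)
    Rh≤V : R * h ≤ V
    Rh≤V = square-cancel (R * h) V (part-root R h g U V small U≤V)
    Rg≤V : R * g ≤ V
    Rg≤V = square-cancel (R * g) V (part-root′ R h g U V small U≤V)

    lower : V * R * 4 ≤ c * R * 5 + V * 3
    lower = go h-def
      where
      go : c + h ≡ 2 * w ⊎ 2 * w + h ≡ c → V * R * 4 ≤ c * R * 5 + V * 3
      go (inj₁ p) = level-lower R h g U V c w Rh≤V Rg≤V g-def w-def p
      go (inj₂ p) = level-lower′ R h g U V c w Rh≤V Rg≤V g-def w-def p

    upper : c * R * 5 ≤ V * R * 4 + V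
    upper = go h-def
      where
      go : c + h ≡ 2 * w ⊎ 2 * w + h ≡ c → c * R * 5 ≤ V * R * 4 + V
      go (inj₁ p) = level-upper R h g U V c w Rh≤V Rg≤V g-def w-def p
      go (inj₂ p) = level-upper′ R h g U V c w Rh≤V Rg≤V g-def w-def p

    sum-above : ∀ s → 1 ≤ V → n * c ≤ V * s → n * R * 4 ≤ s * R * 5 + n * 3
    sum-above s 1≤V k = *-cancel-≤ V (n * R * 4) (s * R * 5 + n * 3) 1≤V (sum-lower R V c n s lower k)

    sum-below : ∀ s → 1 ≤ V → U * s ≤ n * c → s ≤ 2 * n → s * R * 5 ≤ n * R * 4 + n * 11
    sum-below s 1≤V k s≤ = *-cancel-≤ V (s * R * 5) (n * R * 4 + n * 11) 1≤V (sum-upper R V U g c n s upper k Rg≤V g-def s≤)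

  n-scale = certify 2 (λ D n → D :* con 100 :≤ n ∷ [] ⊢ D :* n :* con 62 :≤ n :* n)
    ((50 , fwd 0 31 (1 ∷ []) ∷ []) ∷ [])

  module Near {n : ℕ} (S : SumFreeSet n n) (E : Edge S) (R D : ℕ) (D≡ : D ≡ R * R * 200) (12≤R : 12 ≤ R) (D≤n : D * 100 ≤ n)
    (near : n * n * D * 3 ≤ size S * D * 5 + n * n) where

    28800≤D : 28800 ≤ D
    28800≤D = subst (28800 ≤_) (sym D≡) (*-monoˡ-≤ 200 (*-mono-≤ 12≤R 12≤R))
    2880000≤n : 2880000 ≤ n
    2880000≤n = ≤-trans (*-monoˡ-≤ 100 28800≤D) D≤n
    -- Every absolute constant needed is compared by evaluation with the one bound 28800 = 12² ·
    -- 200.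
    D-large : ∀ k → {Bool.T (k ≤ᵇ 28800)} → k ≤ D
    D-large k {h} = ≤-trans (≤ᵇ⇒≤ k 28800 h) 28800≤D
    n-large : ∀ k → {Bool.T (k ≤ᵇ 2880000)} → k ≤ n
    n-large k {h} = ≤-trans (≤ᵇ⇒≤ k 2880000 h) 2880000≤n
    1≤D : 1 ≤ D
    1≤D = D-large 1
    4≤n : 4 ≤ n
    4≤n = n-large 4
    1≤n : 1 ≤ n
    1≤n = ≤-trans (s≤s z≤n) 4≤n
    Q : ℕ
    Q = n * n
    1≤Q : 1 ≤ Q
    1≤Q = *-mono-≤ 1≤n 1≤n

    complement : ∀ {t} → t ≤ n → n ≡ t + (n ∸ t)
    complement t≤n = sym (m+[n∸m]≡n t≤n)

    corner : ∀ {t r} → (t , r) ∈ pts S → (n ∸ t) * (n ∸ r) + weight n n (t , r) ≡ Q + t * r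
    corner {t} {r} p∈ = let (_ , t≤n) , (_ , r≤n) = pts-inBox S p∈ in
      corner-area n n t r (n ∸ t) (n ∸ r) (complement t≤n) (complement r≤n)

    outer : ∀ {t r} → (t , r) ∈ pts S → n < 2 * t ⊎ n < 2 * r → Q * 239 ≤ weight n n (t , r) * 400
    outer {t} {r} p∈ far = *-cancel-≤ D (Q * 239) (weight n n (t , r) * 400) 1≤D
      (near-outer (size S) ((n ∸ t) * (n ∸ r)) Q (weight n n (t , r)) (t * r) D
        (large-element-bound S p∈ (complement t≤n) (complement r≤n) (halves far)) (corner p∈) near (D-large 100))
      where
      t≤n : t ≤ n
      t≤n = proj₂ (proj₁ (pts-inBox S p∈))
      r≤n : r ≤ n
      r≤n = proj₂ (proj₂ (pts-inBox S p∈))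
      halves : n < 2 * t ⊎ n < 2 * r → n ∸ t < t ⊎ n ∸ r < r
      halves (inj₁ h) = inj₁ (far-half t (n ∸ t) n (complement t≤n) h)
      halves (inj₂ h) = inj₂ (far-half r (n ∸ r) n (complement r≤n) h)

    not-tiny : ∀ {t r} → (t , r) ∈ pts S → Q * 19 ≤ weight n n (t , r) * 100
    not-tiny {t} {r} p∈ = *-cancel-≤ D (Q * 19) (weight n n (t , r) * 100) 1≤D
      (average-weight ((n ∸ t) * (n ∸ r)) Q (weight n n (t , r)) (t * r) (size S) D
        (averaging-bound S p∈ (complement t≤n) (complement r≤n)) (corner p∈) near (D-large 40))
      where
      t≤n : t ≤ n
      t≤n = proj₂ (proj₁ (pts-inBox S p∈))
      r≤n : r ≤ n
      r≤n = proj₂ (proj₂ (pts-inBox S p∈))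

    -- If the weight exceeded 7tr by more than Q/1000, shrinking along (t , r) and `rectangle-bound`
    -- on the core would push |S| below the assumed density.
    shrunk : ∀ {t r x y} → (t , r) ∈ pts S → x + 2 * t ≡ n → y + 2 * r ≡ n →
      weight n n (t , r) * 1000 ≤ t * r * 7000 + Q
    shrunk {t} {r} {x} {y} p∈ eX eY = *-cancel-≤ D (weight n n (t , r) * 1000) (t * r * 7000 + Q) 1≤D
      (near-central D (weight n n (t , r)) (t * r) Q n
        (subst₂ (λ X Y → D * (t * Y + r * X) ≤ D * (t * r * 7) + X * Y + D * n * 80) eX eY
          (near-shrink (size S) (size (restrict S x y)) t r x y D n
            (subst₂ (λ X Y → size S + (x + t) * (y + r) ≤ X * Y + size (restrict S x y)) (sym eX) (sym eY)
              (Shrink.bound S p∈ (sym eX) (sym eY)))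
            (rectangle-bound x y (restrict S x y)) (sym eX) (sym eY)
            (subst₂ (λ X Y → X * Y * D * 3 ≤ size S * D * 5 + X * Y) (sym eX) (sym eY) near)))
        (D-large 2000) (subst (D * n * 160000 ≤_) (*-assoc D n n) (*-monoʳ-≤ (D * n) (n-large 160000))))

    inner : ∀ {t r} → (t , r) ∈ pts S → 2 * t ≤ n → 2 * r ≤ n → weight n n (t , r) * 1000 ≤ t * r * 7000 + Q
    inner {t} {r} p∈ 2t≤n 2r≤n = shrunk {t} {r} {n ∸ 2 * t} {n ∸ 2 * r} p∈ (m∸n+n≡m 2t≤n) (m∸n+n≡m 2r≤n)

    inner-heavy : ∀ {t r} → (t , r) ∈ pts S → 2 * t ≤ n → 2 * r ≤ n → Q * 57 ≤ weight n n (t , r) * 100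
    inner-heavy {t} {r} p∈ 2t≤n 2r≤n = ≮⇒≥ λ light →
      central-gap Q (weight n n (t , r)) (t * r) (product-weight t r n n (2xy≤x²+y² (t * n) (r * n)))
        (not-tiny p∈) (inner p∈ 2t≤n 2r≤n) light 1≤Q

    not-light : ∀ {p} → p ∈ pts S → Q * 57 ≤ weight n n p * 100
    not-light {t , r} p∈ with 2 * t ≤? n | 2 * r ≤? n
    ... | no h | _ = outer-light Q (weight n n (t , r)) (outer p∈ (inj₁ (≰⇒> h)))
    ... | yes _ | no h = outer-light Q (weight n n (t , r)) (outer p∈ (inj₂ (≰⇒> h)))
    ... | yes h | yes k = inner-heavy p∈ h k

    light-central : ∀ {p} → p ∈ pts S → Q * 239 ≤ weight n n p * 400 ⊎ Q * 81 ≤ area p * 1000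
    light-central {t , r} p∈ with 2 * t ≤? n | 2 * r ≤? n
    ... | no h | _ = inj₁ (outer p∈ (inj₁ (≰⇒> h)))
    ... | yes _ | no h = inj₁ (outer p∈ (inj₂ (≰⇒> h)))
    ... | yes h | yes k = inj₂ (central-area′ Q (weight n n (t , r)) (t * r) (inner-heavy p∈ h k) (inner p∈ h k))

    main : MainBound S E
    main with Core.result S E 4≤n 4≤n not-light light-central
    ... | inj₁ h = ⊥-elim (near-light (size S) Q n D h near (D-large 100) (*-monoʳ-≤ n (n-large 1000)) 1≤Q)
    ... | inj₂ M = M

    open Edge E
    open MainBound main using (w; h; g; w-def; h-def; g-def; bound)

    small : R * R * (h * h + g * g) ≤ α * n * (β * n)
    small = subst (R * R * (h * h + g * g) ≤_) (sym (product α β n n))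
      (*-cancel-≤ 200 (R * R * (h * h + g * g)) (α * β * Q) (s≤s z≤n)
        (divide R (α * β) Q D (h * h + g * g) D≡
          (near-main (α * β) (size S) Q n D h g bound near (n-scale D n D≤n))))

    1≤R : 1 ≤ R
    1≤R = ≤-trans (s≤s z≤n) 12≤R

    touch-b : α * (a₁ + β) + β * b₂ ≡ c
    touch-b = contact-b α β a₁ a₂ b₂ a₂≡

    Sums-above Sums-below : Set
    Sums-above = ∀ {p} → p ∈ pts S → n * R * 4 ≤ (proj₁ p + proj₂ p) * R * 5 + n * 3
    Sums-below = ∀ x y → α * x + β * y ≡ c → x + y ≤ 2 * n → (x + y) * R * 5 ≤ n * R * 4 + n * 11

    sums-flat : α * n + g ≡ β * n → Sums-above × Sums-below
    sums-flat g≡ =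
      (λ {p} p∈ → sum-above (proj₁ p + proj₂ p) 1≤V (weighted-sum α β n (proj₁ p) (proj₂ p) c (β * n) (above p∈) U≤V ≤-refl)) ,
      (λ x y touch s≤ → sum-below (x + y) 1≤V (weighted-contact α β n x y c (α * n) touch ≤-refl U≤V) s≤)
      where
      open Levels α β c w h g n R 1≤R w-def h-def g≡ small
      1≤V : 1 ≤ β * n
      1≤V = *-mono-≤ 1≤β 1≤n

    sums-steep : β * n + g ≡ α * n → Sums-above × Sums-below
    sums-steep g≡ =
      (λ {p} p∈ → sum-above (proj₁ p + proj₂ p) 1≤V (weighted-sum α β n (proj₁ p) (proj₂ p) c (α * n) (above p∈) ≤-refl U≤V)) ,
      (λ x y touch s≤ → sum-below (x + y) 1≤V (weighted-contact α β n x y c (β * n) touch U≤V ≤-refl) s≤)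
      where
      open Levels β α c w h g n R 1≤R (trans (+-comm (β * n) (α * n)) w-def) h-def g≡
        (subst (R * R * (h * h + g * g) ≤_) (*-comm (α * n) (β * n)) small)
      1≤V : 1 ≤ α * n
      1≤V = *-mono-≤ 1≤α 1≤n

    sums-both : α * n + g ≡ β * n ⊎ β * n + g ≡ α * n → Sums-above × Sums-below
    sums-both (inj₁ e) = sums-flat e
    sums-both (inj₂ e) = sums-steep e

    -- The corner (0 , n) has coordinate sum n, whereas a contact point has sum about 4n/5, so for R
    -- ≥ 12 the contact point is a genuine element.
    a∈S : (a₁ , a₂) ∈ pts S
    a∈S = go a∈
      where
      go : (a₁ , a₂) ∈ pts S ⊎ (a₁ ≡ 0 × a₂ ≡ n) → (a₁ , a₂) ∈ pts S
      go (inj₁ p) = p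
      go (inj₂ (e₁ , e₂)) = ⊥-elim (corner-contact n R
        (subst₂ (λ x y → (x + y) * R * 5 ≤ n * R * 4 + n * 11) e₁ e₂
          (proj₂ (sums-both g-def) a₁ a₂ refl (subst₂ (λ x y → x + y ≤ 2 * n) (sym e₁) (sym e₂) (m≤m+n n (n + 0))))) 12≤R 1≤n)

    b∈S : (a₁ + β , b₂) ∈ pts S
    b∈S = go b∈
      where
      go : (a₁ + β , b₂) ∈ pts S ⊎ (a₁ + β ≡ n × b₂ ≡ 0) → (a₁ + β , b₂) ∈ pts S
      go (inj₁ p) = p
      go (inj₂ (e₁ , e₂)) = ⊥-elim (corner-contact′ n R
        (subst₂ (λ x y → (x + y) * R * 5 ≤ n * R * 4 + n * 11) e₁ e₂
          (proj₂ (sums-both g-def) (a₁ + β) b₂ touch-b (subst₂ (λ x y → x + y ≤ 2 * n) (sym e₁) (sym e₂)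
            (subst (_≤ 2 * n) (sym (+-identityʳ n)) (m≤m+n n (n + 0)))))) 12≤R 1≤n)

    in-double : ∀ {x y} → (x , y) ∈ pts S → x + y ≤ 2 * n
    in-double {x} {y} p∈ = let (_ , x≤n) , (_ , y≤n) = pts-inBox S p∈ in double-sum x y n x≤n y≤n

    nearExtremal : NearExtremal S R
    nearExtremal = record
      { sums = proj₁ (sums-both g-def)
      ; a = a₁ , a₂
      ; b = a₁ + β , b₂
      ; a∈ = a∈S
      ; b∈ = b∈S
      ; a-left = *-cancelʳ-≤ a₁ a₂ n {{>-nonZero 1≤n}} a-left
      ; b-right = *-cancelʳ-≤ b₂ (a₁ + β) n {{>-nonZero 1≤n}} b-right
      ; a-low = proj₂ (sums-both g-def) a₁ a₂ refl (in-double a∈S)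
      ; b-low = proj₂ (sums-both g-def) (a₁ + β) b₂ touch-b (in-double b∈S)
      }

  near-extremal : ∀ {n} (S : SumFreeSet n n) R → 12 ≤ R → R * R * 200 * 100 ≤ n →
    n * n * (R * R * 200) * 3 ≤ size S * (R * R * 200) * 5 + n * n → NearExtremal S R
  near-extremal {n} S R 12≤R D≤n near = Near.nearExtremal S (hullEdge S 1≤n 1≤n) R (R * R * 200) refl 12≤R D≤n near
    where
    1≤n : 1 ≤ n
    1≤n = ≤-trans (*-mono-≤ (*-mono-≤ (*-mono-≤ 1≤R 1≤R) (s≤s {n = 199} z≤n)) (s≤s {n = 99} z≤n)) D≤n
      where
      1≤R : 1 ≤ R
      1≤R = ≤-trans (s≤s z≤n) 12≤R

  -- Small boxes and their gaps

  box : ℕ → ℕ → ℕ → List Pt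
  box u v l = map (_⊹ (u , v)) (grid l l)

  box-unique : ∀ u v l → Unique (box u v l)
  box-unique u v l = unique-map (_⊹ (u , v)) (grid-unique l l) (λ {p} {q} _ _ → ⊹-cancelʳ p q (u , v))

  length-box : ∀ u v l → length (box u v l) ≡ l * l
  length-box u v l = trans (length-map (_⊹ (u , v)) (grid l l)) (length-grid l l)

  InBox : ℕ → ℕ → ℕ → Pt → Set
  InBox u v l p = (u < proj₁ p × proj₁ p ≤ u + l) × (v < proj₂ p × proj₂ p ≤ v + l)

  shift-lower = certify 2 (λ i u → con 1 :≤ i ∷ [] ⊢ u :< i :+ u)
    ((1 , fwd 0 1 [] ∷ []) ∷ [])
  shift-upper = certify 3 (λ i u l → i :≤ l ∷ [] ⊢ i :+ u :≤ u :+ l)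
    ((1 , fwd 0 1 [] ∷ []) ∷ [])
  unshift-upper = certify 3 (λ i u l → i :+ u :≤ u :+ l ∷ [] ⊢ i :≤ l)
    ((1 , fwd 0 1 [] ∷ []) ∷ [])

  ∈-box⁻ : ∀ {u v l p} → p ∈ box u v l → InBox u v l p
  ∈-box⁻ {u} {v} {l} q with ∈-map⁻ (_⊹ (u , v)) q
  ... | (i , j) , h , refl with ∈-grid⁻ {l} {l} h
  ... | (l₁ , u₁) , (l₂ , u₂) = (shift-lower i u l₁ , shift-upper i u l u₁) , (shift-lower j v l₂ , shift-upper j v l u₂)

  ∈-box⁺ : ∀ {u v l p} → InBox u v l p → p ∈ box u v l
  ∈-box⁺ {u} {v} {l} {p₁ , p₂} ((a , b) , (c , d)) = subst (_∈ box u v l) (cong₂ _,_ (m∸n+n≡m (<⇒≤ a)) (m∸n+n≡m (<⇒≤ c)))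
    (∈-map⁺ (_⊹ (u , v)) {x = p₁ ∸ u , p₂ ∸ v} (∈-grid⁺
      ((m<n⇒0<n∸m a , unshift-upper (p₁ ∸ u) u l (subst (_≤ u + l) (sym (m∸n+n≡m (<⇒≤ a))) b)) ,
       (m<n⇒0<n∸m c , unshift-upper (p₂ ∸ v) v l (subst (_≤ v + l) (sym (m∸n+n≡m (<⇒≤ c))) d)))))

  unit-sum : ∀ x y → lin 1 1 (x , y) ≡ x + y
  unit-sum x y = cong₂ _+_ (*-identityˡ x) (*-identityˡ y)

  module Gaps {n} (S : SumFreeSet n n) where

    in? : Decidable (_∈ pts S)
    in? = _∈? pts S

    gaps : List Pt → List Pt
    gaps = filter (¬? ∘ in?)

    ∈-gaps : ∀ {xs p} → p ∈ gaps xs → p ∈ xs × p ∉ pts S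
    ∈-gaps {xs} = ∈-filter⁻ (¬? ∘ in?) {xs = xs}

    gaps-unique : ∀ u v l → Unique (gaps (box u v l))
    gaps-unique u v l = Unique.filter⁺ (¬? ∘ in?) (box-unique u v l)

    found-or-gaps : ∀ u v l → (∃[ p ] (p ∈ pts S × InBox u v l p)) ⊎ l * l ≤ length (gaps (box u v l))
    found-or-gaps u v l = go (any? in? (box u v l))
      where
      go : Dec (Any (_∈ pts S) (box u v l)) → (∃[ p ] (p ∈ pts S × InBox u v l p)) ⊎ l * l ≤ length (gaps (box u v l))
      go (yes some) = let p , p∈ , h = find some in inj₁ (p , h , ∈-box⁻ p∈)
      go (no none) = inj₂ (subst (_≤ length (gaps (box u v l))) (length-box u v l)
        (length-≤-⊆ (box-unique u v l) (λ p∈ → ∈-filter⁺ (¬? ∘ in?) p∈ (λ h → none (lose p∈ h)))))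

  fill-w = certify 6 (λ m A n k η ξ → A :≤ 16 · k :+ ξ ∷ m :+ η :≡ 16 · k ∷ 20 · k :≤ n ∷ ξ :≤ k ∷ []
      ⊢ m :+ A :≤ 2 · n)
    ((20 , fwd 0 20 [] ∷ fwd 1 20 [] ∷ fwd 2 33 [] ∷ fwd 3 20 [] ∷ []) ∷ [])
  fill-range = certify 7 (λ t r x y n m w → n :≡ t :+ x ∷ n :≡ r :+ y ∷ m :+ (t :+ r) :+ w :≡ 2 · n ∷ []
      ⊢ 1 · x :+ 1 · y :≡ m :+ w)
    ((1 , bwd 0 1 [] ∷ bwd 1 1 [] ∷ bwd 2 1 [] ∷ []) ∷ (1 , fwd 0 1 [] ∷ fwd 1 1 [] ∷ fwd 2 1 [] ∷ []) ∷ [])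
  fill-v = certify 9 (λ t r x n m w k η κ → n :≡ t :+ x ∷ m :+ (t :+ r) :+ w :≡ 2 · n ∷ n :≤ 20 · k :+ η ∷
      m :+ η :≡ 16 · k ∷ 4 · k :≤ r :+ κ ∷ [] ⊢ w :≤ 1 · x :+ (κ :+ 2 · η))
    ((1 , fwd 0 1 [] ∷ fwd 1 1 [] ∷ fwd 2 1 [] ∷ bwd 3 1 [] ∷ fwd 4 1 [] ∷ []) ∷ [])
  fill-v₃ = certify 7 (λ t r n m w k η → m :+ (t :+ r) :+ w :≡ 2 · n ∷ n :≤ 20 · k :+ η ∷ m :+ η :≡ 16 · k ∷
      m :≤ t :+ r ∷ η :* con 100 :≤ k ∷ [] ⊢ w :≤ t :+ r :+ con 0)
    ((533 , fwd 0 533 [] ∷ fwd 1 1066 [] ∷ bwd 2 1334 [] ∷ fwd 3 801 [] ∷ fwd 4 24 [] ∷ []) ∷ [])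
  fill-m = certify 4 (λ m η k n → m :+ η :≡ 16 · k ∷ 20 · k :≤ n ∷ [] ⊢ m :≤ 1 · n)
    ((5 , fwd 0 5 [] ∷ fwd 1 4 [] ∷ []) ∷ [])
  fill-m₂ = certify 3 (λ m η k → m :+ η :≡ 16 · k ∷ η :* con 100 :≤ k ∷ con 2 :≤ η ∷ [] ⊢ con 2 :≤ m)
    ((50 , bwd 0 50 [] ∷ fwd 1 1 [] ∷ fwd 2 50 [] ∷ []) ∷ [])
  fill-narrow = certify 8 (λ t r n m w k η ξ → m :+ (t :+ r) :+ w :≡ 2 · n ∷ 20 · k :≤ n ∷ m :+ η :≡ 16 · k ∷
      t :+ r :≤ 16 · k :+ ξ ∷ [] ⊢ 8 · k :+ η :≤ w :+ ξ)
    ((1 , bwd 0 1 [] ∷ fwd 1 2 [] ∷ fwd 2 1 [] ∷ fwd 3 1 [] ∷ []) ∷ [])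
  -- The two triangles have legs of about 16k and 8k, so together they fill 128k² + 32k² =
  -- (2/5)(20k)². For a set of density near 3/5 only error terms are left for d.
  fill-count = certify 14 (λ N d n Te Tw T₁ T₂ e m w κ η ξ k →
      N :+ (Te :+ d :+ Tw) :≤ n :* n :+ (T₁ :+ T₂ :+ con 0) ∷ e :* e :≤ 2 · (con 1 :* con 1 :* Te) ∷
      w :* w :≤ 2 · (con 1 :* con 1 :* Tw) ∷
      2 · (con 1 :* con 1 :* T₁) :≤ (κ :+ 2 · η :+ con 1 :+ con 1) :* (κ :+ 2 · η :+ con 1 :+ con 1) ∷
      2 · (con 1 :* con 1 :* T₂) :≤ (κ :+ 2 · η :+ con 1 :+ con 1) :* (κ :+ 2 · η :+ con 1 :+ con 1) ∷
      e :+ con 2 :≡ m ∷ m :+ η :≡ 16 · k ∷ 8 · k :+ η :≤ w :+ ξ ∷ n :* n :* con 3 :≤ N :* con 5 :+ k :* η ∷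
      n :≤ 20 · k :+ η ∷ con 2 :≤ η ∷ η :≤ ξ ∷ η :* con 100 :≤ k ∷ ξ :≤ k ∷ []
      ⊢ d :≤ k :* ξ :* con 60 :+ (κ :+ 4 · η) :* (κ :+ 4 · η))
    ((200 , fwd 0 200 [] ∷ fwd 1 100 [] ∷ fwd 2 100 [] ∷ fwd 3 100 [] ∷ fwd 4 100 [] ∷ fwd 5 200 [] ∷ fwd 6 400 [] ∷
     fwd 8 40 [] ∷ fwd 10 200 [] ∷ fwd 12 14 [] ∷ bwd 5 100 (7 ∷ []) ∷ bwd 5 100 (8 ∷ []) ∷ bwd 6 100 (8 ∷ []) ∷
     bwd 6 1600 (13 ∷ []) ∷ fwd 6 100 (11 ∷ []) ∷ fwd 7 100 (9 ∷ []) ∷ fwd 7 700 (13 ∷ []) ∷ fwd 7 100 (11 ∷ []) ∷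
     fwd 9 80 (2 ∷ []) ∷ fwd 9 1600 (13 ∷ []) ∷ fwd 9 80 (11 ∷ []) ∷ fwd 10 400 (10 ∷ []) ∷ fwd 10 3207 (13 ∷
     []) ∷ fwd 11 8247 (13 ∷ []) ∷ fwd 13 200 (11 ∷ []) ∷ ff 7 13 100 ∷ []) ∷ [])

  far-first = certify 5 (λ n u t p x → n :≤ u :+ t ∷ u :< p ∷ n :≡ t :+ x ∷ p :≤ x ∷ [] ⊢ absurd)
    ((1 , fwd 0 1 [] ∷ fwd 1 1 [] ∷ bwd 2 1 [] ∷ fwd 3 1 [] ∷ []) ∷ [])
  box-above = certify 5 (λ m u v p q → m :≤ u :+ v ∷ u :< p ∷ v :< q ∷ [] ⊢ m :≤ p :+ q)
    ((1 , fwd 0 1 [] ∷ fwd 1 1 [] ∷ fwd 2 1 [] ∷ []) ∷ [])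
  box-below = certify 7 (λ m u v l p q s → u :+ v :+ 2 · l :≤ m :+ m ∷ p :≤ u :+ l ∷ q :≤ v :+ l ∷ m :≤ s ∷ []
      ⊢ p :+ q :≤ m :+ s)
    ((1 , fwd 0 1 [] ∷ fwd 1 1 [] ∷ fwd 2 1 [] ∷ fwd 3 1 [] ∷ []) ∷ [])

  transpose : ∀ {X Y} → SumFreeSet X Y → SumFreeSet Y X
  transpose {X} {Y} S = record
    { pts = map swap (pts S)
    ; pts-unique = unique-map swap (pts-unique S) (λ _ _ e → cong swap e)
    ; pts-inBox = inBox
    ; pts-sumFree = sumFree
    }
    where
    old : ∀ {p} → p ∈ map swap (pts S) → swap p ∈ pts S
    old p∈ with ∈-map⁻ swap p∈
    ... | _ , q∈ , refl = q∈
    inBox : ∀ {p} → p ∈ map swap (pts S) → Box Y X p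
    inBox p∈ = swap (pts-inBox S (old p∈))
    sumFree : ∀ {x y} → x ∈ map swap (pts S) → y ∈ map swap (pts S) → x ⊹ y ∉ map swap (pts S)
    sumFree x∈ y∈ s∈ = pts-sumFree S (old x∈) (old y∈) (old s∈)

  ∈-transpose : ∀ {X Y} (S : SumFreeSet X Y) {p} → p ∈ pts S → swap p ∈ pts (transpose S)
  ∈-transpose S = ∈-map⁺ swap

  ∈-transpose⁻ : ∀ {X Y} (S : SumFreeSet X Y) {p} → p ∈ pts (transpose S) → swap p ∈ pts S
  ∈-transpose⁻ S p∈ with ∈-map⁻ swap p∈
  ... | _ , q∈ , refl = q∈

  -- Lengths are measured against k ≈ n / 20; η bounds all the initial errors, and m = 16k − η.
  record Setup {n : ℕ} (S : SumFreeSet n n) (k η m : ℕ) : Set where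
    field
      20k≤n : 20 * k ≤ n
      n≤20k+η : n ≤ 20 * k + η
      m-def : m + η ≡ 16 * k
      sums : ∀ {p} → p ∈ pts S → m ≤ proj₁ p + proj₂ p
      near : n * n * 3 ≤ size S * 5 + k * η
      2≤η : 2 ≤ η
      100η≤k : η * 100 ≤ k

  transposed : ∀ {n} {S : SumFreeSet n n} {k η m} → Setup S k η m → Setup (transpose S) k η m
  transposed {n} {S} {k} {η} {m} setup = record
    { 20k≤n = 20k≤n ; n≤20k+η = n≤20k+η ; m-def = m-def
    ; sums = λ {p} p∈ → subst (m ≤_) (+-comm (proj₂ p) (proj₁ p)) (sums (∈-transpose⁻ S p∈))
    ; near = subst (λ z → n * n * 3 ≤ z * 5 + k * η) (sym (length-map swap (pts S))) near
    ; 2≤η = 2≤η ; 100η≤k = 100η≤k }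
    where open Setup setup

  module Filling {n} (S : SumFreeSet n n) {k η m : ℕ} (setup : Setup S k η m) where

    open Setup setup
    open Gaps S

    above : ∀ {p} → p ∈ pts S → m ≤ lin 1 1 p
    above {p} p∈ = subst (m ≤_) (sym (unit-sum (proj₁ p) (proj₂ p))) (sums p∈)

    m≤n : m ≤ 1 * n
    m≤n = fill-m m η k n m-def 20k≤n

    e : ℕ
    e = m ∸ 2
    e-def : e + 2 ≡ m
    e-def = m∸n+n≡m (fill-m₂ m η k m-def 100η≤k 2≤η)

    box-inside : ∀ {u v l p} → u + l ≤ n → v + l ≤ n → p ∈ gaps (box u v l) → Box n n p
    box-inside {u} {v} {l} hu hv q with ∈-box⁻ {u} {v} {l} (proj₁ (∈-gaps {box u v l} q))
    ... | (a , b) , (c , d) = (≤-trans (s≤s z≤n) a , ≤-trans b hu) , (≤-trans (s≤s z≤n) c , ≤-trans d hv)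

    -- By `far`, translation by (t , r) carries the small box out of the grid, so the box is not
    -- matched and its gaps count as additional missing points. That both coordinates are at least
    -- 4k - κ keeps the corner triangle inside the box up to an overflow of κ + 2η at two of its
    -- sides; the third overflow is 0.
    fill : ∀ {t r} ξ κ → (t , r) ∈ pts S → t + r ≤ 16 * k + ξ → 4 * k ≤ t + κ → 4 * k ≤ r + κ → η ≤ ξ → ξ ≤ k →
      ∀ u v l → u + l ≤ n → v + l ≤ n → m ≤ u + v → u + v + 2 * l ≤ m + m → n ≤ u + t ⊎ n ≤ v + r →
      length (gaps (box u v l)) ≤ k * ξ * 60 + (κ + 4 * η) * (κ + 4 * η)
    fill {t} {r} ξ κ a∈ low t≥ r≥ η≤ξ ξ≤k u v l hu hv hm hl far = fill-count (size S) (length D) n (length (tri 1 1 e)) (length (tri 1 1 w)) (length (tri 1 1 (κ + 2 * η)))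
        (length (tri 1 1 (κ + 2 * η))) e m w κ η ξ k
        (Single.bound S 1 1 m (t + r) w e (κ + 2 * η) (κ + 2 * η) 0 ≤-refl ≤-refl above m≤n m≤n a∈ X≡ Y≡ (unit-sum t r)
          (fill-range t r (n ∸ t) (n ∸ r) n m w X≡ Y≡ w-def) (≤-reflexive e-def)
          (fill-v t r (n ∸ t) n m w k η κ X≡ w-def n≤20k+η m-def r≥)
          (fill-v r t (n ∸ r) n m w k η κ Y≡ (trans (cong (λ s → m + s + w) (+-comm r t)) w-def) n≤20k+η m-def t≥)
          (fill-v₃ t r n m w k η w-def n≤20k+η m-def (sums a∈) 100η≤k)
          D (gaps-unique u v l) (box-inside {u} {v} {l} hu hv) (λ q → proj₂ (∈-gaps {box u v l} q)) D-above D-below D-far)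
        (tri-lower 1 1 e ≤-refl ≤-refl) (tri-lower 1 1 w ≤-refl ≤-refl)
        (tri-upper 1 1 (κ + 2 * η) ≤-refl ≤-refl) (tri-upper 1 1 (κ + 2 * η) ≤-refl ≤-refl)
        e-def m-def (fill-narrow t r n m w k η ξ w-def 20k≤n m-def low) near n≤20k+η 2≤η η≤ξ 100η≤k ξ≤k
      where
      w-exists : ∃[ w ] m + (t + r) + w ≡ 2 * n
      w-exists = m≤n⇒∃[o]m+o≡n (fill-w m (t + r) n k η ξ low m-def 20k≤n ξ≤k)
      w : ℕ
      w = proj₁ w-exists
      w-def : m + (t + r) + w ≡ 2 * n
      w-def = proj₂ w-exists
      D : List Pt
      D = gaps (box u v l)
      X≡ : n ≡ t + (n ∸ t)
      X≡ = sym (m+[n∸m]≡n (proj₂ (proj₁ (pts-inBox S a∈))))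
      Y≡ : n ≡ r + (n ∸ r)
      Y≡ = sym (m+[n∸m]≡n (proj₂ (proj₂ (pts-inBox S a∈))))
      position : ∀ {p} → p ∈ D → InBox u v l p
      position q = ∈-box⁻ {u} {v} {l} (proj₁ (∈-gaps {box u v l} q))
      D-above : ∀ {p} → p ∈ D → m ≤ lin 1 1 p
      D-above {p} q = let (a , _) , (b , _) = position q in
        subst (m ≤_) (sym (unit-sum (proj₁ p) (proj₂ p))) (box-above m u v (proj₁ p) (proj₂ p) hm a b)
      D-below : ∀ {p} → p ∈ D → lin 1 1 p ≤ m + (t + r)
      D-below {p} q = let (_ , a) , (_ , b) = position q in
        subst (_≤ m + (t + r)) (sym (unit-sum (proj₁ p) (proj₂ p))) (box-below m u v l (proj₁ p) (proj₂ p) (t + r) hl a b (sums a∈))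
      D-far : ∀ {p} → p ∈ D → ¬ Small (n ∸ t) (n ∸ r) p
      D-far {p} q (s₁ , s₂) = go far
        where
        go : n ≤ u + t ⊎ n ≤ v + r → ⊥
        go (inj₁ h) = far-first n u t (proj₁ p) (n ∸ t) h (proj₁ (proj₁ (position q))) X≡ s₁
        go (inj₂ h) = far-first n v r (proj₂ p) (n ∸ r) h (proj₁ (proj₂ (position q))) Y≡ s₂

    pick : ∀ {t r} ξ κ → (t , r) ∈ pts S → t + r ≤ 16 * k + ξ → 4 * k ≤ t + κ → 4 * k ≤ r + κ → η ≤ ξ → ξ ≤ k →
      ∀ u v l → u + l ≤ n → v + l ≤ n → m ≤ u + v → u + v + 2 * l ≤ m + m → n ≤ u + t ⊎ n ≤ v + r →
      k * ξ * 60 + (κ + 4 * η) * (κ + 4 * η) < l * l → ∃[ p ] (p ∈ pts S × InBox u v l p)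
    pick ξ κ a∈ low t≥ r≥ η≤ξ ξ≤k u v l hu hv hm hl far big with found-or-gaps u v l
    ... | inj₁ found = found
    ... | inj₂ many = ⊥-elim (<⇒≱ big (≤-trans many (fill ξ κ a∈ low t≥ r≥ η≤ξ ξ≤k u v l hu hv hm hl far)))

  -- Mirror-image boxes

  -- A box is shown to have at most about k times the preceding length many gaps, so its side must
  -- exceed the square root of this before an element is certain to lie in it.
  record Scales (k η κ l₂ l₄ l₅ : ℕ) : Set where
    field
      κ-large : k * η * 60 ≤ κ * κ
      l₂-large : k * κ * 1000 ≤ l₂ * l₂
      l₄-large : k * l₂ * 1000 ≤ l₄ * l₄
      l₅-large : k * l₄ * 1000 ≤ l₅ * l₅
      η≪κ : η * 100 ≤ κ
      κ≪l₂ : κ * 100 ≤ l₂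
      l₂≪l₄ : l₂ * 100 ≤ l₄
      l₄≪l₅ : l₄ * 100 ≤ l₅
      l₅≪k : l₅ * 100 ≤ k

  chain = certify 3 (λ a b c → a :* con 100 :≤ b ∷ b :* con 100 :≤ c ∷ [] ⊢ a :* con 100 :≤ c)
    ((100 , fwd 0 100 [] ∷ fwd 1 1 [] ∷ []) ∷ [])
  halve = certify 3 (λ t r m → t :≤ r ∷ m :≤ t :+ r ∷ [] ⊢ m :≤ 2 · r)
    ((1 , fwd 0 1 [] ∷ fwd 1 1 [] ∷ []) ∷ [])
  left-far = certify 5 (λ n k η m r → n :≤ 20 · k :+ η ∷ m :+ η :≡ 16 · k ∷ m :≤ 2 · r ∷ []
      ⊢ n :≤ 12 · k :+ 2 · η :+ r)
    ((2 , fwd 0 2 [] ∷ bwd 1 1 [] ∷ fwd 2 1 [] ∷ []) ∷ [])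
  left-u = certify 4 (λ n k η κ → 20 · k :≤ n ∷ κ :* con 100 :≤ k ∷ [] ⊢ 4 · k :+ 4 · κ :≤ n)
    ((500 , fwd 0 101 [] ∷ fwd 1 20 [] ∷ []) ∷ [])
  left-v = certify 4 (λ n k η κ → 20 · k :≤ n ∷ κ :* con 100 :≤ k ∷ η :* con 100 :≤ k ∷ []
      ⊢ 12 · k :+ 2 · η :+ 4 · κ :≤ n)
    ((1000 , fwd 0 603 [] ∷ fwd 1 40 [] ∷ fwd 2 20 [] ∷ []) ∷ [])
  left-m = certify 3 (λ m k η → m :+ η :≡ 16 · k ∷ [] ⊢ m :≤ 4 · k :+ (12 · k :+ 2 · η))
    ((1 , fwd 0 1 [] ∷ []) ∷ [])
  left-l = certify 4 (λ m k η κ → m :+ η :≡ 16 · k ∷ κ :* con 100 :≤ k ∷ η :* con 100 :≤ k ∷ []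
      ⊢ 4 · k :+ (12 · k :+ 2 · η) :+ 2 · (4 · κ) :≤ m :+ m)
    ((39975 , bwd 0 40250 [] ∷ fwd 1 3198 [] ∷ fwd 2 1202 [] ∷ []) ∷ [])
  left-sum = certify 5 (λ k η κ t r → t :≤ 4 · k :+ 4 · κ ∷ r :≤ 12 · k :+ 2 · η :+ 4 · κ ∷ []
      ⊢ t :+ r :≤ 16 · k :+ (2 · η :+ 8 · κ))
    ((1 , fwd 0 1 [] ∷ fwd 1 1 [] ∷ []) ∷ [])
  left-t = certify 2 (λ k t → 4 · k :< t ∷ [] ⊢ 4 · k :≤ t :+ con 0)
    ((1 , fwd 0 1 [] ∷ []) ∷ [])
  left-r = certify 3 (λ k η r → 12 · k :+ 2 · η :< r ∷ [] ⊢ 4 · k :≤ r :+ con 0)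
    ((3 , fwd 0 1 [] ∷ []) ∷ [])
  left-ξ = certify 2 (λ η κ → [] ⊢ η :≤ 2 · η :+ 8 · κ)
    ((1 , []) ∷ [])
  left-ξk = certify 3 (λ η κ k → η :* con 100 :≤ κ ∷ κ :* con 100 :≤ k ∷ [] ⊢ 2 · η :+ 8 · κ :≤ k)
    ((5000 , fwd 0 100 [] ∷ fwd 1 401 [] ∷ []) ∷ [])
  centre-u = certify 3 (λ n k l → 20 · k :≤ n ∷ l :* con 100 :≤ k ∷ [] ⊢ 8 · k :+ l :≤ n)
    ((2000 , fwd 0 801 [] ∷ fwd 1 20 [] ∷ []) ∷ [])
  centre-m = certify 3 (λ m k η → m :+ η :≡ 16 · k ∷ [] ⊢ m :≤ 8 · k :+ 8 · k)
    ((1 , fwd 0 1 [] ∷ []) ∷ [])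
  centre-l = certify 4 (λ m k η l → m :+ η :≡ 16 · k ∷ l :* con 100 :≤ k ∷ η :* con 100 :≤ k ∷ []
      ⊢ 8 · k :+ 8 · k :+ 2 · l :≤ m :+ m)
    ((50 , bwd 0 100 [] ∷ fwd 1 1 [] ∷ fwd 2 1 [] ∷ []) ∷ [])
  centre-far = certify 4 (λ n k η r → n :≤ 20 · k :+ η ∷ 12 · k :+ 2 · η :< r ∷ [] ⊢ n :≤ 8 · k :+ r)
    ((1 , fwd 0 1 [] ∷ fwd 1 1 [] ∷ []) ∷ [])
  centre-big = certify 4 (λ k η κ l → k :* κ :* con 1000 :≤ l :* l ∷ η :* con 100 :≤ κ ∷ κ :* con 100 :≤ k ∷ []
      ⊢ k :* (2 · η :+ 8 · κ) :* con 60 :+ (con 0 :+ 4 · η) :* (con 0 :+ 4 · η) :+ κ :* κ :≤ l :* l)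
    ((31250000 , fwd 0 15037813 [] ∷ fwd 1 37500000 (0 ∷ []) ∷ fwd 1 5000000 (1 ∷ []) ∷ fwd 1 50000 (2 ∷ []) ∷
     fwd 2 313000 (2 ∷ []) ∷ []) ∷ [])
  pair-a = certify 8 (λ k η κ t r m p n → t :+ κ :< 4 · k ∷ m :≤ t :+ r ∷ m :+ η :≡ 16 · k ∷ n :≤ 20 · k :+ η ∷
      8 · k :< p ∷ η :* con 100 :≤ κ ∷ p :+ r :≤ n ∷ [] ⊢ absurd)
    ((100 , fwd 0 50 [] ∷ fwd 1 50 [] ∷ bwd 2 50 [] ∷ fwd 3 50 [] ∷ fwd 4 50 [] ∷ fwd 5 1 [] ∷ fwd 6 50 [] ∷ []) ∷
     [])
  pair-d = certify 7 (λ k η κ t s m x → t :+ κ :< 4 · k ∷ s :+ κ :< 4 · k ∷ m :≤ x :+ s ∷ m :+ η :≡ 16 · k ∷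
      η :* con 100 :≤ κ ∷ [] ⊢ t :≤ x)
    ((300 , fwd 0 300 [] ∷ fwd 1 100 [] ∷ fwd 2 100 [] ∷ bwd 3 100 [] ∷ fwd 4 1 [] ∷ []) ∷ [])
  pair-w = certify 5 (λ k η n A B → 20 · k :≤ n ∷ A :≤ 16 · k :+ η ∷ B :≤ 16 · k :+ η ∷ η :* con 100 :≤ k ∷ []
      ⊢ A :+ B :≤ 2 · n)
    ((1000 , fwd 0 1601 [] ∷ fwd 1 1000 [] ∷ fwd 2 1000 [] ∷ fwd 3 20 [] ∷ []) ∷ [])
  pair-range = certify 4 (λ n A B w → A :+ B :+ w :≡ 2 · n ∷ [] ⊢ 1 · n :+ 1 · n :≡ A :+ B :+ w)
    ((1 , bwd 0 1 [] ∷ []) ∷ (1 , fwd 0 1 [] ∷ []) ∷ [])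
  pair-steep = certify 9 (λ k η κ n m A t d s → m :≤ A ∷ m :≤ t :+ d :+ s ∷ s :+ κ :< 4 · k ∷ m :+ η :≡ 16 · k ∷
      n :≤ 20 · k :+ η ∷ η :* con 100 :≤ κ ∷ [] ⊢ 1 · n :≤ A :+ 1 · (t :+ d))
    ((300 , fwd 0 300 [] ∷ fwd 1 100 [] ∷ fwd 2 100 [] ∷ bwd 3 400 [] ∷ fwd 4 300 [] ∷ fwd 5 7 [] ∷ []) ∷ [])
  pair-v₁ = certify 11 (λ k η κ n m A B w t d s → A :+ B :+ w :≡ 2 · n ∷ n :≤ 20 · k :+ η ∷ m :+ η :≡ 16 · k ∷
      m :≤ A ∷ m :≤ B ∷ m :≤ t :+ d :+ s ∷ t :+ κ :< 4 · k ∷ s :+ κ :< 4 · k ∷ η :* con 100 :≤ κ ∷ []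
      ⊢ w :≤ 1 · d :+ con 0)
    ((20 , fwd 0 20 [] ∷ fwd 1 40 [] ∷ bwd 2 60 [] ∷ fwd 3 20 [] ∷ fwd 4 20 [] ∷ fwd 5 20 [] ∷ fwd 6 20 [] ∷
     fwd 7 20 [] ∷ fwd 8 1 [] ∷ []) ∷ [])
  pair-v₂ = certify 7 (λ k η n m A B w → A :+ B :+ w :≡ 2 · n ∷ n :≤ 20 · k :+ η ∷ m :+ η :≡ 16 · k ∷ m :≤ A ∷
      m :≤ B ∷ η :* con 100 :≤ k ∷ [] ⊢ w :≤ m :+ con 0)
    ((533 , fwd 0 533 [] ∷ fwd 1 1066 [] ∷ bwd 2 1334 [] ∷ fwd 3 268 [] ∷ fwd 4 533 [] ∷ fwd 5 24 [] ∷ []) ∷ [])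
  pair-narrow = certify 6 (λ k η n A B w → A :+ B :+ w :≡ 2 · n ∷ 20 · k :≤ n ∷ A :≤ 16 · k :+ η ∷
      B :≤ 16 · k :+ η ∷ [] ⊢ 8 · k :+ η :≤ w :+ 3 · η)
    ((1 , bwd 0 1 [] ∷ fwd 1 2 [] ∷ fwd 2 1 [] ∷ fwd 3 1 [] ∷ []) ∷ [])
  pair-count = certify 10 (λ N d n Te Tw m w e k η → N :+ (Te :+ d :+ Tw) :≤ n :* n :+ (con 0 :+ con 0) ∷
      e :* e :≤ 2 · (con 1 :* con 1 :* Te) ∷ w :* w :≤ 2 · (con 1 :* con 1 :* Tw) ∷ e :+ con 2 :≡ m ∷
      m :+ η :≡ 16 · k ∷ 8 · k :+ η :≤ w :+ 3 · η ∷ n :* n :* con 3 :≤ N :* con 5 :+ k :* η ∷ n :≤ 20 · k :+ η ∷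
      con 2 :≤ η ∷ η :* con 100 :≤ k ∷ [] ⊢ d :≤ k :* η :* con 180 :+ η :* η :* con 16)
    ((100 , fwd 0 100 [] ∷ fwd 1 50 [] ∷ fwd 2 50 [] ∷ fwd 3 100 [] ∷ fwd 4 200 [] ∷ fwd 6 20 [] ∷ bwd 3 50 (7 ∷
     []) ∷ bwd 3 50 (5 ∷ []) ∷ bwd 4 50 (5 ∷ []) ∷ bwd 4 800 (8 ∷ []) ∷ fwd 4 50 (9 ∷ []) ∷ fwd 5 50 (6 ∷ []) ∷
     fwd 5 399 (8 ∷ []) ∷ fwd 7 40 (2 ∷ []) ∷ fwd 7 800 (8 ∷ []) ∷ fwd 7 619 (9 ∷ []) ∷ fwd 8 1600 (8 ∷ []) ∷
     ff 5 9 1 ∷ []) ∷ [])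
  pair-big = certify 5 (λ k η κ l d → d :≤ k :* η :* con 180 :+ η :* η :* con 16 ∷ k :* κ :* con 1000 :≤ l :* l ∷
      η :* con 100 :≤ κ ∷ κ :* con 100 :≤ k ∷ [] ⊢ d :+ κ :* κ :≤ l :* l)
    ((31250000 , fwd 0 31250000 [] ∷ fwd 1 56563 [] ∷ fwd 2 56250000 (0 ∷ []) ∷ fwd 2 5000000 (1 ∷ []) ∷
     fwd 2 50000 (2 ∷ []) ∷ fwd 3 313000 (2 ∷ []) ∷ []) ∷ [])
  left-big = certify 3 (λ k η κ → k :* η :* con 60 :≤ κ :* κ ∷ η :* con 100 :≤ κ ∷ []
      ⊢ k :* η :* con 60 :+ (κ :+ 4 · η) :* (κ :+ 4 · η) :+ κ :* κ :≤ 4 · κ :* (4 · κ))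
    ((625 , fwd 0 625 [] ∷ fwd 1 51 (2 ∷ []) ∷ fwd 1 100 (1 ∷ []) ∷ []) ∷ [])

  strictly : ∀ {x y} z → 1 ≤ z → x + z * z ≤ y → x < y
  strictly {x} z 1≤z h = ≤-trans (m<m+n x (*-mono-≤ 1≤z 1≤z)) h

  module Centre {n} (S : SumFreeSet n n) {k η m κ l₂ l₄ l₅ : ℕ} (setup : Setup S k η m) (scales : Scales k η κ l₂ l₄ l₅) where

    open Setup setup
    open Scales scales
    open Gaps S
    open Filling S setup

    l₄≪k : l₄ * 100 ≤ k
    l₄≪k = chain l₄ l₅ k l₄≪l₅ l₅≪k
    l₂≪k : l₂ * 100 ≤ k
    l₂≪k = chain l₂ l₄ k l₂≪l₄ l₄≪k
    κ≪k : κ * 100 ≤ k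
    κ≪k = chain κ l₂ k κ≪l₂ l₂≪k
    1≤κ : 1 ≤ κ
    1≤κ = ≤-trans (≤-trans (s≤s z≤n) (≤-trans 2≤η (m≤m*n η 100))) η≪κ

    Central : Set
    Central = ∃[ p ] (p ∈ pts S × InBox (8 * k) (8 * k) l₂ p)

    -- The height of a is only known to be about 8k, too little to carry the central box out of the
    -- grid. It suffices for a box near (4k , 12k); an element found there has height above 12k and
    -- both coordinates above 4k, and so reaches the centre with no allowance κ.
    centre-left : ∀ {t r} → (t , r) ∈ pts S → t ≤ r → t + r ≤ 16 * k + η → 4 * k ≤ t + κ → Central
    centre-left {t} {r} a∈ t≤r low t≥ = second (pick η κ a∈ low t≥ (≤-trans t≥ (+-monoˡ-≤ κ t≤r)) ≤-refl
        (≤-trans (m≤m*n η 100) 100η≤k) (4 * k) (12 * k + 2 * η) (4 * κ)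
        (left-u n k η κ 20k≤n κ≪k) (left-v n k η κ 20k≤n κ≪k 100η≤k) (left-m m k η m-def) (left-l m k η κ m-def κ≪k 100η≤k)
        (inj₂ (left-far n k η m r n≤20k+η m-def (halve t r m t≤r (sums a∈)))) (strictly κ 1≤κ (left-big k η κ κ-large η≪κ)))
      where
      second : ∃[ p ] (p ∈ pts S × InBox (4 * k) (12 * k + 2 * η) (4 * κ) p) → Central
      second ((t′ , r′) , p∈ , ((t> , t≤) , (r> , r≤))) = pick (2 * η + 8 * κ) 0 p∈
        (left-sum k η κ t′ r′ t≤ r≤) (left-t k t′ t>) (left-r k η r′ r>) (left-ξ η κ) (left-ξk η κ k η≪κ κ≪k) (8 * k) (8 * k) l₂
        (centre-u n k l₂ 20k≤n l₂≪k) (centre-u n k l₂ 20k≤n l₂≪k) (centre-m m k η m-def) (centre-l m k η l₂ m-def l₂≪k 100η≤k)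
        (inj₂ (centre-far n k η r′ n≤20k+η r>)) (strictly κ 1≤κ (centre-big k η κ l₂ l₂-large η≪κ κ≪k))

    -- With a to the left of column 4k - κ and b below row 4k - κ, the horizontal distance d is at
    -- least w, so the whole corner triangle is matched through a or b without overflow. Both
    -- translations carry the central box out of the grid, so its gaps are free to be counted.
    centre-both′ : ∀ {t r d s} → (t , r) ∈ pts S → (t + d , s) ∈ pts S → t + r ≤ 16 * k + η → t + d + s ≤ 16 * k + η →
      t + κ < 4 * k → s + κ < 4 * k → Central
    centre-both′ {t} {r} {d} {s} a∈ b∈ a-low b-low t< s< = go (found-or-gaps (8 * k) (8 * k) l₂)
      where
      A B : ℕ
      A = t + r
      B = t + d + s
      m≤A : m ≤ A
      m≤A = sums a∈
      m≤B : m ≤ B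
      m≤B = sums b∈
      w-exists : ∃[ w ] A + B + w ≡ 2 * n
      w-exists = m≤n⇒∃[o]m+o≡n (pair-w k η n A B 20k≤n a-low b-low 100η≤k)
      w : ℕ
      w = proj₁ w-exists
      w-def : A + B + w ≡ 2 * n
      w-def = proj₂ w-exists
      D : List Pt
      D = gaps (box (8 * k) (8 * k) l₂)
      position : ∀ {p} → p ∈ D → InBox (8 * k) (8 * k) l₂ p
      position q = ∈-box⁻ {8 * k} {8 * k} {l₂} (proj₁ (∈-gaps {box (8 * k) (8 * k) l₂} q))
      D-above : ∀ {p} → p ∈ D → m ≤ lin 1 1 p
      D-above {p} q = let (a , _) , (b , _) = position q in
        subst (m ≤_) (sym (unit-sum (proj₁ p) (proj₂ p))) (box-above m (8 * k) (8 * k) (proj₁ p) (proj₂ p) (centre-m m k η m-def) a b)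
      D-below : ∀ {p} → p ∈ D → lin 1 1 p ≤ A + B
      D-below {p} q = let (_ , a) , (_ , b) = position q in
        subst (_≤ A + B) (sym (unit-sum (proj₁ p) (proj₂ p))) (≤-trans
          (box-below m (8 * k) (8 * k) l₂ (proj₁ p) (proj₂ p) B (centre-l m k η l₂ m-def l₂≪k 100η≤k) a b m≤B) (+-monoˡ-≤ B m≤A))
      D-far-a : ∀ {p} → p ∈ D → ¬ Box n n (p ⊹ (t , r))
      D-far-a {p} q (_ , (_ , p+r≤n)) = pair-a k η κ t r m (proj₂ p) n t< m≤A m-def n≤20k+η (proj₁ (proj₂ (position q))) η≪κ p+r≤n
      D-far-b : ∀ {p} → p ∈ D → ¬ Box n n (p ⊹ (t + d , s))
      D-far-b {p} q ((_ , p+b≤n) , _) = pair-a k η κ s (t + d) m (proj₁ p) n s< (subst (m ≤_) (+-comm (t + d) s) m≤B)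
        m-def n≤20k+η (proj₁ (proj₁ (position q))) η≪κ p+b≤n
      crowded : length D < l₂ * l₂
      crowded = strictly κ 1≤κ (pair-big k η κ l₂ (length D)
        (pair-count (size S) (length D) n (length (tri 1 1 e)) (length (tri 1 1 w)) m w e k η
          (Both.bound S 1 1 m A B w e 0 0 ≤-refl ≤-refl above m≤n m≤n a∈ b∈ (unit-sum t r) (unit-sum (t + d) s)
            (pair-range n A B w w-def) (pair-steep k η κ n m A t d s m≤A m≤B s< m-def n≤20k+η η≪κ) (≤-reflexive e-def)
            (pair-v₁ k η κ n m A B w t d s w-def n≤20k+η m-def m≤A m≤B m≤B t< s< η≪κ)
            (pair-v₂ k η n m A B w w-def n≤20k+η m-def m≤A m≤B 100η≤k)
            D (gaps-unique (8 * k) (8 * k) l₂) (box-inside {8 * k} {8 * k} {l₂} (centre-u n k l₂ 20k≤n l₂≪k) (centre-u n k l₂ 20k≤n l₂≪k))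
            (λ q → proj₂ (∈-gaps {box (8 * k) (8 * k) l₂} q)) D-above D-below D-far-a D-far-b)
          (tri-lower 1 1 e ≤-refl ≤-refl) (tri-lower 1 1 w ≤-refl ≤-refl) e-def m-def
          (pair-narrow k η n A B w w-def 20k≤n a-low b-low) near n≤20k+η 2≤η 100η≤k)
        l₂-large η≪κ κ≪k)
      go : Central ⊎ l₂ * l₂ ≤ length D → Central
      go (inj₁ found) = found
      go (inj₂ many) = ⊥-elim (<⇒≱ crowded many)

    centre-both : ∀ {t r x s} → (t , r) ∈ pts S → (x , s) ∈ pts S → t + r ≤ 16 * k + η → x + s ≤ 16 * k + η →
      t + κ < 4 * k → s + κ < 4 * k → Central
    centre-both {t} {r} {x} {s} a∈ b∈ a-low b-low t< s< = centre-both′ {d = x ∸ t} a∈ (subst (λ z → (z , s) ∈ pts S) x≡ b∈)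
        a-low (subst (λ z → z + s ≤ 16 * k + η) x≡ b-low) t< s<
      where
      x≡ : x ≡ t + (x ∸ t)
      x≡ = sym (m+[n∸m]≡n (pair-d k η κ t s m x t< s< (sums b∈) m-def η≪κ))

  -- Excluding elements of large coordinate sum

  side-u = certify 3 (λ n k l → 20 · k :≤ n ∷ l :* con 100 :≤ k ∷ [] ⊢ 4 · k :+ l :≤ n)
    ((2000 , fwd 0 401 [] ∷ fwd 1 20 [] ∷ []) ∷ [])
  side-v = certify 4 (λ n k η l → 20 · k :≤ n ∷ l :* con 100 :≤ k ∷ η :* con 100 :≤ k ∷ []
      ⊢ 12 · k :+ η :+ l :≤ n)
    ((1000 , fwd 0 601 [] ∷ fwd 1 10 [] ∷ fwd 2 10 [] ∷ []) ∷ [])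
  side-m = certify 3 (λ m k η → m :+ η :≡ 16 · k ∷ [] ⊢ m :≤ 4 · k :+ (12 · k :+ η))
    ((1 , fwd 0 1 [] ∷ []) ∷ [])
  side-l = certify 4 (λ m k η l → m :+ η :≡ 16 · k ∷ l :* con 100 :≤ k ∷ η :* con 100 :≤ k ∷ []
      ⊢ 4 · k :+ (12 · k :+ η) :+ 2 · l :≤ m :+ m)
    ((100 , bwd 0 200 [] ∷ fwd 1 2 [] ∷ fwd 2 3 [] ∷ []) ∷ [])
  side-far = certify 4 (λ n k η r → n :≤ 20 · k :+ η ∷ 8 · k :< r ∷ [] ⊢ n :≤ 12 · k :+ η :+ r)
    ((1 , fwd 0 1 [] ∷ fwd 1 1 [] ∷ []) ∷ [])
  side-big = certify 4 (λ k η l₂ l₄ → k :* l₂ :* con 1000 :≤ l₄ :* l₄ ∷ η :* con 100 :≤ l₂ ∷ l₂ :* con 100 :≤ k ∷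
      [] ⊢ k :* (2 · l₂) :* con 60 :+ (con 0 :+ 4 · η) :* (con 0 :+ 4 · η) :+ l₂ :* l₂ :≤ l₄ :* l₄)
    ((31250000 , fwd 0 3750313 [] ∷ fwd 1 5000000 (1 ∷ []) ∷ fwd 1 50000 (2 ∷ []) ∷ fwd 2 313000 (2 ∷ []) ∷ []) ∷
     [])
  central-sum = certify 4 (λ k l t r → t :≤ 8 · k :+ l ∷ r :≤ 8 · k :+ l ∷ [] ⊢ t :+ r :≤ 16 · k :+ 2 · l)
    ((1 , fwd 0 1 [] ∷ fwd 1 1 [] ∷ []) ∷ [])
  central-coord = certify 2 (λ k t → 8 · k :< t ∷ [] ⊢ 4 · k :≤ t :+ con 0)
    ((2 , fwd 0 1 [] ∷ []) ∷ [])
  side-coord = certify 3 (λ k η r → 12 · k :+ η :< r ∷ [] ⊢ 4 · k :≤ r :+ con 0)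
    ((3 , fwd 0 1 [] ∷ []) ∷ [])
  side-sum = certify 5 (λ k η l t r → t :≤ 4 · k :+ l ∷ r :≤ 12 · k :+ η :+ l ∷ []
      ⊢ t :+ r :≤ 16 · k :+ (η :+ 2 · l))
    ((1 , fwd 0 1 [] ∷ fwd 1 1 [] ∷ []) ∷ [])
  twice-ξ = certify 2 (λ η l → η :* con 100 :≤ l ∷ [] ⊢ η :≤ 2 · l)
    ((100 , fwd 0 1 [] ∷ []) ∷ [])
  twice-ξk = certify 2 (λ l k → l :* con 100 :≤ k ∷ [] ⊢ 2 · l :≤ k)
    ((50 , fwd 0 1 [] ∷ []) ∷ [])
  plus-ξ = certify 2 (λ η l → [] ⊢ η :≤ η :+ 2 · l)
    ((1 , []) ∷ [])
  plus-ξk = certify 3 (λ η l k → η :* con 100 :≤ l ∷ l :* con 100 :≤ k ∷ [] ⊢ η :+ 2 · l :≤ k)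
    ((10000 , fwd 0 100 [] ∷ fwd 1 201 [] ∷ []) ∷ [])

  mirror-lower = certify 6 (λ u u′ l z p q → u :+ u′ :+ l :+ con 1 :≡ z ∷ p :≤ u :+ l ∷ p :+ q :≡ z ∷ []
      ⊢ u′ :< q)
    ((1 , fwd 0 1 [] ∷ fwd 1 1 [] ∷ bwd 2 1 [] ∷ []) ∷ [])
  mirror-upper = certify 6 (λ u u′ l z p q → u :+ u′ :+ l :+ con 1 :≡ z ∷ u :< p ∷ p :+ q :≡ z ∷ []
      ⊢ q :≤ u′ :+ l)
    ((1 , bwd 0 1 [] ∷ fwd 1 1 [] ∷ fwd 2 1 [] ∷ []) ∷ [])
  mirror-reach = certify 5 (λ u u′ l z p → u :+ u′ :+ l :+ con 1 :≡ z ∷ p :≤ u :+ l ∷ [] ⊢ p :≤ z)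
    ((1 , fwd 0 1 [] ∷ fwd 1 1 [] ∷ []) ∷ [])
  mirror-count = certify 5 (λ L i g g′ B → L :≡ i :+ g ∷ i :≤ g′ ∷ g :≤ B ∷ g′ :≤ B ∷ [] ⊢ L :≤ 2 · B)
    ((1 , fwd 0 1 [] ∷ fwd 1 1 [] ∷ fwd 2 1 [] ∷ fwd 3 1 [] ∷ []) ∷ [])

  -- If z ∈ S then w and z − w are not both in S, so mirror-image boxes cannot both be nearly full.
  mirror : ∀ {n} (S : SumFreeSet n n) {z₁ z₂} u v u′ v′ l B → (z₁ , z₂) ∈ pts S → u + u′ + l + 1 ≡ z₁ → v + v′ + l + 1 ≡ z₂ →
    length (Gaps.gaps S (box u v l)) ≤ B → length (Gaps.gaps S (box u′ v′ l)) ≤ B → l * l ≤ 2 * B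
  mirror S {z₁} {z₂} u v u′ v′ l B z∈ e₁ e₂ g≤ g′≤ =
    mirror-count (l * l) (length full) (length (gaps (box u v l))) (length (gaps (box u′ v′ l))) B
      (trans (sym (length-box u v l)) (length-filter-split in? (box u v l))) reflect g≤ g′≤
    where
    open Gaps S
    full : List Pt
    full = filter in? (box u v l)
    ∈-full : ∀ {p} → p ∈ full → InBox u v l p × p ∈ pts S
    ∈-full q = let h , p∈ = ∈-filter⁻ in? {xs = box u v l} q in ∈-box⁻ {u} {v} {l} h , p∈
    reach₁ : ∀ {p} → p ∈ full → proj₁ p ≤ z₁
    reach₁ {p} q = mirror-reach u u′ l z₁ (proj₁ p) e₁ (proj₂ (proj₁ (proj₁ (∈-full q))))
    reach₂ : ∀ {p} → p ∈ full → proj₂ p ≤ z₂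
    reach₂ {p} q = mirror-reach v v′ l z₂ (proj₂ p) e₂ (proj₂ (proj₂ (proj₁ (∈-full q))))
    image : Pt → Pt
    image p = z₁ ∸ proj₁ p , z₂ ∸ proj₂ p
    into : ∀ {p} → p ∈ full → image p ∈ gaps (box u′ v′ l)
    into {p} q = ∈-filter⁺ (¬? ∘ in?)
      (∈-box⁺ {u′} {v′} {l}
        ((mirror-lower u u′ l z₁ (proj₁ p) _ e₁ (proj₂ (proj₁ inside)) eq₁ , mirror-upper u u′ l z₁ (proj₁ p) _ e₁ (proj₁ (proj₁ inside)) eq₁) ,
         (mirror-lower v v′ l z₂ (proj₂ p) _ e₂ (proj₂ (proj₂ inside)) eq₂ , mirror-upper v v′ l z₂ (proj₂ p) _ e₂ (proj₁ (proj₂ inside)) eq₂)))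
      (λ h → pts-sumFree S (proj₂ (∈-full q)) h (subst (_∈ pts S) (cong₂ _,_ (sym eq₁) (sym eq₂)) z∈))
      where
      inside : InBox u v l p
      inside = proj₁ (∈-full q)
      eq₁ : proj₁ p + (z₁ ∸ proj₁ p) ≡ z₁
      eq₁ = m+[n∸m]≡n (reach₁ q)
      eq₂ : proj₂ p + (z₂ ∸ proj₂ p) ≡ z₂
      eq₂ = m+[n∸m]≡n (reach₂ q)
    reflect : length full ≤ length (gaps (box u′ v′ l))
    reflect = length-≤-injection image (Unique.filter⁺ in? (box-unique u v l)) into
      (λ p q e → cong₂ _,_ (∸-cancelˡ-≡ (reach₁ p) (reach₁ q) (cong proj₁ e)) (∸-cancelˡ-≡ (reach₂ p) (reach₂ q) (cong proj₂ e)))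

  high-z₂ = certify 4 (λ k l z₁ z₂ → z₁ :≤ z₂ ∷ 32 · k :+ 4 · l :≤ z₁ :+ z₂ ∷ [] ⊢ 16 · k :+ 2 · l :≤ z₂)
    ((2 , fwd 0 1 [] ∷ fwd 1 1 [] ∷ []) ∷ [])
  open-u = certify 3 (λ k l z → 14 · k :≤ z ∷ l :* con 100 :≤ k ∷ con 1 :≤ l ∷ [] ⊢ k :+ l :+ con 1 :≤ z)
    ((50 , fwd 0 50 [] ∷ fwd 1 1 [] ∷ fwd 2 50 [] ∷ []) ∷ [])
  open-v = certify 3 (λ k l z → 16 · k :+ 2 · l :≤ z ∷ l :* con 100 :≤ k ∷ con 1 :≤ l ∷ []
      ⊢ 15 · k :+ l :+ con 1 :≤ z)
    ((1 , fwd 0 1 [] ∷ fwd 2 1 [] ∷ []) ∷ [])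
  wide-u = certify 3 (λ k n l → 20 · k :≤ n ∷ l :* con 100 :≤ k ∷ [] ⊢ k :+ l :≤ n)
    ((2000 , fwd 0 101 [] ∷ fwd 1 20 [] ∷ []) ∷ [])
  wide-v = certify 3 (λ k n l → 20 · k :≤ n ∷ l :* con 100 :≤ k ∷ [] ⊢ 15 · k :+ l :≤ n)
    ((2000 , fwd 0 1501 [] ∷ fwd 1 20 [] ∷ []) ∷ [])
  wide-m = certify 3 (λ k η m → m :+ η :≡ 16 · k ∷ [] ⊢ m :≤ k :+ 15 · k)
    ((1 , fwd 0 1 [] ∷ []) ∷ [])
  wide-l = certify 4 (λ k η m l → m :+ η :≡ 16 · k ∷ l :* con 100 :≤ k ∷ η :* con 100 :≤ k ∷ []
      ⊢ k :+ 15 · k :+ 2 · l :≤ m :+ m)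
    ((50 , bwd 0 100 [] ∷ fwd 1 1 [] ∷ fwd 2 1 [] ∷ []) ∷ [])
  wide-far = certify 4 (λ k η n r → n :≤ 20 · k :+ η ∷ 8 · k :< r ∷ η :* con 100 :≤ k ∷ [] ⊢ n :≤ 15 · k :+ r)
    ((800 , fwd 0 800 [] ∷ fwd 1 501 [] ∷ fwd 2 8 [] ∷ []) ∷ [])
  image-u = certify 5 (λ u u′ l z n → u :+ u′ :+ l :+ con 1 :≡ z ∷ z :≤ n ∷ [] ⊢ u′ :+ l :≤ n)
    ((1 , fwd 0 1 [] ∷ fwd 1 1 [] ∷ []) ∷ [])
  wide-image-m = certify 8 (λ k η m l u v z₁ z₂ → m :+ η :≡ 16 · k ∷ k :+ u :+ l :+ con 1 :≡ z₁ ∷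
      15 · k :+ v :+ l :+ con 1 :≡ z₂ ∷ 32 · k :+ 4 · l :≤ z₁ :+ z₂ ∷ con 1 :≤ l ∷ [] ⊢ m :≤ u :+ v)
    ((1 , fwd 0 1 [] ∷ bwd 1 1 [] ∷ bwd 2 1 [] ∷ fwd 3 1 [] ∷ fwd 4 2 [] ∷ []) ∷ [])
  wide-image-l = certify 9 (λ k η m l u v z₁ z₂ n → m :+ η :≡ 16 · k ∷ k :+ u :+ l :+ con 1 :≡ z₁ ∷
      15 · k :+ v :+ l :+ con 1 :≡ z₂ ∷ z₁ :≤ n ∷ z₂ :≤ n ∷ n :≤ 20 · k :+ η ∷ η :* con 100 :≤ k ∷ []
      ⊢ u :+ v :+ 2 · l :≤ m :+ m)
    ((1599 , bwd 0 2402 [] ∷ fwd 1 1599 [] ∷ fwd 2 1599 [] ∷ fwd 3 1599 [] ∷ fwd 4 1599 [] ∷ fwd 5 3198 [] ∷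
     fwd 6 56 [] ∷ []) ∷ [])
  half-of = certify 2 (λ a b → a :* con 100 :≤ b ∷ [] ⊢ 2 · a :≤ b)
    ((50 , fwd 0 1 [] ∷ []) ∷ [])
  wide-image-far = certify 7 (λ k η l u z n t → k :+ u :+ l :+ con 1 :≡ z ∷ 14 · k :≤ z ∷ n :≤ 20 · k :+ η ∷
      8 · k :< t ∷ 2 · l :≤ k ∷ 2 · η :≤ k ∷ [] ⊢ n :≤ u :+ t)
    ((2 , bwd 0 2 [] ∷ fwd 1 2 [] ∷ fwd 2 2 [] ∷ fwd 3 2 [] ∷ fwd 4 1 [] ∷ fwd 5 1 [] ∷ []) ∷ [])
  tall-z₂ = certify 4 (λ k l z₁ z₂ → z₁ :< 14 · k ∷ 32 · k :+ 4 · l :≤ z₁ :+ z₂ ∷ [] ⊢ 18 · k :≤ z₂)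
    ((1 , fwd 0 1 [] ∷ fwd 1 1 [] ∷ []) ∷ [])
  tall-z₁ = certify 6 (λ k η l z₁ z₂ n → 32 · k :+ 4 · l :≤ z₁ :+ z₂ ∷ z₂ :≤ n ∷ n :≤ 20 · k :+ η ∷
      η :* con 100 :≤ k ∷ [] ⊢ 11 · k :≤ z₁)
    ((109 , fwd 0 100 [] ∷ fwd 1 100 [] ∷ fwd 2 100 [] ∷ fwd 3 1 [] ∷ []) ∷ [])
  tall-open-u = certify 3 (λ k l z → 11 · k :≤ z ∷ l :* con 100 :≤ k ∷ con 1 :≤ l ∷ [] ⊢ 7 · k :+ l :+ con 1 :≤ z)
    ((50 , fwd 0 50 [] ∷ fwd 1 1 [] ∷ fwd 2 50 [] ∷ []) ∷ [])
  tall-open-v = certify 3 (λ k l z → 18 · k :≤ z ∷ l :* con 100 :≤ k ∷ con 1 :≤ l ∷ [] ⊢ 9 · k :+ l :+ con 1 :≤ z)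
    ((50 , fwd 0 50 [] ∷ fwd 1 1 [] ∷ fwd 2 50 [] ∷ []) ∷ [])
  tall-u = certify 3 (λ k n l → 20 · k :≤ n ∷ l :* con 100 :≤ k ∷ [] ⊢ 7 · k :+ l :≤ n)
    ((2000 , fwd 0 701 [] ∷ fwd 1 20 [] ∷ []) ∷ [])
  tall-v = certify 3 (λ k n l → 20 · k :≤ n ∷ l :* con 100 :≤ k ∷ [] ⊢ 9 · k :+ l :≤ n)
    ((2000 , fwd 0 901 [] ∷ fwd 1 20 [] ∷ []) ∷ [])
  tall-m = certify 3 (λ k η m → m :+ η :≡ 16 · k ∷ [] ⊢ m :≤ 7 · k :+ 9 · k)
    ((1 , fwd 0 1 [] ∷ []) ∷ [])
  tall-l = certify 4 (λ k η m l → m :+ η :≡ 16 · k ∷ l :* con 100 :≤ k ∷ η :* con 100 :≤ k ∷ []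
      ⊢ 7 · k :+ 9 · k :+ 2 · l :≤ m :+ m)
    ((50 , bwd 0 100 [] ∷ fwd 1 1 [] ∷ fwd 2 1 [] ∷ []) ∷ [])
  tall-far = certify 4 (λ k η n r → n :≤ 20 · k :+ η ∷ 12 · k :+ η :< r ∷ [] ⊢ n :≤ 9 · k :+ r)
    ((1 , fwd 0 1 [] ∷ fwd 1 1 [] ∷ []) ∷ [])
  tall-image-m = certify 8 (λ k η m l u v z₁ z₂ → m :+ η :≡ 16 · k ∷ 7 · k :+ u :+ l :+ con 1 :≡ z₁ ∷
      9 · k :+ v :+ l :+ con 1 :≡ z₂ ∷ 32 · k :+ 4 · l :≤ z₁ :+ z₂ ∷ con 1 :≤ l ∷ [] ⊢ m :≤ u :+ v)
    ((1 , fwd 0 1 [] ∷ bwd 1 1 [] ∷ bwd 2 1 [] ∷ fwd 3 1 [] ∷ fwd 4 2 [] ∷ []) ∷ [])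
  tall-image-l = certify 9 (λ k η m l u v z₁ z₂ n → m :+ η :≡ 16 · k ∷ 7 · k :+ u :+ l :+ con 1 :≡ z₁ ∷
      9 · k :+ v :+ l :+ con 1 :≡ z₂ ∷ z₁ :≤ n ∷ z₂ :≤ n ∷ n :≤ 20 · k :+ η ∷ η :* con 100 :≤ k ∷ []
      ⊢ u :+ v :+ 2 · l :≤ m :+ m)
    ((1599 , bwd 0 2402 [] ∷ fwd 1 1599 [] ∷ fwd 2 1599 [] ∷ fwd 3 1599 [] ∷ fwd 4 1599 [] ∷ fwd 5 3198 [] ∷
     fwd 6 56 [] ∷ []) ∷ [])
  tall-image-far = certify 7 (λ k η l v z n r → 9 · k :+ v :+ l :+ con 1 :≡ z ∷ 18 · k :≤ z ∷ n :≤ 20 · k :+ η ∷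
      12 · k :+ η :< r ∷ l :* con 100 :≤ k ∷ con 1 :≤ l ∷ [] ⊢ n :≤ v :+ r)
    ((200 , bwd 0 200 [] ∷ fwd 1 189 [] ∷ fwd 2 200 [] ∷ fwd 3 200 [] ∷ fwd 4 2 [] ∷ []) ∷ [])
  wide-big = certify 5 (λ k η l₂ l₄ l₅ → k :* l₄ :* con 1000 :≤ l₅ :* l₅ ∷ η :* con 100 :≤ l₂ ∷
      l₂ :* con 100 :≤ k ∷ l₂ :* con 100 :≤ l₄ ∷ []
      ⊢ 2 · (k :* (2 · l₂) :* con 60 :+ (con 0 :+ 4 · η) :* (con 0 :+ 4 · η)) :+ l₂ :* l₂ :≤ l₅ :* l₅)
    ((6250000000 , fwd 0 15000627 [] ∷ fwd 1 2000000000 (1 ∷ []) ∷ fwd 1 20000000 (2 ∷ []) ∷ fwd 2 62700000 (2 ∷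
     []) ∷ fwd 3 15000627000 (0 ∷ []) ∷ []) ∷ [])
  tall-big = certify 4 (λ k η l₄ l₅ → k :* l₄ :* con 1000 :≤ l₅ :* l₅ ∷ η :* con 100 :≤ l₄ ∷ l₄ :* con 100 :≤ k ∷
      [] ⊢ 2 · (k :* (η :+ 2 · l₄) :* con 60 :+ (con 0 :+ 4 · η) :* (con 0 :+ 4 · η)) :+ l₄ :* l₄ :≤ l₅ :* l₅)
    ((62500000 , fwd 0 15075627 [] ∷ fwd 1 75000000 (0 ∷ []) ∷ fwd 1 20000000 (1 ∷ []) ∷ fwd 1 200000 (2 ∷ []) ∷
     fwd 2 627000 (2 ∷ []) ∷ []) ∷ [])

  reorder = certify 3 (λ u d l → [] ⊢ u :+ d :+ l :+ con 1 :≡ u :+ l :+ con 1 :+ d)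
    ((1 , []) ∷ (1 , []) ∷ [])

  module Upper {n} (S : SumFreeSet n n) {k η m κ l₂ l₄ l₅ : ℕ} (setup : Setup S k η m) (scales : Scales k η κ l₂ l₄ l₅) where

    open Setup setup
    open Scales scales
    open Filling S setup
    open Centre S setup scales using (Central; l₂≪k; l₄≪k; κ≪k; 1≤κ)

    η≪l₂ : η * 100 ≤ l₂
    η≪l₂ = chain η κ l₂ η≪κ κ≪l₂
    η≪l₄ : η * 100 ≤ l₄
    η≪l₄ = chain η l₂ l₄ η≪l₂ l₂≪l₄
    η≪l₅ : η * 100 ≤ l₅
    η≪l₅ = chain η l₄ l₅ η≪l₄ l₄≪l₅
    positive : ∀ {l} → η * 100 ≤ l → 1 ≤ l
    positive h = ≤-trans (≤-trans (s≤s z≤n) (≤-trans 2≤η (m≤m*n η 100))) h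

    Side : Set
    Side = ∃[ p ] (p ∈ pts S × InBox (4 * k) (12 * k + η) l₄ p)

    -- A central element fills only boxes that leave the grid under a shift of about 8k. An element
    -- of height about 12k, found in one such box, handles the mirror images for which 8k is too
    -- short.
    side : Central → Side
    side ((t , r) , p∈ , ((t> , t≤) , (r> , r≤))) = pick (2 * l₂) 0 p∈ (central-sum k l₂ t r t≤ r≤)
      (central-coord k t t>) (central-coord k r r>) (twice-ξ η l₂ η≪l₂) (twice-ξk l₂ k l₂≪k) (4 * k) (12 * k + η) l₄
      (side-u n k l₄ 20k≤n l₄≪k) (side-v n k η l₄ 20k≤n l₄≪k 100η≤k) (side-m m k η m-def) (side-l m k η l₄ m-def l₄≪k 100η≤k)
      (inj₂ (side-far n k η r n≤20k+η r>)) (strictly l₂ (positive η≪l₂) (side-big k η l₂ l₄ l₄-large η≪l₂ l₂≪k))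

    complementary : ∀ u l z → u + l + 1 ≤ z → ∃[ u′ ] u + u′ + l + 1 ≡ z
    complementary u l z h = let d , e = m≤n⇒∃[o]m+o≡n h in d , trans (reorder u d l) e

    -- The box at (k , 15k) leaves the grid upwards under translation by the central element. Its
    -- mirror image starts near column z₁ - k ≥ 13k and leaves the grid to the right. The excess 4l₅
    -- of z over 32k keeps the image above the line x + y = m, so both boxes are nearly full.
    wide : ∀ {z₁ z₂} → Central → (z₁ , z₂) ∈ pts S → z₁ ≤ z₂ → 32 * k + 4 * l₅ ≤ z₁ + z₂ → 14 * k ≤ z₁ → ⊥
    wide {z₁} {z₂} ((t , r) , p∈ , ((t> , t≤) , (r> , r≤))) z∈ z₁≤z₂ high 14k≤z₁ =
      go (complementary k l₅ z₁ (open-u k l₅ z₁ 14k≤z₁ l₅≪k 1≤l₅))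
         (complementary (15 * k) l₅ z₂ (open-v k l₅ z₂ (high-z₂ k l₅ z₁ z₂ z₁≤z₂ high) l₅≪k 1≤l₅))
      where
      1≤l₅ : 1 ≤ l₅
      1≤l₅ = positive η≪l₅
      B : ℕ
      B = k * (2 * l₂) * 60 + (0 + 4 * η) * (0 + 4 * η)
      z₁≤n : z₁ ≤ n
      z₁≤n = proj₂ (proj₁ (pts-inBox S z∈))
      z₂≤n : z₂ ≤ n
      z₂≤n = proj₂ (proj₂ (pts-inBox S z∈))
      filled : ∀ u v → u + l₅ ≤ n → v + l₅ ≤ n → m ≤ u + v → u + v + 2 * l₅ ≤ m + m → n ≤ u + t ⊎ n ≤ v + r →
        length (Gaps.gaps S (box u v l₅)) ≤ B
      filled u v = fill (2 * l₂) 0 p∈ (central-sum k l₂ t r t≤ r≤) (central-coord k t t>) (central-coord k r r>)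
        (twice-ξ η l₂ η≪l₂) (twice-ξk l₂ k l₂≪k) u v l₅
      go : ∃[ u ] k + u + l₅ + 1 ≡ z₁ → ∃[ v ] 15 * k + v + l₅ + 1 ≡ z₂ → ⊥
      go (u , e₁) (v , e₂) = <⇒≱ (strictly l₂ (positive η≪l₂) (wide-big k η l₂ l₄ l₅ l₅-large η≪l₂ l₂≪k l₂≪l₄))
        (mirror S k (15 * k) u v l₅ B z∈ e₁ e₂
          (filled k (15 * k) (wide-u k n l₅ 20k≤n l₅≪k) (wide-v k n l₅ 20k≤n l₅≪k) (wide-m k η m m-def)
            (wide-l k η m l₅ m-def l₅≪k 100η≤k) (inj₂ (wide-far k η n r n≤20k+η r> 100η≤k)))
          (filled u v (image-u k u l₅ z₁ n e₁ z₁≤n) (image-u (15 * k) v l₅ z₂ n e₂ z₂≤n)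
            (wide-image-m k η m l₅ u v z₁ z₂ m-def e₁ e₂ high 1≤l₅)
            (wide-image-l k η m l₅ u v z₁ z₂ n m-def e₁ e₂ z₁≤n z₂≤n n≤20k+η 100η≤k)
            (inj₁ (wide-image-far k η l₅ u z₁ n t e₁ 14k≤z₁ n≤20k+η t> (half-of l₅ k l₅≪k) (half-of η k 100η≤k)))))

    -- Now z₂ ≥ 18k, so the box at (7k , 9k) and its mirror image both start in row 9k or higher, up
    -- to lower-order terms. Translation by an element of height above 12k carries both out of the
    -- grid upwards.
    tall : ∀ {z₁ z₂} → Side → (z₁ , z₂) ∈ pts S → 32 * k + 4 * l₅ ≤ z₁ + z₂ → z₁ < 14 * k → ⊥
    tall {z₁} {z₂} ((t , r) , p∈ , ((t> , t≤) , (r> , r≤))) z∈ high z₁<14k =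
      go (complementary (7 * k) l₅ z₁ (tall-open-u k l₅ z₁ (tall-z₁ k η l₅ z₁ z₂ n high z₂≤n n≤20k+η 100η≤k) l₅≪k 1≤l₅))
         (complementary (9 * k) l₅ z₂ (tall-open-v k l₅ z₂ 18k≤z₂ l₅≪k 1≤l₅))
      where
      1≤l₅ : 1 ≤ l₅
      1≤l₅ = positive η≪l₅
      B : ℕ
      B = k * (η + 2 * l₄) * 60 + (0 + 4 * η) * (0 + 4 * η)
      z₁≤n : z₁ ≤ n
      z₁≤n = proj₂ (proj₁ (pts-inBox S z∈))
      z₂≤n : z₂ ≤ n
      z₂≤n = proj₂ (proj₂ (pts-inBox S z∈))
      18k≤z₂ : 18 * k ≤ z₂
      18k≤z₂ = tall-z₂ k l₅ z₁ z₂ z₁<14k high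
      filled : ∀ u v → u + l₅ ≤ n → v + l₅ ≤ n → m ≤ u + v → u + v + 2 * l₅ ≤ m + m → n ≤ u + t ⊎ n ≤ v + r →
        length (Gaps.gaps S (box u v l₅)) ≤ B
      filled u v = fill (η + 2 * l₄) 0 p∈ (side-sum k η l₄ t r t≤ r≤) (left-t k t t>) (side-coord k η r r>)
        (plus-ξ η l₄) (plus-ξk η l₄ k η≪l₄ l₄≪k) u v l₅
      go : ∃[ u ] 7 * k + u + l₅ + 1 ≡ z₁ → ∃[ v ] 9 * k + v + l₅ + 1 ≡ z₂ → ⊥
      go (u , e₁) (v , e₂) = <⇒≱ (strictly l₄ (positive η≪l₄) (tall-big k η l₄ l₅ l₅-large η≪l₄ l₄≪k))
        (mirror S (7 * k) (9 * k) u v l₅ B z∈ e₁ e₂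
          (filled (7 * k) (9 * k) (tall-u k n l₅ 20k≤n l₅≪k) (tall-v k n l₅ 20k≤n l₅≪k) (tall-m k η m m-def)
            (tall-l k η m l₅ m-def l₅≪k 100η≤k) (inj₂ (tall-far k η n r n≤20k+η r>)))
          (filled u v (image-u (7 * k) u l₅ z₁ n e₁ z₁≤n) (image-u (9 * k) v l₅ z₂ n e₂ z₂≤n)
            (tall-image-m k η m l₅ u v z₁ z₂ m-def e₁ e₂ high 1≤l₅)
            (tall-image-l k η m l₅ u v z₁ z₂ n m-def e₁ e₂ z₁≤n z₂≤n n≤20k+η 100η≤k)
            (inj₂ (tall-image-far k η l₅ v z₂ n r e₂ 18k≤z₂ n≤20k+η r> l₅≪k 1≤l₅))))

    upper : ∀ {z₁ z₂} → Central → (z₁ , z₂) ∈ pts S → z₁ ≤ z₂ → 32 * k + 4 * l₅ ≤ z₁ + z₂ → ⊥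
    upper {z₁} {z₂} centre z∈ z₁≤z₂ high = go (14 * k ≤? z₁)
      where
      go : Dec (14 * k ≤ z₁) → ⊥
      go (yes h) = wide centre z∈ z₁≤z₂ high h
      go (no h) = tall (side centre) z∈ high (≰⇒> h)

  -- Choice of constants

  regroup = certify 4 (λ a b ℓ k → [] ⊢ a :* ℓ :* (b :* ℓ) :* k :≡ a :* b :* k :* (ℓ :* ℓ))
    ((1 , []) ∷ (1 , []) ∷ [])
  square = certify 2 (λ c ℓ → [] ⊢ c :* ℓ :* (c :* ℓ) :≡ c :* c :* (ℓ :* ℓ))
    ((1 , []) ∷ (1 , []) ∷ [])
  shift = certify 3 (λ a ℓ k → [] ⊢ a :* ℓ :* k :≡ a :* k :* ℓ)
    ((1 , []) ∷ (1 , []) ∷ [])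

  -- All lengths are powers of h times ℓ. An exponent c following a must satisfy 2c ≥ 32 + a + 1;
  -- starting from a = 0 this is met by 17, 25, 29, 31, still below the exponent 32 of k. The spare
  -- factor h ≥ 1000 absorbs the numerical constants.
  module Powers (h ℓ : ℕ) (1000≤h : 1000 ≤ h) where

    instance
      h≢0 : NonZero h
      h≢0 = >-nonZero (≤-trans (s≤s z≤n) 1000≤h)

    power-step : ∀ a c → a + 1 ≤ c → h ^ a * 1000 ≤ h ^ c
    power-step a c a<c = ≤-trans (*-monoʳ-≤ (h ^ a) 1000≤h) (≤-trans
      (≤-reflexive (trans (cong (h ^ a *_) (sym (^-identityʳ h))) (sym (^-distribˡ-+-* h a 1)))) (^-monoʳ-≤ h a<c))

    quadratic : ∀ a b c → a + b + 1 ≤ c + c → h ^ a * ℓ * (h ^ b * ℓ) * 1000 ≤ h ^ c * ℓ * (h ^ c * ℓ)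
    quadratic a b c a+b<2c = subst₂ _≤_ (sym (regroup (h ^ a) (h ^ b) ℓ 1000)) (sym (square (h ^ c) ℓ))
      (*-monoˡ-≤ (ℓ * ℓ) (subst₂ _≤_ (cong (_* 1000) (^-distribˡ-+-* h a b)) (^-distribˡ-+-* h c c) (power-step (a + b) (c + c) a+b<2c)))

    linear : ∀ a c → a + 1 ≤ c → h ^ a * ℓ * 100 ≤ h ^ c * ℓ
    linear a c a<c = subst (_≤ h ^ c * ℓ) (sym (shift (h ^ a) ℓ 100))
      (*-monoˡ-≤ ℓ (≤-trans (*-monoʳ-≤ (h ^ a) (m≤m+n 100 900)) (power-step a c a<c)))

    ones : ℓ ≡ h ^ 0 * ℓ
    ones = sym (*-identityˡ ℓ)

    scales : Scales (h ^ 32 * ℓ) ℓ (h ^ 17 * ℓ) (h ^ 25 * ℓ) (h ^ 29 * ℓ) (h ^ 31 * ℓ)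
    scales = record
      { κ-large = ≤-trans (*-monoʳ-≤ (h ^ 32 * ℓ * ℓ) (m≤m+n 60 940))
          (subst (λ e → h ^ 32 * ℓ * e * 1000 ≤ h ^ 17 * ℓ * (h ^ 17 * ℓ)) (sym ones) (quadratic 32 0 17 (m≤m+n 33 1)))
      ; l₂-large = quadratic 32 17 25 ≤-refl
      ; l₄-large = quadratic 32 25 29 ≤-refl
      ; l₅-large = quadratic 32 29 31 ≤-refl
      ; η≪κ = subst (λ e → e * 100 ≤ h ^ 17 * ℓ) (sym ones) (linear 0 17 (s≤s z≤n))
      ; κ≪l₂ = linear 17 25 (m≤m+n 18 7)
      ; l₂≪l₄ = linear 25 29 (m≤m+n 26 3)
      ; l₄≪l₅ = linear 29 31 (m≤m+n 30 1)
      ; l₅≪k = linear 31 32 ≤-refl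
      }

  ℓ-large = certify 4 (λ n L ℓ ρ → n :≡ ρ :+ ℓ :* (20 · L) ∷ ρ :< 20 · L ∷ L :* L :* con 5000 :≤ n ∷ con 1 :≤ L ∷
      ℓ :< 100 · L ∷ [] ⊢ absurd)
    ((31 , fwd 0 1 [] ∷ fwd 1 1 [] ∷ fwd 2 1 [] ∷ fwd 3 30 [] ∷ fwd 4 50 (1 ∷ []) ∷ []) ∷ [])
  base-upper = certify 4 (λ n L ℓ ρ → n :≡ ρ :+ ℓ :* (20 · L) ∷ ρ :< 20 · L ∷ 100 · L :≤ ℓ ∷ con 1 :≤ L ∷ []
      ⊢ n :≤ 20 · (L :* ℓ) :+ ℓ)
    ((5 , fwd 0 5 [] ∷ fwd 1 5 [] ∷ fwd 2 1 [] ∷ []) ∷ [])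
  base-lower = certify 4 (λ n L ℓ ρ → n :≡ ρ :+ ℓ :* (20 · L) ∷ [] ⊢ 20 · (L :* ℓ) :≤ n)
    ((1 , bwd 0 1 [] ∷ []) ∷ [])
  base-m = certify 2 (λ L ℓ → con 1 :≤ L ∷ [] ⊢ ℓ :≤ 16 · (L :* ℓ))
    ((1 , fwd 0 1 (1 ∷ []) ∷ []) ∷ [])
  base-m′ = certify 4 (λ m s ℓ q → m :+ ℓ :≡ 16 · q ∷ 16 · q :≤ s :+ ℓ ∷ [] ⊢ m :≤ s)
    ((1 , fwd 0 1 [] ∷ fwd 1 1 [] ∷ []) ∷ [])
  sums-from = certify 5 (λ n R L ℓ s → n :* R :* con 4 :≤ s :* R :* con 5 :+ n :* con 3 ∷ R :≡ 100 · L ∷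
      20 · (L :* ℓ) :≤ n ∷ n :≤ 20 · (L :* ℓ) :+ ℓ ∷ con 1 :≤ L ∷ [] ⊢ R :* (16 · (L :* ℓ)) :≤ R :* (s :+ ℓ))
    ((5 , fwd 0 1 [] ∷ fwd 2 437 [] ∷ fwd 3 440 [] ∷ fwd 2 4 (1 ∷ []) ∷ fwd 4 440 (3 ∷ []) ∷ bwd 1 5 (3 ∷ []) ∷
     []) ∷ [])
  low-from = certify 6 (λ n R L ℓ ρ s → s :* R :* con 5 :≤ n :* R :* con 4 :+ n :* con 11 ∷ R :≡ 100 · L ∷
      n :≡ ρ :+ ℓ :* (20 · L) ∷ ρ :< 20 · L ∷ 100 · L :≤ ℓ ∷ n :≤ 20 · (L :* ℓ) :+ ℓ ∷ con 1 :≤ L ∷ []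
      ⊢ R :* s :≤ R :* (16 · (L :* ℓ) :+ ℓ))
    ((25 , fwd 0 5 [] ∷ bwd 1 11 [] ∷ fwd 2 55 [] ∷ fwd 3 55 [] ∷ bwd 1 15 (3 ∷ []) ∷ fwd 1 400 (2 ∷ []) ∷
     fwd 2 20 (1 ∷ []) ∷ fwd 3 20 (1 ∷ []) ∷ fwd 4 400 (2 ∷ []) ∷ []) ∷ [])
  near-size = certify 3 (λ n L ℓ → n :≤ 20 · (L :* ℓ) :+ ℓ ∷ con 1 :≤ L ∷ [] ⊢ n :≤ 21 · (L :* ℓ))
    ((1 , fwd 0 1 [] ∷ fwd 1 1 (2 ∷ []) ∷ []) ∷ [])
  near-square = certify 2 (λ n q → n :≤ 21 · q ∷ [] ⊢ n :* n :≤ q :* q :* con 441)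
    ((1 , fwd 0 1 (0 ∷ []) ∷ fwd 0 21 (1 ∷ []) ∷ []) ∷ [])
  near-from = certify 5 (λ n N D q ℓ → n :* n :* D :* con 3 :≤ N :* D :* con 5 :+ n :* n ∷
      n :* n :≤ D :* (q :* ℓ) ∷ [] ⊢ D :* (n :* n :* con 3) :≤ D :* (N :* con 5 :+ q :* ℓ))
    ((1 , fwd 0 1 [] ∷ fwd 1 1 [] ∷ []) ∷ [])
  conclusion-low = certify 4 (λ n G R s → n :* R :* con 4 :≤ s :* R :* con 5 :+ n :* con 3 ∷ G :≤ R ∷ []
      ⊢ R :* (n :* G :* con 4) :≤ R :* (s :* G :* con 5 :+ n :* con 5))
    ((1 , fwd 0 1 (1 ∷ []) ∷ fwd 1 3 (0 ∷ []) ∷ []) ∷ [])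
  conclusion-high = certify 5 (λ n G s q l → n :* G :* con 8 :+ n :* con 5 :≤ s :* G :* con 5 ∷ 20 · q :≤ n ∷
      G :* l :≤ q ∷ [] ⊢ G :* (32 · q :+ 4 · l) :≤ G :* s)
    ((5 , fwd 0 1 [] ∷ fwd 1 1 [] ∷ fwd 2 20 [] ∷ fwd 1 8 (1 ∷ []) ∷ []) ∷ [])
  -- Here 441 = 21²: from n ≤ 21k and k = Lℓ follows n² ≤ 441L · kℓ ≤ D · kℓ, so the density
  -- tolerance n²/D is within the kη allowed by `Setup`.
  near-scale = certify 3 (λ L R D → D :≡ R :* R :* con 200 ∷ R :≡ 100 · L ∷ con 1 :≤ L ∷ [] ⊢ L :* con 441 :≤ D)
    ((2000000 , bwd 0 441 [] ∷ bwd 1 8820000 [] ∷ bwd 1 88200 (1 ∷ []) ∷ fwd 2 8820000 (1 ∷ []) ∷ []) ∷ [])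
  near-fits = certify 5 (λ n q L ℓ D → n :* n :≤ q :* q :* con 441 ∷ q :≡ L :* ℓ ∷ L :* con 441 :≤ D ∷ []
      ⊢ n :* n :≤ D :* (q :* ℓ))
    ((1 , fwd 0 1 [] ∷ fwd 1 441 (1 ∷ []) ∷ fwd 2 1 (1 ∷ 3 ∷ []) ∷ []) ∷ [])
  threshold = certify 3 (λ L R n → R :* R :* con 200 :* con 100 :≤ n ∷ R :≡ 100 · L ∷ []
      ⊢ L :* L :* con 5000 :≤ n)
    ((40000 , fwd 0 1 [] ∷ bwd 1 20000 (1 ∷ []) ∷ bwd 1 2000000 (0 ∷ []) ∷ []) ∷ [])

  -- The length ℓ = ⌊n/(20L)⌋ plays the role of η. With R = 100L the supporting line is known up to
  -- a small multiple of n/R, which is about ℓ/5, and the remainder ρ < 20L is at most ℓ/5 as n is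
  -- large compared with R². Hence ℓ covers both errors.
  module Conclude (h G : ℕ) (1000≤h : 1000 ≤ h) (1≤G : 1 ≤ G) (G≤h : G ≤ h) (L R : ℕ) (L≡ : L ≡ h ^ 32) (R≡ : R ≡ 100 * L)
    {n : ℕ} (S : SumFreeSet n n) (n-large : R * R * 200 * 100 ≤ n)
    (near : n * n * (R * R * 200) * 3 ≤ size S * (R * R * 200) * 5 + n * n) where

    1≤L : 1 ≤ L
    1≤L = subst (1 ≤_) (sym L≡) (m^n>0 h {{>-nonZero (≤-trans (s≤s z≤n) 1000≤h)}} 32)
    instance
      20L≢0 : NonZero (20 * L)
      20L≢0 = >-nonZero (≤-trans 1≤L (m≤m+n L (19 * L)))
    1≤R : 1 ≤ R
    1≤R = subst (1 ≤_) (sym R≡) (≤-trans 1≤L (m≤m+n L (99 * L)))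
    12≤R : 12 ≤ R
    12≤R = subst (12 ≤_) (sym R≡) (≤-trans (m≤m+n 12 88) (m≤m*n 100 L {{>-nonZero 1≤L}}))

    extremal : NearExtremal S R
    extremal = near-extremal S R 12≤R n-large near

    open NearExtremal extremal

    ℓ ρ k : ℕ
    ℓ = n / (20 * L)
    ρ = n % (20 * L)
    k = L * ℓ

    n≡ : n ≡ ρ + ℓ * (20 * L)
    n≡ = m≡m%n+[m/n]*n n (20 * L)
    ρ< : ρ < 20 * L
    ρ< = m%n<n n (20 * L)
    100L≤ℓ : 100 * L ≤ ℓ
    100L≤ℓ = ≮⇒≥ (λ h → ℓ-large n L ℓ ρ n≡ ρ< (threshold L R n n-large R≡) 1≤L h)
    20k≤n : 20 * k ≤ n
    20k≤n = base-lower n L ℓ ρ n≡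
    n≤20k+ℓ : n ≤ 20 * k + ℓ
    n≤20k+ℓ = base-upper n L ℓ ρ n≡ ρ< 100L≤ℓ 1≤L
    m : ℕ
    m = 16 * k ∸ ℓ
    m-def : m + ℓ ≡ 16 * k
    m-def = m∸n+n≡m (base-m L ℓ 1≤L)

    scales : Scales k ℓ (h ^ 17 * ℓ) (h ^ 25 * ℓ) (h ^ 29 * ℓ) (h ^ 31 * ℓ)
    scales = subst (λ z → Scales (z * ℓ) ℓ (h ^ 17 * ℓ) (h ^ 25 * ℓ) (h ^ 29 * ℓ) (h ^ 31 * ℓ)) (sym L≡) (Powers.scales h ℓ 1000≤h)

    open Scales scales

    low : ∀ {s} → s * R * 5 ≤ n * R * 4 + n * 11 → s ≤ 16 * k + ℓ
    low {s} b = *-cancel-≤ R s (16 * k + ℓ) 1≤R (low-from n R L ℓ ρ s b R≡ n≡ ρ< 100L≤ℓ n≤20k+ℓ 1≤L)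

    setup : Setup S k ℓ m
    setup = record
      { 20k≤n = 20k≤n
      ; n≤20k+η = n≤20k+ℓ
      ; m-def = m-def
      ; sums = λ {p} p∈ → base-m′ m (proj₁ p + proj₂ p) ℓ k m-def (*-cancel-≤ R (16 * k) (proj₁ p + proj₂ p + ℓ) 1≤R
          (sums-from n R L ℓ (proj₁ p + proj₂ p) (sums p∈) R≡ 20k≤n n≤20k+ℓ 1≤L))
      ; near = *-cancel-≤ (R * R * 200) (n * n * 3) (size S * 5 + k * ℓ) (*-mono-≤ (*-mono-≤ 1≤R 1≤R) (s≤s {n = 199} z≤n))
          (near-from n (size S) (R * R * 200) k ℓ near (near-fits n k L ℓ (R * R * 200)
            (near-square n k (near-size n L ℓ n≤20k+ℓ 1≤L)) refl (near-scale L R (R * R * 200) refl R≡ 1≤L)))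
      ; 2≤η = ≤-trans (≤-trans (m≤m+n 2 98) (m≤m*n 100 L {{>-nonZero 1≤L}})) 100L≤ℓ
      ; 100η≤k = chain ℓ (h ^ 31 * ℓ) k (chain ℓ (h ^ 29 * ℓ) (h ^ 31 * ℓ) (chain ℓ (h ^ 25 * ℓ) (h ^ 29 * ℓ)
          (chain ℓ (h ^ 17 * ℓ) (h ^ 25 * ℓ) η≪κ κ≪l₂) l₂≪l₄) l₄≪l₅) l₅≪k
      }

    Sᵀ : SumFreeSet n n
    Sᵀ = transpose S
    setupᵀ : Setup Sᵀ k ℓ m
    setupᵀ = transposed setup

    swap-central : ∀ (T : SumFreeSet n n) → (∃[ p ] (p ∈ pts T × InBox (8 * k) (8 * k) (h ^ 25 * ℓ) p)) →
      ∃[ p ] (p ∈ pts (transpose T) × InBox (8 * k) (8 * k) (h ^ 25 * ℓ) p)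
    swap-central T (p , p∈ , inBox) = swap p , ∈-transpose T p∈ , swap inBox

    unswap-central : (∃[ p ] (p ∈ pts Sᵀ × InBox (8 * k) (8 * k) (h ^ 25 * ℓ) p)) →
      ∃[ p ] (p ∈ pts S × InBox (8 * k) (8 * k) (h ^ 25 * ℓ) p)
    unswap-central (p , p∈ , inBox) = swap p , ∈-transpose⁻ S p∈ , swap inBox

    central : ∃[ p ] (p ∈ pts S × InBox (8 * k) (8 * k) (h ^ 25 * ℓ) p)
    central = go (4 * k ≤? proj₁ a + h ^ 17 * ℓ) (4 * k ≤? proj₂ b + h ^ 17 * ℓ)
      where
      b-lowᵀ : proj₂ b + proj₁ b ≤ 16 * k + ℓ
      b-lowᵀ = subst (_≤ 16 * k + ℓ) (+-comm (proj₁ b) (proj₂ b)) (low b-low)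
      go : Dec (4 * k ≤ proj₁ a + h ^ 17 * ℓ) → Dec (4 * k ≤ proj₂ b + h ^ 17 * ℓ) →
        ∃[ p ] (p ∈ pts S × InBox (8 * k) (8 * k) (h ^ 25 * ℓ) p)
      go (yes t≥) _ = Centre.centre-left S setup scales a∈ a-left (low a-low) t≥
      go (no _) (yes s≥) = unswap-central (Centre.centre-left Sᵀ setupᵀ scales (∈-transpose S b∈) b-right b-lowᵀ s≥)
      go (no t<) (no s<) = Centre.centre-both S setup scales a∈ b∈ (low a-low) (low b-low) (≰⇒> t<) (≰⇒> s<)

    no-high : ∀ {x y} → (x , y) ∈ pts S → 32 * k + 4 * (h ^ 31 * ℓ) ≤ x + y → ⊥
    no-high {x} {y} p∈ high = go (≤-total x y)
      where
      go : x ≤ y ⊎ y ≤ x → ⊥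
      go (inj₁ x≤y) = Upper.upper S setup scales central p∈ x≤y high
      go (inj₂ y≤x) = Upper.upper Sᵀ setupᵀ scales (swap-central S central) (∈-transpose S p∈) y≤x
        (subst (32 * k + 4 * (h ^ 31 * ℓ) ≤_) (+-comm x y) high)

    -- Translates precision: an excess of n/G ≥ 20k/G over 8n/5 is more than the 4l₅ that the mirror
    -- argument requires, as l₅ is shorter than k by the factor h ≥ G.
    Gl₅≤k : G * (h ^ 31 * ℓ) ≤ k
    Gl₅≤k = ≤-trans (*-monoˡ-≤ (h ^ 31 * ℓ) G≤h) (≤-reflexive (trans (sym (*-assoc h (h ^ 31) ℓ)) (cong (_* ℓ) (sym L≡))))

    G≤R : G ≤ R
    G≤R = ≤-trans G≤h (≤-trans (≤-trans (≤-reflexive (sym (^-identityʳ h))) (^-monoʳ-≤ h {{>-nonZero (≤-trans (s≤s z≤n) 1000≤h)}} (m≤m+n 1 31)))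
      (≤-trans (≤-reflexive (sym L≡)) (≤-trans (m≤m+n L (99 * L)) (≤-reflexive (sym R≡)))))

    lower : ∀ {x y} → (x , y) ∈ pts S → n * G * 4 ≤ (x + y) * G * 5 + n * 5
    lower {x} {y} p∈ = *-cancel-≤ R (n * G * 4) ((x + y) * G * 5 + n * 5) 1≤R (conclusion-low n G R (x + y) (sums p∈) G≤R)

    upper : ∀ {x y} → (x , y) ∈ pts S → (x + y) * G * 5 < n * G * 8 + n * 5
    upper {x} {y} p∈ = ≰⇒> (λ h′ → no-high p∈ (*-cancel-≤ G (32 * k + 4 * (h ^ 31 * ℓ)) (x + y) 1≤G
      (conclusion-high n G (x + y) k (h ^ 31 * ℓ) h′ 20k≤n Gl₅≤k)))

-- Clearing denominators between ℚ and ℕ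

module Rationals where

  open import Defs using (ℕ→ℚ)
  open import Data.Nat as ℕ using (ℕ; suc)
  import Data.Nat.Properties as ℕ
  open import Data.Integer as ℤ using (+_)
  import Data.Integer.Properties as ℤ
  open import Data.Rational
  open import Data.Rational.Properties
  open import Data.Rational.Solver using (module +-*-Solver)
  import Data.Rational.Unnormalised as ℚᵘ
  import Data.Rational.Unnormalised.Properties as ℚᵘ
  open import Relation.Binary.PropositionalEquality using (_≡_; refl; sym; trans; cong; cong₂; subst; subst₂)

  ℕ→ℚᵘ : ℕ → ℚᵘ.ℚᵘ
  ℕ→ℚᵘ a = ℚᵘ.mkℚᵘ (+ a) 0

  unnormalised : ∀ a → toℚᵘ (ℕ→ℚ a) ℚᵘ.≃ ℕ→ℚᵘ a
  unnormalised a = toℚᵘ-fromℚᵘ (ℕ→ℚᵘ a)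

  ℕ→ℚ-+ : ∀ a b → ℕ→ℚ (a ℕ.+ b) ≡ ℕ→ℚ a + ℕ→ℚ b
  ℕ→ℚ-+ a b = toℚᵘ-injective (ℚᵘ.≃-trans (unnormalised (a ℕ.+ b)) (ℚᵘ.≃-trans
    (ℚᵘ.*≡* (trans (ℤ.*-identityʳ (+ (a ℕ.+ b))) (sym (trans (ℤ.*-identityʳ _) (cong₂ ℤ._+_ (ℤ.*-identityʳ (+ a)) (ℤ.*-identityʳ (+ b)))))))
    (ℚᵘ.≃-sym (ℚᵘ.≃-trans (toℚᵘ-homo-+ (ℕ→ℚ a) (ℕ→ℚ b)) (ℚᵘ.+-cong (unnormalised a) (unnormalised b))))))

  ℕ→ℚ-* : ∀ a b → ℕ→ℚ (a ℕ.* b) ≡ ℕ→ℚ a * ℕ→ℚ b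
  ℕ→ℚ-* a b = toℚᵘ-injective (ℚᵘ.≃-trans (unnormalised (a ℕ.* b)) (ℚᵘ.≃-trans
    (ℚᵘ.*≡* (cong (ℤ._* + 1) (ℤ.pos-* a b)))
    (ℚᵘ.≃-sym (ℚᵘ.≃-trans (toℚᵘ-homo-* (ℕ→ℚ a) (ℕ→ℚ b)) (ℚᵘ.*-cong (unnormalised a) (unnormalised b))))))

  ℕ→ℚ-mono-≤ : ∀ {a b} → a ℕ.≤ b → ℕ→ℚ a ≤ ℕ→ℚ b
  ℕ→ℚ-mono-≤ {a} {b} a≤b = toℚᵘ-cancel-≤ (ℚᵘ.≤-respˡ-≃ (ℚᵘ.≃-sym (unnormalised a)) (ℚᵘ.≤-respʳ-≃ (ℚᵘ.≃-sym (unnormalised b))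
    (ℚᵘ.*≤* (ℤ.*-monoʳ-≤-nonNeg (+ 1) (ℤ.+≤+ a≤b)))))

  ℕ→ℚ-mono-< : ∀ {a b} → a ℕ.< b → ℕ→ℚ a < ℕ→ℚ b
  ℕ→ℚ-mono-< {a} {b} a<b = toℚᵘ-cancel-< (ℚᵘ.<-respˡ-≃ (ℚᵘ.≃-sym (unnormalised a)) (ℚᵘ.<-respʳ-≃ (ℚᵘ.≃-sym (unnormalised b))
    (ℚᵘ.*<* (ℤ.*-monoʳ-<-pos (+ 1) (ℤ.+<+ a<b)))))

  ℕ→ℚ-cancel-< : ∀ {a b} → ℕ→ℚ a < ℕ→ℚ b → a ℕ.< b
  ℕ→ℚ-cancel-< {a} {b} h = ℕ.≰⇒> (λ b≤a → <-irrefl refl (<-≤-trans h (ℕ→ℚ-mono-≤ b≤a)))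

  reciprocal : ∀ d .{{_ : ℕ.NonZero d}} → (+ 1 / d) * ℕ→ℚ d ≡ 1ℚ
  reciprocal (suc d) = toℚᵘ-injective (ℚᵘ.≃-trans (toℚᵘ-homo-* (+ 1 / suc d) (ℕ→ℚ (suc d)))
    (ℚᵘ.≃-trans (ℚᵘ.*-cong (toℚᵘ-fromℚᵘ (ℚᵘ.mkℚᵘ (+ 1) d)) (unnormalised (suc d)))
      (ℚᵘ.*≡* (cong +_ (cong suc (trans (cong (ℕ._* 1) (ℕ.+-identityʳ d)) (trans (ℕ.*-identityʳ d) (sym (trans (ℕ.+-identityʳ _) (ℕ.*-identityʳ d))))))))))

  positive-ℕ→ℚ : ∀ d .{{_ : ℕ.NonZero d}} → Positive (ℕ→ℚ d)
  positive-ℕ→ℚ (suc d) = positive (ℕ→ℚ-mono-< {0} {suc d} (ℕ.s≤s ℕ.z≤n))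

  nonNegative-ℕ→ℚ : ∀ d → NonNegative (ℕ→ℚ d)
  nonNegative-ℕ→ℚ d = nonNegative (ℕ→ℚ-mono-≤ {0} {d} ℕ.z≤n)

  positive-reciprocal : ∀ d .{{_ : ℕ.NonZero d}} → 0ℚ < + 1 / d
  positive-reciprocal (suc d) = positive⁻¹ (+ 1 / suc d) {{normalize-pos 1 (suc d)}}

  -- A positive fraction has numerator at least 1. This lets the denominator of γ serve as the
  -- precision G, so that 1/G replaces γ in all integer estimates.
  reciprocal-below : ∀ γ → 0ℚ < γ → (+ 1 / ↧ₙ γ) ≤ γ
  reciprocal-below γ@(mkℚ (+ suc p) d _) _ = toℚᵘ-cancel-≤ (ℚᵘ.≤-respˡ-≃ (ℚᵘ.≃-sym (toℚᵘ-fromℚᵘ (ℚᵘ.mkℚᵘ (+ 1) d)))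
    (ℚᵘ.*≤* (ℤ.*-monoʳ-≤-nonNeg (+ suc d) {+ 1} {+ suc p} (ℤ.+≤+ (ℕ.s≤s ℕ.z≤n)))))
  reciprocal-below (mkℚ (+ 0) _ _) (*<* (ℤ.+<+ ()))
  reciprocal-below (mkℚ (ℤ.-[1+_] _) _ _) (*<* ())

  open +-*-Solver

  -- With δ = 1/(5D), multiplication by 5D clears both 3/5 and δ, and adding n² to both sides
  -- removes the subtraction.
  density-in-ℕ : ∀ D n N .{{_ : ℕ.NonZero D}} .{{_ : ℕ.NonZero (5 ℕ.* D)}} →
    ((+ 3 / 5) - (+ 1 / (5 ℕ.* D))) * (ℕ→ℚ n * ℕ→ℚ n) < ℕ→ℚ N →
    n ℕ.* n ℕ.* D ℕ.* 3 ℕ.≤ N ℕ.* D ℕ.* 5 ℕ.+ n ℕ.* n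
  density-in-ℕ D n N h = ℕ.<⇒≤ (ℕ→ℚ-cancel-< (subst₂ _<_ left right
    (+-monoˡ-< (ℕ→ℚ n * ℕ→ℚ n) (*-monoˡ-<-pos (ℕ→ℚ (5 ℕ.* D)) {{positive-ℕ→ℚ (5 ℕ.* D)}} h))))
    where
    δ n′ D′ N′ : ℚ
    δ = + 1 / (5 ℕ.* D)
    n′ = ℕ→ℚ n
    D′ = ℕ→ℚ D
    N′ = ℕ→ℚ N
    expand : ∀ a δ n D E → (a - δ) * (n * n) * E + n * n ≡ (a * E) * (n * n) - (δ * E) * (n * n) + n * n
    expand = solve 5 (λ a δ n D E → (a :- δ) :* (n :* n) :* E :+ n :* n := (a :* E) :* (n :* n) :- (δ :* E) :* (n :* n) :+ n :* n) refl
    collect : ∀ t q → t * q - 1ℚ * q + q ≡ t * q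
    collect t q = trans (cong (λ z → t * q - z + q) (*-identityˡ q)) (solve 2 (λ t q → t :* q :- q :+ q := t :* q) refl t q)
    three-fifths : (+ 3 / 5) * ℕ→ℚ (5 ℕ.* D) ≡ ℕ→ℚ 3 * D′
    three-fifths = trans (cong ((+ 3 / 5) *_) (ℕ→ℚ-* 5 D)) (sym (*-assoc (+ 3 / 5) (ℕ→ℚ 5) D′))
    left : ((+ 3 / 5) - δ) * (n′ * n′) * ℕ→ℚ (5 ℕ.* D) + n′ * n′ ≡ ℕ→ℚ (n ℕ.* n ℕ.* D ℕ.* 3)
    left = trans (expand (+ 3 / 5) δ n′ D′ (ℕ→ℚ (5 ℕ.* D))) (trans
      (cong₂ (λ x y → x * (n′ * n′) - y * (n′ * n′) + n′ * n′) three-fifths (reciprocal (5 ℕ.* D)))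
      (trans (collect (ℕ→ℚ 3 * D′) (n′ * n′)) (trans (solve 3 (λ t d q → t :* d :* q := q :* d :* t) refl (ℕ→ℚ 3) D′ (n′ * n′))
        (sym (trans (ℕ→ℚ-* (n ℕ.* n ℕ.* D) 3) (cong (_* ℕ→ℚ 3) (trans (ℕ→ℚ-* (n ℕ.* n) D) (cong (_* D′) (ℕ→ℚ-* n n)))))))))
    right : N′ * ℕ→ℚ (5 ℕ.* D) + n′ * n′ ≡ ℕ→ℚ (N ℕ.* D ℕ.* 5 ℕ.+ n ℕ.* n)
    right = sym (trans (ℕ→ℚ-+ (N ℕ.* D ℕ.* 5) (n ℕ.* n)) (cong₂ _+_
      (trans (ℕ→ℚ-* (N ℕ.* D) 5) (trans (cong (_* ℕ→ℚ 5) (ℕ→ℚ-* N D)) (trans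
        (solve 3 (λ n d f → n :* d :* f := n :* (f :* d)) refl N′ D′ (ℕ→ℚ 5)) (cong (N′ *_) (sym (ℕ→ℚ-* 5 D))))))
      (ℕ→ℚ-* n n)))

  clear : ∀ x G → ℕ→ℚ (x ℕ.* G ℕ.* 5) ≡ ℕ→ℚ x * ℕ→ℚ (5 ℕ.* G)
  clear x G = trans (ℕ→ℚ-* (x ℕ.* G) 5) (trans (cong (_* ℕ→ℚ 5) (ℕ→ℚ-* x G))
    (trans (solve 3 (λ x g f → x :* g :* f := x :* (f :* g)) refl (ℕ→ℚ x) (ℕ→ℚ G) (ℕ→ℚ 5)) (cong (ℕ→ℚ x *_) (sym (ℕ→ℚ-* 5 G)))))

  clear-fraction : ∀ p k n G → p * ℕ→ℚ 5 ≡ ℕ→ℚ k → ℕ→ℚ (n ℕ.* G ℕ.* k) ≡ p * ℕ→ℚ n * ℕ→ℚ (5 ℕ.* G)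
  clear-fraction p k n G e = trans (ℕ→ℚ-* (n ℕ.* G) k) (trans (cong₂ _*_ (ℕ→ℚ-* n G) (sym e))
    (trans (solve 4 (λ n g p f → n :* g :* (p :* f) := p :* n :* (f :* g)) refl (ℕ→ℚ n) (ℕ→ℚ G) p (ℕ→ℚ 5))
      (cong (p * ℕ→ℚ n *_) (sym (ℕ→ℚ-* 5 G)))))

  clear-reciprocal : ∀ n G .{{_ : ℕ.NonZero G}} → ℕ→ℚ (n ℕ.* 5) ≡ (+ 1 / G) * ℕ→ℚ n * ℕ→ℚ (5 ℕ.* G)
  clear-reciprocal n G = trans (ℕ→ℚ-* n 5) (sym (trans (cong ((+ 1 / G) * ℕ→ℚ n *_) (ℕ→ℚ-* 5 G))
    (trans (solve 4 (λ r n f g → r :* n :* (f :* g) := (r :* g) :* (n :* f)) refl (+ 1 / G) (ℕ→ℚ n) (ℕ→ℚ 5) (ℕ→ℚ G))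
      (trans (cong (_* (ℕ→ℚ n * ℕ→ℚ 5)) (reciprocal G)) (*-identityˡ (ℕ→ℚ n * ℕ→ℚ 5))))))

  lower-in-ℚ : ∀ γ G n s .{{_ : ℕ.NonZero G}} .{{_ : ℕ.NonZero (5 ℕ.* G)}} → (+ 1 / G) ≤ γ →
    n ℕ.* G ℕ.* 4 ℕ.≤ s ℕ.* G ℕ.* 5 ℕ.+ n ℕ.* 5 → (+ 4 / 5) * ℕ→ℚ n - γ * ℕ→ℚ n ≤ ℕ→ℚ s
  lower-in-ℚ γ G n s 1/G≤γ h = subst ((+ 4 / 5) * ℕ→ℚ n - γ * ℕ→ℚ n ≤_)
    (solve 2 (λ s q → (s :+ q) :- q := s) refl (ℕ→ℚ s) (γ * ℕ→ℚ n))
    (+-monoˡ-≤ (- (γ * ℕ→ℚ n)) (≤-trans base (+-monoʳ-≤ (ℕ→ℚ s) (*-monoʳ-≤-nonNeg (ℕ→ℚ n) {{nonNegative-ℕ→ℚ n}} 1/G≤γ))))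
    where
    base : (+ 4 / 5) * ℕ→ℚ n ≤ ℕ→ℚ s + (+ 1 / G) * ℕ→ℚ n
    base = *-cancelʳ-≤-pos (ℕ→ℚ (5 ℕ.* G)) {{positive-ℕ→ℚ (5 ℕ.* G)}} (subst₂ _≤_ (clear-fraction (+ 4 / 5) 4 n G refl)
      (trans (ℕ→ℚ-+ (s ℕ.* G ℕ.* 5) (n ℕ.* 5)) (trans (cong₂ _+_ (clear s G) (clear-reciprocal n G))
        (sym (*-distribʳ-+ (ℕ→ℚ (5 ℕ.* G)) (ℕ→ℚ s) ((+ 1 / G) * ℕ→ℚ n))))) (ℕ→ℚ-mono-≤ h))

  upper-in-ℚ : ∀ γ G n s .{{_ : ℕ.NonZero G}} .{{_ : ℕ.NonZero (5 ℕ.* G)}} → (+ 1 / G) ≤ γ →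
    s ℕ.* G ℕ.* 5 ℕ.< n ℕ.* G ℕ.* 8 ℕ.+ n ℕ.* 5 → ℕ→ℚ s < (+ 8 / 5) * ℕ→ℚ n + γ * ℕ→ℚ n
  upper-in-ℚ γ G n s 1/G≤γ h = <-≤-trans base
    (+-monoʳ-≤ ((+ 8 / 5) * ℕ→ℚ n) (*-monoʳ-≤-nonNeg (ℕ→ℚ n) {{nonNegative-ℕ→ℚ n}} 1/G≤γ))
    where
    base : ℕ→ℚ s < (+ 8 / 5) * ℕ→ℚ n + (+ 1 / G) * ℕ→ℚ n
    base = *-cancelʳ-<-nonNeg (ℕ→ℚ (5 ℕ.* G)) {{nonNegative-ℕ→ℚ (5 ℕ.* G)}} (subst₂ _<_ (clear s G)
      (trans (ℕ→ℚ-+ (n ℕ.* G ℕ.* 8) (n ℕ.* 5)) (trans (cong₂ _+_ (clear-fraction (+ 8 / 5) 8 n G refl) (clear-reciprocal n G))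
        (sym (*-distribʳ-+ (ℕ→ℚ (5 ℕ.* G)) ((+ 8 / 5) * ℕ→ℚ n) ((+ 1 / G) * ℕ→ℚ n))))) (ℕ→ℚ-mono-< h))

-- Stability in the rational formulation

open import Defs
open import Data.Nat as ℕ using (ℕ)
open import Data.Product using (_×_; _,_; ∃-syntax)
open import Data.List.Membership.Propositional using (_∈_)
open import Data.Rational using (ℚ; 0ℚ; _<_; _≤_; _+_; _-_; _*_; _/_)
open import Data.Integer using (+_)
open import Data.Rational using (↧ₙ_)
import Data.Nat.Properties as ℕ
open import Relation.Binary.PropositionalEquality using (_≡_; refl; sym; subst)
open SumFreeSets using (SumFreeSet; module Conclude)
open Rationals

sumFreeSet : ∀ {n} (S : GridSet n) → SumFree S → SumFreeSet n n
sumFreeSet S sumFree = record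
  { pts = elems S
  ; pts-unique = unique S
  ; pts-inBox = inGrid S
  ; pts-sumFree = λ x∈ y∈ s∈ → sumFree x∈ y∈ s∈ refl
  }

-- The constants `L`, `R` and `D` are parameters tied by equations, so that the high power of h
-- stays symbolic in the argument.
theorem-for : (γ : ℚ) → 0ℚ < γ → ∀ h L R D → 1000 ℕ.≤ h → ↧ₙ γ ℕ.≤ h → L ≡ h ℕ.^ 32 → R ≡ 100 ℕ.* L → D ≡ R ℕ.* R ℕ.* 200 →
  .{{_ : ℕ.NonZero D}} → .{{_ : ℕ.NonZero (5 ℕ.* D)}} →
  ∃[ δ ] (0ℚ < δ × ∃[ n₀ ] (∀ (n : ℕ) → n₀ ℕ.< n → (S : GridSet n) → SumFree S →
    ((+ 3 / 5) - δ) * (ℕ→ℚ n * ℕ→ℚ n) < ℕ→ℚ (card S) →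
    ∀ {x y} → (x , y) ∈ elems S →
    ((+ 4 / 5) * ℕ→ℚ n - γ * ℕ→ℚ n ≤ ℕ→ℚ (x ℕ.+ y))
    × (ℕ→ℚ (x ℕ.+ y) < (+ 8 / 5) * ℕ→ℚ n + γ * ℕ→ℚ n)))
theorem-for γ 0<γ h L R D 1000≤h G≤h L≡ R≡ refl =
  -- The threshold n₀ = 100D makes every boundary term of order n smaller than the tolerance n²/D.
  + 1 / (5 ℕ.* D) , positive-reciprocal (5 ℕ.* D) , D ℕ.* 100 , λ n n₀<n S sumFree dense {x} {y} p∈ →
    lower-in-ℚ γ (↧ₙ γ) n (x ℕ.+ y) (reciprocal-below γ 0<γ)
      (Conclude.lower h (↧ₙ γ) 1000≤h (ℕ.s≤s ℕ.z≤n) G≤h L R L≡ R≡ (sumFreeSet S sumFree) (ℕ.<⇒≤ n₀<n)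
        (density-in-ℕ D n (card S) dense) p∈) ,
    upper-in-ℚ γ (↧ₙ γ) n (x ℕ.+ y) (reciprocal-below γ 0<γ)
      (Conclude.upper h (↧ₙ γ) 1000≤h (ℕ.s≤s ℕ.z≤n) G≤h L R L≡ R≡ (sumFreeSet S sumFree) (ℕ.<⇒≤ n₀<n)
        (density-in-ℕ D n (card S) dense) p∈)

theorem1p2 : (γ : ℚ) → 0ℚ < γ →
    ∃[ δ ] (0ℚ < δ × ∃[ n₀ ] (∀ (n : ℕ) → n₀ ℕ.< n → (S : GridSet n) → SumFree S →
    ((+ 3 / 5) - δ) * (ℕ→ℚ n * ℕ→ℚ n) < ℕ→ℚ (card S) →
    ∀ {x y} → (x , y) ∈ elems S →
    ((+ 4 / 5) * ℕ→ℚ n - γ * ℕ→ℚ n ≤ ℕ→ℚ (x ℕ.+ y))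
    × (ℕ→ℚ (x ℕ.+ y) < (+ 8 / 5) * ℕ→ℚ n + γ * ℕ→ℚ n)))
-- The base h must be at least the denominator of γ for the final precision, and at least 1000 to
-- separate the scales.
theorem1p2 γ 0<γ = at-scale (↧ₙ γ ℕ.+ 1000) (ℕ.m≤n+m 1000 (↧ₙ γ)) (ℕ.m≤m+n (↧ₙ γ) 1000)
  where
  at-scale : ∀ h → 1000 ℕ.≤ h → ↧ₙ γ ℕ.≤ h → _
  at-scale h 1000≤h G≤h = theorem-for γ 0<γ h (h ℕ.^ 32) R (R ℕ.* R ℕ.* 200) 1000≤h G≤h refl refl refl
    {{D≢0}} {{ℕ.m*n≢0 5 (R ℕ.* R ℕ.* 200) {{_}} {{D≢0}}}}
    where
    R : ℕ
    R = 100 ℕ.* h ℕ.^ 32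
    R≢0 : ℕ.NonZero R
    R≢0 = ℕ.m*n≢0 100 (h ℕ.^ 32) {{_}} {{ℕ.m^n≢0 h 32 {{ℕ.>-nonZero (ℕ.≤-trans (ℕ.s≤s ℕ.z≤n) 1000≤h)}}}}
    D≢0 : ℕ.NonZero (R ℕ.* R ℕ.* 200)
    D≢0 = ℕ.m*n≢0 (R ℕ.* R) 200 {{ℕ.m*n≢0 R R {{R≢0}} {{R≢0}}}}
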